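{- Let $r,m,p$ be positive integers. Then $$\zeta\bigl(\{1\}_r\circledast(1,\{\{1\}_{m-1},2\}_{p-1},\{1\}_m)^\star\bigr)=\sum_{n=1}^\infty \frac{\zeta_{n-1}(\{1\}_{r-1})\,\zeta_n^\star\bigl(\{\{1\}_{m-1},2\}_{p-1},\{1\}_m\bigr)}{n^2}\in\mathbb{Q}[\text{Riemann zeta values}],$$ i.e. this number is a polynomial with rational coefficients in the values $\zeta(2),\zeta(3),\zeta(4),\ldots$.
   Context: For a finite sequence (index) of positive integers $(k_1,\ldots,k_r)$ and $n\ge 0$, $\zeta_n(k_1,\ldots,k_r)=\sum_{n\ge n_1>\cdots>n_r\ge1}\prod_j n_j^{ -k_j}$ and $\zeta_n^\star(k_1,\ldots,k_r)=\sum_{n\ge n_1\ge\cdots\ge n_r\ge1}\prod_j n_j^{ -k_j}$, with $\zeta_n(\emptyset)=\zeta_n^\star(\emptyset)=1$. The Kaneko–Yamamoto multiple zeta value of indices $\mathbf k=(k_1,\ldots,k_r)$, $\mathbf l=(l_1,\ldots,l_s)$ is $$\zeta(\mathbf k\circledast\mathbf l^\star)=\sum_{n=1}^\infty\frac{\zeta_{n-1}(k_2,\ldots,k_r)\,\zeta_n^\star(l_2,\ldots,l_s)}{n^{k_1+l_1}}.$$ The notation $\{s_1,\ldots,s_j\}_d$ denotes the sequence $s_1,\ldots,s_j$ repeated $d$ times (empty if $d=0$); e.g. $\{\{1\}_{m-1},2\}_{p-1}$ is the block $(\underbrace{1,\ldots,1}_{m-1},2)$ repeated $p-1$ times. -}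

module Defs where

open import Data.Nat.Base as ℕ using (ℕ; zero; suc; pred; NonTrivial)
import Data.Nat.Properties as ℕ
open import Data.Integer.Base as ℤ using (+_; +[1+_])
import Data.Integer.Properties as ℤ
import Data.Integer.Solver as ℤ-Solver
open import Data.List.Base using (List; []; _∷_; _++_; replicate; concat)
open import Data.List.NonEmpty.Base using (List⁺; _∷_)
open import Data.Product.Base using (∃-syntax; _×_; _,_; proj₁; proj₂)
open import Data.Rational
import Data.Rational.Properties as ℚ
import Data.Rational.Solver as ℚ-Solver
open import Data.Rational.Unnormalised.Base as ℚᵘ using (ℚᵘ; mkℚᵘ; *≡*; *<*; *≤*)
import Data.Rational.Unnormalised.Properties as ℚᵘ
open import Data.Sum.Base using (inj₁; inj₂)
open import Relation.Binary.PropositionalEquality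

Cauchy : (ℕ → ℚ) → Set
Cauchy x = ∀ ε → 0ℚ < ε → ∃[ N ] ∀ m n → N ℕ.≤ m → N ℕ.≤ n → ∣ x m - x n ∣ < ε

record ℝ : Set where
  constructor mkℝ
  field
    seq    : ℕ → ℚ
    cauchy : Cauchy seq

open ℝ public

infix 4 _≃ℝ_

_≃ℝ_ : ℝ → ℝ → Set
x ≃ℝ y = ∀ ε → 0ℚ < ε → ∃[ N ] ∀ n → N ℕ.≤ n → ∣ seq x n - seq y n ∣ < ε

module CauchyProperties where

  private module QS = ℚ-Solver.+-*-Solver

  half-pos : ∀ ε → 0ℚ < ε → 0ℚ < ½ * ε
  half-pos ε ε>0 =
    ℚ.positive⁻¹ (½ * ε) {{ℚ.pos*pos⇒pos ½ ε {{positive ε>0}}}}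

  half+half : ∀ ε → ½ * ε + ½ * ε ≡ ε
  half+half ε = trans (sym (ℚ.*-distribʳ-+ ε ½ ½)) (ℚ.*-identityˡ ε)

  Bounded : (ℕ → ℚ) → Set
  Bounded x = ∃[ B ] (0ℚ < B × ∃[ N ] ∀ n → N ℕ.≤ n → ∣ x n ∣ ≤ B)

  cauchy⇒bounded : ∀ x → Cauchy x → Bounded x
  cauchy⇒bounded x c with c 1ℚ (ℚ.positive⁻¹ 1ℚ)
  ... | N , h = 1ℚ + ∣ x N ∣ , B>0 , N , bound
    where
    B>0 : 0ℚ < 1ℚ + ∣ x N ∣
    B>0 = ℚ.+-mono-<-≤ (ℚ.positive⁻¹ 1ℚ) (ℚ.0≤∣p∣ (x N))

    bound : ∀ n → N ℕ.≤ n → ∣ x n ∣ ≤ 1ℚ + ∣ x N ∣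
    bound n N≤n = begin
      ∣ x n ∣                    ≡⟨ cong ∣_∣ (solve 2 (λ a b → a := (a :- b) :+ b) refl (x n) (x N)) ⟩
      ∣ (x n - x N) + x N ∣      ≤⟨ ℚ.∣p+q∣≤∣p∣+∣q∣ (x n - x N) (x N) ⟩
      ∣ x n - x N ∣ + ∣ x N ∣    ≤⟨ ℚ.+-monoˡ-≤ ∣ x N ∣ (ℚ.<⇒≤ (h n N N≤n ℕ.≤-refl)) ⟩
      1ℚ + ∣ x N ∣               ∎
      where open ℚ.≤-Reasoning
            open QS

  const-cauchy : ∀ q → Cauchy (λ _ → q)
  const-cauchy q ε ε>0 = 0 , λ _ _ _ _ →
    subst (λ t → ∣ t ∣ < ε) (sym (ℚ.+-inverseʳ q)) ε>0

  +-cauchy : ∀ x y → Cauchy x → Cauchy y → Cauchy (λ n → x n + y n)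
  +-cauchy x y cx cy ε ε>0
    with cx (½ * ε) (half-pos ε ε>0) | cy (½ * ε) (half-pos ε ε>0)
  ... | M , hx | N , hy = M ℕ.⊔ N , λ m n m≥ n≥ → begin-strict
      ∣ (x m + y m) - (x n + y n) ∣
        ≡⟨ cong ∣_∣ (solve 4 (λ a b c d → (a :+ b) :- (c :+ d) := (a :- c) :+ (b :- d)) refl
                      (x m) (y m) (x n) (y n)) ⟩
      ∣ (x m - x n) + (y m - y n) ∣
        ≤⟨ ℚ.∣p+q∣≤∣p∣+∣q∣ (x m - x n) (y m - y n) ⟩
      ∣ x m - x n ∣ + ∣ y m - y n ∣
        <⟨ ℚ.+-mono-< (hx m n (ℕ.m⊔n≤o⇒m≤o M N m≥) (ℕ.m⊔n≤o⇒m≤o M N n≥))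
                      (hy m n (ℕ.m⊔n≤o⇒n≤o M N m≥) (ℕ.m⊔n≤o⇒n≤o M N n≥)) ⟩
      ½ * ε + ½ * ε
        ≡⟨ half+half ε ⟩
      ε ∎
    where open ℚ.≤-Reasoning
          open QS

  recip : ∀ B → 0ℚ < B → ∃[ C ] (0ℚ < C × B * C ≡ 1ℚ)
  recip B B>0 = (1/ B) {{B≢0}} , ℚ.positive⁻¹ _ {{ℚ.1/pos⇒pos B {{B-pos}}}} , ℚ.*-inverseʳ B {{B≢0}}
    where
    B-pos = positive B>0
    B≢0   = ℚ.pos⇒nonZero B {{B-pos}}

  pos*pos : ∀ p q → 0ℚ < p → 0ℚ < q → 0ℚ < p * q
  pos*pos p q p>0 q>0 = ℚ.positive⁻¹ (p * q)
    {{ℚ.pos*pos⇒pos p {{positive p>0}} q {{positive q>0}}}}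

  *-bound : ∀ B C δ b t → 0ℚ < B → B * C ≡ 1ℚ → ∣ b ∣ ≤ B → ∣ t ∣ < C * δ → ∣ b * t ∣ < δ
  *-bound B C δ b t B>0 BC≡1 b≤ t< = begin-strict
    ∣ b * t ∣        ≡⟨ ℚ.∣p*q∣≡∣p∣*∣q∣ b t ⟩
    ∣ b ∣ * ∣ t ∣    ≤⟨ ℚ.*-monoʳ-≤-nonNeg ∣ t ∣ {{ℚ.∣-∣-nonNeg t}} b≤ ⟩
    B * ∣ t ∣        <⟨ ℚ.*-monoʳ-<-pos B {{positive B>0}} t< ⟩
    B * (C * δ)      ≡⟨ sym (ℚ.*-assoc B C δ) ⟩
    B * C * δ        ≡⟨ cong (_* δ) BC≡1 ⟩
    1ℚ * δ           ≡⟨ ℚ.*-identityˡ δ ⟩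
    δ                ∎
    where open ℚ.≤-Reasoning

  *-diff : ∀ a b c d → a * b - c * d ≡ a * (b - d) + d * (a - c)
  *-diff = solve 4 (λ a b c d → a :* b :- c :* d := a :* (b :- d) :+ d :* (a :- c)) refl
    where open QS

  *-close : ∀ a b c d δ → ∣ a * (b - d) ∣ < δ → ∣ d * (a - c) ∣ < δ →
            ∣ a * b - c * d ∣ < δ + δ
  *-close a b c d δ h₁ h₂ = begin-strict
    ∣ a * b - c * d ∣                      ≡⟨ cong ∣_∣ (*-diff a b c d) ⟩
    ∣ a * (b - d) + d * (a - c) ∣          ≤⟨ ℚ.∣p+q∣≤∣p∣+∣q∣ (a * (b - d)) (d * (a - c)) ⟩
    ∣ a * (b - d) ∣ + ∣ d * (a - c) ∣      <⟨ ℚ.+-mono-< h₁ h₂ ⟩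
    δ + δ                                  ∎
    where open ℚ.≤-Reasoning

  *-cauchy : ∀ x y → Cauchy x → Cauchy y → Cauchy (λ n → x n * y n)
  *-cauchy x y cx cy ε ε>0 =
    let δ   = ½ * ε
        δ>0 = half-pos ε ε>0
        A , A>0 , M₁ , hA = cauchy⇒bounded x cx
        D , D>0 , N₁ , hD = cauchy⇒bounded y cy
        A′ , A′>0 , AA′≡1 = recip A A>0
        D′ , D′>0 , DD′≡1 = recip D D>0
        M₂ , hx = cx (D′ * δ) (pos*pos D′ δ D′>0 δ>0)
        N₂ , hy = cy (A′ * δ) (pos*pos A′ δ A′>0 δ>0)
    in (M₁ ℕ.⊔ N₁) ℕ.⊔ (M₂ ℕ.⊔ N₂) , λ m n m≥ n≥ →
    let m≥₁ = ℕ.m⊔n≤o⇒m≤o (M₁ ℕ.⊔ N₁) (M₂ ℕ.⊔ N₂) m≥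
        m≥₂ = ℕ.m⊔n≤o⇒n≤o (M₁ ℕ.⊔ N₁) (M₂ ℕ.⊔ N₂) m≥
        n≥₁ = ℕ.m⊔n≤o⇒m≤o (M₁ ℕ.⊔ N₁) (M₂ ℕ.⊔ N₂) n≥
        n≥₂ = ℕ.m⊔n≤o⇒n≤o (M₁ ℕ.⊔ N₁) (M₂ ℕ.⊔ N₂) n≥
    in subst (∣ x m * y m - x n * y n ∣ <_) (half+half ε)
         (*-close (x m) (y m) (x n) (y n) δ
           (*-bound A A′ δ (x m) (y m - y n) A>0 AA′≡1 (hA m (ℕ.m⊔n≤o⇒m≤o M₁ N₁ m≥₁))
             (hy m n (ℕ.m⊔n≤o⇒n≤o M₂ N₂ m≥₂) (ℕ.m⊔n≤o⇒n≤o M₂ N₂ n≥₂)))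
           (*-bound D D′ δ (y n) (x m - x n) D>0 DD′≡1 (hD n (ℕ.m⊔n≤o⇒n≤o M₁ N₁ n≥₁))
             (hx m n (ℕ.m⊔n≤o⇒m≤o M₂ N₂ m≥₂) (ℕ.m⊔n≤o⇒m≤o M₂ N₂ n≥₂))))

infixl 6 _+ℝ_
infixl 7 _*ℝ_

fromℚ : ℚ → ℝ
fromℚ q = mkℝ (λ _ → q) (CauchyProperties.const-cauchy q)

_+ℝ_ : ℝ → ℝ → ℝ
x +ℝ y = mkℝ (λ n → seq x n + seq y n) (CauchyProperties.+-cauchy (seq x) (seq y) (cauchy x) (cauchy y))

_*ℝ_ : ℝ → ℝ → ℝ
x *ℝ y = mkℝ (λ n → seq x n * seq y n) (CauchyProperties.*-cauchy (seq x) (seq y) (cauchy x) (cauchy y))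

∑ : ℕ → ((i : ℕ) .{{_ : ℕ.NonZero i}} → ℚ) → ℚ
∑ zero    f = 0ℚ
∑ (suc n) f = ∑ n f + f (suc n)

infix 4 _SumsTo_

-- Convergence is part of the claim: c says that the partial sums are Cauchy.
_SumsTo_ : ((i : ℕ) .{{_ : ℕ.NonZero i}} → ℚ) → ℝ → Set
f SumsTo x = ∃[ c ] mkℝ (λ n → ∑ n f) c ≃ℝ x

infix 8 1/_^_

1/_^_ : (n k : ℕ) .{{_ : ℕ.NonZero n}} → ℚ
1/ n ^ k = (+ 1 / (n ℕ.^ k)) {{ℕ.m^n≢0 n k}}

-- For k ≥ 2 the partial sums S increase while S(n) + 1/n decreases.
module ζ-Convergence where

  inv : ℕ → ℚ
  inv n = + 1 / suc n

  toℚᵘ-/ : ∀ n → toℚᵘ (inv n) ℚᵘ.≃ mkℚᵘ (+ 1) n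
  toℚᵘ-/ n = ℚ.toℚᵘ-fromℚᵘ (mkℚᵘ (+ 1) n)

  inv-pos : ∀ n → 0ℚ < inv n
  inv-pos n = ℚ.positive⁻¹ (inv n) {{ℚ.normalize-pos 1 (suc n)}}

  inv-small : ∀ ε → 0ℚ < ε → ∃[ N ] inv N < ε
  inv-small ε@(mkℚ +[1+ a ] d _) _ = suc d , ℚ.toℚᵘ-cancel-<
    (ℚᵘ.<-respˡ-≃ (ℚᵘ.≃-sym (toℚᵘ-/ (suc d)))
      (*<* (ℤ.+<+ (ℕ.≤-trans (ℕ.≤-reflexive (cong suc (ℕ.*-identityˡ (suc d))))
                             (ℕ.m≤m+n (suc (suc d)) (a ℕ.* suc (suc d)))))))
  inv-small (mkℚ (+ 0) d _) (*<* (ℤ.+<+ ()))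
  inv-small (mkℚ (ℤ.-[1+ a ]) d _) (*<* ())

  recip-anti : ∀ a b .{{_ : ℕ.NonZero a}} .{{_ : ℕ.NonZero b}} → b ℕ.≤ a → + 1 / a ≤ + 1 / b
  recip-anti (suc a) (suc b) b≤a = ℚ.toℚᵘ-cancel-≤
    (ℚᵘ.≤-respʳ-≃ (ℚᵘ.≃-sym (toℚᵘ-/ b)) (ℚᵘ.≤-respˡ-≃ (ℚᵘ.≃-sym (toℚᵘ-/ a))
      (*≤* (ℤ.*-monoˡ-≤-nonNeg (+ 1) (ℤ.+≤+ b≤a)))))

  telescope : ∀ n → + 1 / (suc n ℕ.* suc (suc n)) + inv (suc n) ≡ inv n
  telescope n = ℚ.toℚᵘ-injective (begin
    toℚᵘ (+ 1 / (suc n ℕ.* suc (suc n)) + inv (suc n))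
      ≈⟨ ℚ.toℚᵘ-homo-+ (+ 1 / (suc n ℕ.* suc (suc n))) (inv (suc n)) ⟩
    toℚᵘ (+ 1 / (suc n ℕ.* suc (suc n))) ℚᵘ.+ toℚᵘ (inv (suc n))
      ≈⟨ ℚᵘ.+-cong (toℚᵘ-/ (pred (suc n ℕ.* suc (suc n)))) (toℚᵘ-/ (suc n)) ⟩
    mkℚᵘ (+ 1) (pred (suc n ℕ.* suc (suc n))) ℚᵘ.+ mkℚᵘ (+ 1) (suc n)
      ≈⟨ *≡* (solve 1 (λ x →
           (con (+ 1) :* (con (+ 1) :+ x) :+ con (+ 1) :* (x :* (con (+ 1) :+ x))) :* x
             := con (+ 1) :* ((x :* (con (+ 1) :+ x)) :* (con (+ 1) :+ x))) refl (+ suc n)) ⟩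
    mkℚᵘ (+ 1) n
      ≈⟨ ℚᵘ.≃-sym (toℚᵘ-/ n) ⟩
    toℚᵘ (inv n) ∎)
    where open ℚᵘ.≃-Reasoning
          open ℤ-Solver.+-*-Solver

  pow-bound : ∀ n k .{{_ : NonTrivial k}} → suc n ℕ.* suc (suc n) ℕ.≤ suc (suc n) ℕ.^ k
  pow-bound n (suc (suc k)) = ℕ.≤-trans
    (ℕ.*-mono-≤ (ℕ.n≤1+n (suc n)) (ℕ.≤-reflexive (sym (ℕ.^-identityʳ (suc (suc n))))))
    (ℕ.^-monoʳ-≤ (suc (suc n)) {2} {suc (suc k)} (ℕ.s≤s (ℕ.s≤s ℕ.z≤n)))

  module _ (k : ℕ) .{{_ : NonTrivial k}} where

    S : ℕ → ℚ
    S n = ∑ n (λ i → 1/ i ^ k)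

    term-pos : ∀ n → 0ℚ ≤ 1/ suc n ^ k
    term-pos n = ℚ.nonNegative⁻¹ (1/ suc n ^ k)
      {{ℚ.normalize-nonNeg 1 (suc n ℕ.^ k) {{ℕ.m^n≢0 (suc n) k}}}}

    step-lower : ∀ n → S n ≤ S (suc n)
    step-lower n = subst (_≤ S (suc n)) (ℚ.+-identityʳ (S n)) (ℚ.+-monoʳ-≤ (S n) (term-pos n))

    step-upper : ∀ n → S (suc (suc n)) + inv (suc n) ≤ S (suc n) + inv n
    step-upper n = begin
      S (suc n) + 1/ suc (suc n) ^ k + inv (suc n)
        ≡⟨ ℚ.+-assoc (S (suc n)) (1/ suc (suc n) ^ k) (inv (suc n)) ⟩
      S (suc n) + (1/ suc (suc n) ^ k + inv (suc n))
        ≤⟨ ℚ.+-monoʳ-≤ (S (suc n)) (ℚ.+-monoˡ-≤ (inv (suc n))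
             (recip-anti (suc (suc n) ℕ.^ k) (suc n ℕ.* suc (suc n))
               {{ℕ.m^n≢0 (suc (suc n)) k}} (pow-bound n k))) ⟩
      S (suc n) + (+ 1 / (suc n ℕ.* suc (suc n)) + inv (suc n))
        ≡⟨ cong (λ t → S (suc n) + t) (telescope n) ⟩
      S (suc n) + inv n ∎
      where open ℚ.≤-Reasoning

    lower : ∀ {m n} → m ℕ.≤′ n → S m ≤ S n
    lower ℕ.≤′-refl             = ℚ.≤-refl
    lower (ℕ.≤′-step {n = n} p) = ℚ.≤-trans (lower p) (step-lower n)

    upper : ∀ {m n} → m ℕ.≤′ n → S (suc n) + inv n ≤ S (suc m) + inv m
    upper ℕ.≤′-refl             = ℚ.≤-refl
    upper (ℕ.≤′-step {n = n} p) = ℚ.≤-trans (step-upper n) (upper p)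

    S≤ : ∀ N n → suc N ℕ.≤ n → S n ≤ S (suc N) + inv N
    S≤ N (suc n) (ℕ.s≤s N≤n) = begin
      S (suc n)          ≡⟨ sym (ℚ.+-identityʳ (S (suc n))) ⟩
      S (suc n) + 0ℚ     ≤⟨ ℚ.+-monoʳ-≤ (S (suc n)) (ℚ.<⇒≤ (inv-pos n)) ⟩
      S (suc n) + inv n  ≤⟨ upper (ℕ.≤⇒≤′ N≤n) ⟩
      S (suc N) + inv N  ∎
      where open ℚ.≤-Reasoning

    diff : ∀ {a b c d} → a ≤ c + d → c ≤ b → a - b ≤ d
    diff {a} {b} {c} {d} a≤ c≤ = begin
      a - b        ≤⟨ ℚ.+-mono-≤ a≤ (ℚ.neg-antimono-≤ c≤) ⟩
      c + d - c    ≡⟨ solve 2 (λ c d → c :+ d :- c := d) refl c d ⟩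
      d            ∎
      where open ℚ.≤-Reasoning
            open ℚ-Solver.+-*-Solver

    ζ-cauchy : Cauchy S
    ζ-cauchy ε ε>0 with inv-small ε ε>0
    ... | N , inv<ε = suc N , λ m n m≥ n≥ → ℚ.≤-<-trans (close m n m≥ n≥) inv<ε
      where
      close : ∀ m n → suc N ℕ.≤ m → suc N ℕ.≤ n → ∣ S m - S n ∣ ≤ inv N
      close m n m≥ n≥ with ℚ.∣p∣≡p∨∣p∣≡-p (S m - S n)
      ... | inj₁ e = subst (_≤ inv N) (sym e) (diff (S≤ N m m≥) (lower (ℕ.≤⇒≤′ n≥)))
      ... | inj₂ e = subst (_≤ inv N)
        (sym (trans e (solve 2 (λ a b → :- (a :- b) := b :- a) refl (S m) (S n))))
        (diff (S≤ N n n≥) (lower (ℕ.≤⇒≤′ m≥)))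
        where open ℚ-Solver.+-*-Solver

ζ : (k : ℕ) .{{_ : NonTrivial k}} → ℝ
ζ k = mkℝ (λ n → ∑ n (λ i → 1/ i ^ k)) (ζ-Convergence.ζ-cauchy k)

data Polynomial : Set where
  con       : ℚ → Polynomial
  var       : (k : ℕ) .{{_ : NonTrivial k}} → Polynomial
  _:+_ _:*_ : Polynomial → Polynomial → Polynomial

eval : Polynomial → ℝ
eval (con q)  = fromℚ q
eval (var k)  = ζ k
eval (P :+ Q) = eval P +ℝ eval Q
eval (P :* Q) = eval P *ℝ eval Q

infix 4 _∈ℚ[ζ]

_∈ℚ[ζ] : ℝ → Set
x ∈ℚ[ζ] = ∃[ P ] x ≃ℝ eval P

-- The entries of an index are meant to be positive, but the formulas below
-- make sense without this.
Index : Set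
Index = List ℕ

-- Summing over the outermost variable n₁ = i first leaves a truncated sum over
-- n₂ > ⋯ > n_r with n₂ ≤ i - 1, respectively n₂ ≥ ⋯ ≥ n_r with n₂ ≤ i.
ζ[_] ζ⋆[_] : ℕ → Index → ℚ
ζ[ n ] []        = 1ℚ
ζ[ n ] (k ∷ ks)  = ∑ n (λ i → 1/ i ^ k * ζ[ pred i ] ks)

ζ⋆[ n ] []       = 1ℚ
ζ⋆[ n ] (k ∷ ks) = ∑ n (λ i → 1/ i ^ k * ζ⋆[ i ] ks)

-- x is the value ζ(k ⊛ l⋆); in particular its defining series converges.
infix 4 _≃ζ⟨_⊛_⋆⟩

_≃ζ⟨_⊛_⋆⟩ : ℝ → List⁺ ℕ → List⁺ ℕ → Set
x ≃ζ⟨ k₁ ∷ ks ⊛ l₁ ∷ ls ⋆⟩ =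
  (λ n → ζ[ pred n ] ks * ζ⋆[ n ] ls * 1/ n ^ (k₁ ℕ.+ l₁)) SumsTo x

-- s ×× d is the index s₁ , … , s_j repeated d times, i.e. {s₁ , … , s_j}_d.
infixl 8 _××_

_××_ : Index → ℕ → Index
s ×× d = concat (replicate d s)

{-# OPTIONS --safe #-}

-- The harmonic sums n⁻¹ ζ⋆_n(…) of the theorem are Hoffman dual to those of the index
-- ({m + 1}_p): they are, up to sign, the Newton coefficients of j ↦ ζ⋆_j({m + 1}_p).  As
-- ζ_{n-1}({1}_{r-1}) / n is the coefficient of x^r in x (x + 1) ⋯ (x + n - 1) / n!, the N-th partial
-- sum is the coefficient of x^r in M(x), where - M(- z) is the polynomial interpolating
-- ζ⋆_j({m + 1}_p) at z = j = 0, …, N.  With y marking p,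
-- M(x - j) = (1 - y / (j + 1 - x)^(m + 1)) M(x - j - 1) up to O((log N)^c / (j + 1) N), and
-- M(x - N) = - ∏_{k ≤ N} (1 - y / k^(m + 1))⁻¹ up to O((log N)^c / N).  So the series has the same
-- limit as the corresponding coefficient of - ∏_{k ≤ N} (1 - y / (k - x)^(m + 1)) / (1 - y / k^(m + 1)),
-- which the logarithmic derivative in y expresses through the power sums ∑_{k ≤ N} k^(-s), s ≥ 2.
module Submission where

open import Algebra.Bundles using (CommutativeRing)
import Algebra.Properties.Group
import Algebra.Properties.Ring
import Algebra.Solver.Ring
open import Algebra.Solver.Ring.AlmostCommutativeRing
  using (fromCommutativeRing; _-Raw-AlmostCommutative⟶_; -raw-almostCommutative⟶)
open import Data.Empty using (⊥-elim)
import Data.Integer.Base as ℤ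
import Data.Integer.Solver as ℤ-Solver
open import Data.List.Base using ([]; _∷_; _++_)
open import Data.List.NonEmpty.Base using (_∷_)
import Data.List.Properties as List
open import Data.List.Relation.Unary.All using (All; []; _∷_)
open import Data.Maybe.Base using (Maybe; just; nothing)
open import Data.Nat.Base as ℕ using (ℕ; zero; suc; _∸_; NonZero)
import Data.Nat.Induction as ℕ
import Data.Nat.Properties as ℕ
open import Data.Product.Base using (∃-syntax; Σ-syntax; _×_; _,_; proj₁; proj₂)
open import Data.Rational.Base as ℚ using (ℚ)
import Data.Rational.Properties as ℚ
import Data.Rational.Solver as ℚ-Solver
open import Data.Rational.Unnormalised.Base as ℚᵘ using (mkℚᵘ; *≡*)
import Data.Rational.Unnormalised.Properties as ℚᵘ
open import Level using (0ℓ)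
import Relation.Binary.Reasoning.Setoid
open import Relation.Binary.PropositionalEquality as ≡ using (_≡_)
open import Relation.Nullary.Decidable.Core using (yes; no)
open import Defs hiding (con; var; _:+_; _:*_)
open CauchyProperties using (half-pos; half+half; recip; pos*pos)
open ζ-Convergence using (inv; inv-pos; inv-small; recip-anti; toℚᵘ-/)

-- Formal power series over a ℚ-algebra

-- All estimates concern coefficients of formal series in x and y, so only rational numbers occur:
-- harmonic numbers stand for logarithms, and complete monotonicity of difference tables stands for
-- an integral representation. The obstacle is the truncation at N. Abel summation leaves a boundary
-- term containing (x - j) (x - j + 1) ⋯ (x - j + N - 1) / N! with j < N. One of its factors is x
-- itself, so only N - 1 numbers stand against the N of N!, and this gives 1 / N. The passage from x
-- - j to x - j - 1 multiplies such an error by a series of size 1 / (j + 1), so all N passages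
-- together cost only one more logarithm. At the last node the interpolation formula would be exact
-- for x = 0; the formal x leaves errors divisible by x, and positivity of the difference tables is
-- what bounds them. The comparison series has, for every finite N, coefficients that are
-- polynomials in the truncated zeta sums. Hence a single limit at the very end yields both the
-- convergence and the value.

record ℚ-Algebra : Set₁ where
  field
    commutativeRing : CommutativeRing 0ℓ 0ℓ
    scalar          : CommutativeRing.rawRing ℚ.+-*-commutativeRing
                        -Raw-AlmostCommutative⟶ fromCommutativeRing commutativeRing

  open CommutativeRing commutativeRing public hiding (rawRing)
  open _-Raw-AlmostCommutative⟶_ scalar public renaming (⟦_⟧ to ι)

  ι-cong? : ∀ p q → Maybe (ι p ≈ ι q)
  ι-cong? p q with p ℚ.≟ q
  ... | yes ≡.refl = just refl
  ... | no  _      = nothing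

  module Solver = Algebra.Solver.Ring (CommutativeRing.rawRing ℚ.+-*-commutativeRing)
    (fromCommutativeRing commutativeRing) scalar ι-cong?

ℚ-algebra : ℚ-Algebra
ℚ-algebra = record
  { commutativeRing = ℚ.+-*-commutativeRing
  ; scalar          = -raw-almostCommutative⟶ (fromCommutativeRing ℚ.+-*-commutativeRing)
  }


module PowerSeries (A : ℚ-Algebra) where

  open ℚ-Algebra A
  open Solver using (solve; _:=_; _:+_; _:*_; :-_; con)
  open Relation.Binary.Reasoning.Setoid setoid

  infix  4 _≋_
  infixl 6 _⊕_
  infixl 7 _⊛_

  Series : Set
  Series = ℕ → Carrier

  _≋_ : Series → Series → Set
  f ≋ g = ∀ n → f n ≈ g n

  tail : Series → Series
  tail f n = f (suc n)

  const : Carrier → Series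
  const c zero    = c
  const c (suc _) = 0#

  X : Series
  X zero    = 0#
  X (suc n) = const 1# n

  -- The product is read off from f = f 0 + X · `tail f`, so that proofs go by induction on the
  -- coefficient with f replaced by its tail.
  _⊕_ _⊛_ : Series → Series → Series
  (f ⊕ g) n       = f n + g n
  (f ⊛ g) zero    = f 0 * g 0
  (f ⊛ g) (suc n) = f 0 * g (suc n) + (tail f ⊛ g) n

  ⊝_ : Series → Series
  (⊝ f) n = - f n

  ⊛-cong : ∀ {f g h k} → f ≋ g → h ≋ k → f ⊛ h ≋ g ⊛ k
  ⊛-cong p q zero    = *-cong (p 0) (q 0)
  ⊛-cong p q (suc n) = +-cong (*-cong (p 0) (q (suc n))) (⊛-cong (λ i → p (suc i)) q n)

  const-0 : ∀ n → const 0# n ≈ 0#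
  const-0 zero    = refl
  const-0 (suc _) = refl

  ⊛-zeroˡ : ∀ f → const 0# ⊛ f ≋ const 0#
  ⊛-zeroˡ f zero    = zeroˡ (f 0)
  ⊛-zeroˡ f (suc n) = begin
    0# * f (suc n) + (tail (const 0#) ⊛ f) n
      ≈⟨ +-cong (zeroˡ _) (⊛-cong {f = λ _ → 0#} (λ i → sym (const-0 i)) (λ _ → refl) n) ⟩
    0# + (const 0# ⊛ f) n
      ≈⟨ +-identityˡ _ ⟩
    (const 0# ⊛ f) n
      ≈⟨ ⊛-zeroˡ f n ⟩
    const 0# n
      ≈⟨ const-0 n ⟩
    0# ∎

  const-⊛ : ∀ c f n → (const c ⊛ f) n ≈ c * f n
  const-⊛ c f zero    = refl
  const-⊛ c f (suc n) = begin
    c * f (suc n) + ((λ _ → 0#) ⊛ f) n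
      ≈⟨ +-congˡ (⊛-cong {f = λ _ → 0#} (λ i → sym (const-0 i)) (λ _ → refl) n) ⟩
    c * f (suc n) + (const 0# ⊛ f) n
      ≈⟨ +-congˡ (trans (⊛-zeroˡ f n) (const-0 n)) ⟩
    c * f (suc n) + 0#
      ≈⟨ +-identityʳ _ ⟩
    c * f (suc n) ∎

  ⊛-identityˡ : ∀ f → const 1# ⊛ f ≋ f
  ⊛-identityˡ f n = trans (const-⊛ 1# f n) (*-identityˡ (f n))

  X-⊛ : ∀ f n → (X ⊛ f) (suc n) ≈ f n
  X-⊛ f n = begin
    0# * f (suc n) + (const 1# ⊛ f) n  ≈⟨ +-cong (zeroˡ _) (⊛-identityˡ f n) ⟩
    0# + f n                           ≈⟨ +-identityˡ _ ⟩
    f n                                ∎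

  ⊛-distribʳ : ∀ h f g → (f ⊕ g) ⊛ h ≋ f ⊛ h ⊕ g ⊛ h
  ⊛-distribʳ h f g zero    = distribʳ (h 0) (f 0) (g 0)
  ⊛-distribʳ h f g (suc n) = begin
    (f 0 + g 0) * h (suc n) + (tail (f ⊕ g) ⊛ h) n
      ≈⟨ +-congˡ (⊛-distribʳ h (tail f) (tail g) n) ⟩
    (f 0 + g 0) * h (suc n) + ((tail f ⊛ h) n + (tail g ⊛ h) n)
      ≈⟨ solve 5 (λ a b c d e → (a :+ b) :* c :+ (d :+ e) := (a :* c :+ d) :+ (b :* c :+ e)) refl _ _ _ _ _ ⟩
    (f ⊛ h ⊕ g ⊛ h) (suc n) ∎

  ⊛-sucʳ : ∀ f g n → (f ⊛ g) (suc n) ≈ f (suc n) * g 0 + (f ⊛ tail g) n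
  ⊛-sucʳ f g zero    = +-comm _ _
  ⊛-sucʳ f g (suc n) = begin
    f 0 * g (2 ℕ.+ n) + (tail f ⊛ g) (suc n)
      ≈⟨ +-congˡ (⊛-sucʳ (tail f) g n) ⟩
    f 0 * g (2 ℕ.+ n) + (f (2 ℕ.+ n) * g 0 + (tail f ⊛ tail g) n)
      ≈⟨ solve 3 (λ a b c → a :+ (b :+ c) := b :+ (a :+ c)) refl _ _ _ ⟩
    f (2 ℕ.+ n) * g 0 + (f ⊛ tail g) (suc n) ∎

  ⊛-comm : ∀ f g → f ⊛ g ≋ g ⊛ f
  ⊛-comm f g zero    = *-comm (f 0) (g 0)
  ⊛-comm f g (suc n) = begin
    f 0 * g (suc n) + (tail f ⊛ g) n  ≈⟨ +-cong (*-comm _ _) (⊛-comm (tail f) g n) ⟩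
    g (suc n) * f 0 + (g ⊛ tail f) n  ≈⟨ ⊛-sucʳ g f n ⟨
    (g ⊛ f) (suc n)                   ∎

  scale-⊛ : ∀ c f g n → ((λ i → c * f i) ⊛ g) n ≈ c * (f ⊛ g) n
  scale-⊛ c f g zero    = *-assoc c (f 0) (g 0)
  scale-⊛ c f g (suc n) = begin
    c * f 0 * g (suc n) + ((λ i → c * tail f i) ⊛ g) n
      ≈⟨ +-cong (*-assoc _ _ _) (scale-⊛ c (tail f) g n) ⟩
    c * (f 0 * g (suc n)) + c * (tail f ⊛ g) n
      ≈⟨ distribˡ c _ _ ⟨
    c * (f ⊛ g) (suc n) ∎

  ⊛-assoc : ∀ f g h → (f ⊛ g) ⊛ h ≋ f ⊛ (g ⊛ h)
  ⊛-assoc f g h zero    = *-assoc (f 0) (g 0) (h 0)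
  ⊛-assoc f g h (suc n) = begin
    f 0 * g 0 * h (suc n) + (((λ i → f 0 * tail g i) ⊕ tail f ⊛ g) ⊛ h) n
      ≈⟨ +-congˡ (⊛-distribʳ h (λ i → f 0 * tail g i) (tail f ⊛ g) n) ⟩
    f 0 * g 0 * h (suc n) + (((λ i → f 0 * tail g i) ⊛ h) n + ((tail f ⊛ g) ⊛ h) n)
      ≈⟨ +-congˡ (+-cong (scale-⊛ (f 0) (tail g) h n) (⊛-assoc (tail f) g h n)) ⟩
    f 0 * g 0 * h (suc n) + (f 0 * (tail g ⊛ h) n + (tail f ⊛ (g ⊛ h)) n)
      ≈⟨ solve 5 (λ a b c d e → a :* b :* c :+ (a :* d :+ e) := a :* (b :* c :+ d) :+ e) refl _ _ _ _ _ ⟩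
    (f ⊛ (g ⊛ h)) (suc n) ∎

  -- Coefficient n of a product is a finite sum of products of coefficients of index at most n. The
  -- properties live on families over `I` because uniform bounds and being a polynomial in truncated
  -- zeta values concern a whole family. The index bounds serve the strong induction in `V-ZP`.
  ⊛-closure : ∀ {I : Set} (P Q S : (I → Carrier) → Set) →
              (∀ {a b} → P a → Q b → S (λ i → a i * b i)) →
              (∀ {a b} → S a → S b → S (λ i → a i + b i)) →
              ∀ (f g : I → Series) n →
              (∀ k → k ℕ.≤ n → P (λ i → f i k)) → (∀ k → k ℕ.≤ n → Q (λ i → g i k)) →
              S (λ i → (f i ⊛ g i) n)
  ⊛-closure P Q S mul add f g zero    p q = mul (p 0 ℕ.z≤n) (q 0 ℕ.z≤n)
  ⊛-closure P Q S mul add f g (suc n) p q =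
    add (mul (p 0 ℕ.z≤n) (q (suc n) ℕ.≤-refl))
        (⊛-closure P Q S mul add (λ i → tail (f i)) g n
          (λ k k≤n → p (suc k) (ℕ.s≤s k≤n)) (λ k k≤n → q k (ℕ.m≤n⇒m≤1+n k≤n)))

  -- The result is again a ℚ-algebra, so the construction iterates to ℚ⟦x⟧ and ℚ⟦x⟧⟦y⟧, each with a
  -- ring solver that knows rational constants.
  powerSeries : ℚ-Algebra
  powerSeries = record
    { commutativeRing = record
      { Carrier = Series ; _≈_ = _≋_ ; _+_ = _⊕_ ; _*_ = _⊛_ ; -_ = ⊝_
      ; 0# = const 0# ; 1# = const 1#
      ; isCommutativeRing = record
        { isRing = record
          { +-isAbelianGroup = record
            { isGroup = record
              { isMonoid = record
                { isSemigroup = record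
                  { isMagma = record
                    { isEquivalence = record
                      { refl = λ _ → refl ; sym = λ p n → sym (p n) ; trans = λ p q n → trans (p n) (q n) }
                    ; ∙-cong = λ p q n → +-cong (p n) (q n)
                    }
                  ; assoc = λ f g h n → +-assoc (f n) (g n) (h n)
                  }
                ; identity = (λ f n → trans (+-congʳ (const-0 n)) (+-identityˡ (f n)))
                           , (λ f n → trans (+-congˡ (const-0 n)) (+-identityʳ (f n)))
                }
              ; inverse = (λ f n → trans (-‿inverseˡ (f n)) (sym (const-0 n)))
                        , (λ f n → trans (-‿inverseʳ (f n)) (sym (const-0 n)))
              ; ⁻¹-cong = λ p n → -‿cong (p n)
              }
            ; comm = λ f g n → +-comm (f n) (g n)
            }
          ; *-cong = ⊛-cong
          ; *-assoc = ⊛-assoc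
          ; *-identity = ⊛-identityˡ , (λ f n → trans (⊛-comm f (const 1#) n) (⊛-identityˡ f n))
          ; distrib = (λ f g h n → trans (⊛-comm f (g ⊕ h) n) (trans (⊛-distribʳ f g h n)
                                     (+-cong (⊛-comm g f n) (⊛-comm h f n))))
                    , ⊛-distribʳ
          }
        ; *-comm = ⊛-comm
        }
      }
    ; scalar = record
      { ⟦_⟧    = λ q → const (ι q)
      ; +-homo = λ { p q zero → +-homo p q ; p q (suc _) → sym (+-identityʳ 0#) }
      ; *-homo = λ p q n → trans (const-* p q n) (sym (const-⊛ (ι p) (const (ι q)) n))
      ; -‿homo = λ { p zero → -‿homo p ; p (suc _) → trans (sym (+-identityʳ 0#)) 0+0≈-0 }
      ; 0-homo = λ { zero → 0-homo ; (suc _) → refl }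
      ; 1-homo = λ { zero → 1-homo ; (suc _) → refl }
      }
    }
    where
    0+0≈-0 : 0# + 0# ≈ - 0#
    0+0≈-0 = begin
      0# + 0#        ≈⟨ +-congʳ (-‿inverseˡ 0#) ⟨
      - 0# + 0# + 0# ≈⟨ trans (+-identityʳ _) (+-identityʳ _) ⟩
      - 0#           ∎

    const-* : ∀ p q n → const (ι (p ℚ.* q)) n ≈ ι p * const (ι q) n
    const-* p q zero    = *-homo p q
    const-* p q (suc _) = sym (zeroʳ (ι p))

-- Natural numbers in ℚ and difference tables

open import Data.Rational
  using (0ℚ; 1ℚ; ½; _+_; _*_; _-_; -_; ∣_∣; _≤_; _<_; _/_; toℚᵘ; positive; nonNegative)

-- Recursive, so that `nat (suc n)` unfolds to `1ℚ + nat n` and the ring solver can treat `nat n` as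
-- an atom.
nat : ℕ → ℚ
nat zero    = 0ℚ
nat (suc n) = 1ℚ + nat n

toℚᵘ-nat : ∀ n → toℚᵘ (nat n) ℚᵘ.≃ mkℚᵘ (ℤ.+ n) 0
toℚᵘ-nat zero    = ℚᵘ.≃-refl
toℚᵘ-nat (suc n) = begin
  toℚᵘ (1ℚ + nat n)                ≈⟨ ℚ.toℚᵘ-homo-+ 1ℚ (nat n) ⟩
  toℚᵘ 1ℚ ℚᵘ.+ toℚᵘ (nat n)        ≈⟨ ℚᵘ.+-congʳ (toℚᵘ 1ℚ) (toℚᵘ-nat n) ⟩
  toℚᵘ 1ℚ ℚᵘ.+ mkℚᵘ (ℤ.+ n) 0        ≈⟨ *≡* (solve 1 (λ x →
    (con (ℤ.+ 1) :* con (ℤ.+ 1) :+ x :* con (ℤ.+ 1)) :* con (ℤ.+ 1) := (con (ℤ.+ 1) :+ x) :* con (ℤ.+ 1)) ≡.refl (ℤ.+ n)) ⟩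
  mkℚᵘ (ℤ.+ suc n) 0                 ∎
  where open ℚᵘ.≃-Reasoning
        open ℤ-Solver.+-*-Solver

nat*inv : ∀ n → nat (suc n) * inv n ≡ 1ℚ
nat*inv n = ℚ.toℚᵘ-injective (begin
  toℚᵘ (nat (suc n) * inv n)            ≈⟨ ℚ.toℚᵘ-homo-* (nat (suc n)) (inv n) ⟩
  toℚᵘ (nat (suc n)) ℚᵘ.* toℚᵘ (inv n)  ≈⟨ ℚᵘ.*-cong (toℚᵘ-nat (suc n)) (toℚᵘ-/ n) ⟩
  mkℚᵘ (ℤ.+ suc n) 0 ℚᵘ.* mkℚᵘ (ℤ.+ 1) n    ≈⟨ *≡* (solve 1 (λ x →
    x :* con (ℤ.+ 1) :* con (ℤ.+ 1) := con (ℤ.+ 1) :* (con (ℤ.+ 1) :* x)) ≡.refl (ℤ.+ suc n)) ⟩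
  toℚᵘ 1ℚ                               ∎)
  where open ℚᵘ.≃-Reasoning
        open ℤ-Solver.+-*-Solver

-- If s j = ∫ u^j dμ over [0,1], then table s n j = ∫ (1 - u)^n u^j dμ.
table : (ℕ → ℚ) → ℕ → ℕ → ℚ
table s zero    j = s j
table s (suc n) j = table s n j - table s n (suc j)

-- Newton series

module Rising (A : ℚ-Algebra) where

  open ℚ-Algebra A renaming (_+_ to _⊕_; _*_ to _⊛_; -_ to ⊝_; _-_ to _⊖_)
  open Solver using (solve; _:=_; _:+_; _:*_; :-_; _:-_; con)
  open Relation.Binary.Reasoning.Setoid setoid

  Σ< : ℕ → (ℕ → Carrier) → Carrier
  Σ< zero    f = 0#
  Σ< (suc n) f = Σ< n f ⊕ f n

  Σ<-cong : ∀ N {f g} → (∀ n → f n ≈ g n) → Σ< N f ≈ Σ< N g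
  Σ<-cong zero    p = refl
  Σ<-cong (suc N) p = +-cong (Σ<-cong N p) (p N)

  -- t (t + 1) ⋯ (t + n - 1) / n!, which at t = - j is (- 1)^n times the binomial coefficient j over
  -- n.
  rising : Carrier → ℕ → Carrier
  rising t zero    = 1#
  rising t (suc n) = rising t n ⊛ (t ⊕ ι (nat n)) ⊛ ι (inv n)

  rising-cong : ∀ {s t} → s ≈ t → ∀ n → rising s n ≈ rising t n
  rising-cong p zero    = refl
  rising-cong p (suc n) = *-congʳ (*-cong (rising-cong p n) (+-congʳ p))

  ι-suc : ∀ n → ι (nat (suc n)) ≈ 1# ⊕ ι (nat n)
  ι-suc n = trans (+-homo 1ℚ (nat n)) (+-congʳ 1-homo)

  ι-inverse : ∀ n → (1# ⊕ ι (nat n)) ⊛ ι (inv n) ≈ 1#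
  ι-inverse n = begin
    (1# ⊕ ι (nat n)) ⊛ ι (inv n)  ≈⟨ *-congʳ (ι-suc n) ⟨
    ι (nat (suc n)) ⊛ ι (inv n)   ≈⟨ *-homo _ _ ⟨
    ι (nat (suc n) * inv n)       ≡⟨ ≡.cong ι (nat*inv n) ⟩
    ι 1ℚ                          ≈⟨ 1-homo ⟩
    1#                            ∎

  rising-suc : ∀ t n → ι (nat (suc n)) ⊛ rising t (suc n) ≈ rising t n ⊛ (t ⊕ ι (nat n))
  rising-suc t n = begin
    ι (nat (suc n)) ⊛ (rising t n ⊛ (t ⊕ ι (nat n)) ⊛ ι (inv n))
      ≈⟨ *-congʳ (ι-suc n) ⟩
    (1# ⊕ ι (nat n)) ⊛ (rising t n ⊛ (t ⊕ ι (nat n)) ⊛ ι (inv n))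
      ≈⟨ solve 3 (λ a b c → a :* (b :* c) := b :* (a :* c)) refl _ _ _ ⟩
    rising t n ⊛ (t ⊕ ι (nat n)) ⊛ ((1# ⊕ ι (nat n)) ⊛ ι (inv n))
      ≈⟨ trans (*-congˡ (ι-inverse n)) (*-identityʳ _) ⟩
    rising t n ⊛ (t ⊕ ι (nat n)) ∎

  rising-shift : ∀ t n → t ⊛ rising (t ⊕ 1#) n ≈ ι (nat (suc n)) ⊛ rising t (suc n)
  rising-shift t zero = begin
    t ⊛ 1#                 ≈⟨ solve 2 (λ t e → t :* e := e :* (t :+ con 0ℚ)) refl t 1# ⟩
    1# ⊛ (t ⊕ ι 0ℚ)        ≈⟨ rising-suc t 0 ⟨
    ι (nat 1) ⊛ rising t 1 ∎
  rising-shift t (suc n) = begin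
    t ⊛ (rising (t ⊕ 1#) n ⊛ (t ⊕ 1# ⊕ ι (nat n)) ⊛ ι (inv n))
      ≈⟨ solve 4 (λ t a b c → t :* (a :* b :* c) := (t :* a) :* b :* c) refl _ _ _ _ ⟩
    t ⊛ rising (t ⊕ 1#) n ⊛ (t ⊕ 1# ⊕ ι (nat n)) ⊛ ι (inv n)
      ≈⟨ *-congʳ (*-cong (trans (rising-shift t n) (*-congʳ (ι-suc n))) (trans (+-assoc _ _ _) (+-congˡ (sym (ι-suc n))))) ⟩
    (1# ⊕ ι (nat n)) ⊛ rising t (suc n) ⊛ (t ⊕ ι (nat (suc n))) ⊛ ι (inv n)
      ≈⟨ solve 4 (λ a b c d → a :* b :* c :* d := b :* c :* (a :* d)) refl _ _ _ _ ⟩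
    rising t (suc n) ⊛ (t ⊕ ι (nat (suc n))) ⊛ ((1# ⊕ ι (nat n)) ⊛ ι (inv n))
      ≈⟨ trans (*-congˡ (ι-inverse n)) (*-identityʳ _) ⟩
    rising t (suc n) ⊛ (t ⊕ ι (nat (suc n)))
      ≈⟨ rising-suc t (suc n) ⟨
    ι (nat (2 ℕ.+ n)) ⊛ rising t (2 ℕ.+ n) ∎

  rising-pascal : ∀ t n → rising (t ⊕ 1#) (suc n) ≈ rising t (suc n) ⊕ rising (t ⊕ 1#) n
  rising-pascal t n = begin
    u ⊛ (t ⊕ 1# ⊕ ι (nat n)) ⊛ v
      ≈⟨ solve 5 (λ u t o k v → u :* (t :+ o :+ k) :* v := (t :* u) :* v :+ u :* ((o :+ k) :* v)) refl u t 1# (ι (nat n)) v ⟩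
    t ⊛ u ⊛ v ⊕ u ⊛ ((1# ⊕ ι (nat n)) ⊛ v)
      ≈⟨ +-cong (*-congʳ (trans (rising-shift t n) (*-congʳ (ι-suc n)))) (trans (*-congˡ (ι-inverse n)) (*-identityʳ u)) ⟩
    (1# ⊕ ι (nat n)) ⊛ rising t (suc n) ⊛ v ⊕ u
      ≈⟨ +-congʳ (trans (solve 3 (λ a b c → a :* b :* c := b :* (a :* c)) refl _ _ _) (trans (*-congˡ (ι-inverse n)) (*-identityʳ _))) ⟩
    rising t (suc n) ⊕ u ∎
    where
    u = rising (t ⊕ 1#) n
    v = ι (inv n)

  -- For a n = `table s n 0` and t = - j with j ≤ N, this is Newton's interpolation formula for - (s
  -- 0 + ⋯ + s (j - 1)).
  newton : (ℕ → ℚ) → Carrier → ℕ → Carrier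
  newton a t N = Σ< N (λ n → rising t (suc n) ⊛ ι (a n))

  newton-cong : ∀ {a b} t N → (∀ n → a n ≡ b n) → newton a t N ≈ newton b t N
  newton-cong t N p = Σ<-cong N (λ n → *-congˡ (reflexive (≡.cong ι (p n))))

  -- By Pascal's rule the terms at t + 1 and t differ by `rising (t ⊕ 1#) n`, which is (n + 1) / t
  -- times `rising t (suc n)`; the hypothesis says w = - 1 / t. The identity is termwise, so the
  -- truncation leaves no error here.
  newton-shift : ∀ a t w N → w ⊛ (⊝ t) ≈ 1# →
                 newton a (t ⊕ 1#) N ≈ newton a t N ⊖ w ⊛ newton (λ n → nat (suc n) * a n) t N
  newton-shift a t w zero    wz = begin
    0#            ≈⟨ -‿inverseʳ 0# ⟨
    0# ⊖ 0#       ≈⟨ +-congˡ (-‿cong (zeroʳ w)) ⟨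
    0# ⊖ w ⊛ 0#   ∎
  newton-shift a t w (suc N) wz = begin
    newton a (t ⊕ 1#) N ⊕ rising (t ⊕ 1#) (suc N) ⊛ ι (a N)
      ≈⟨ +-cong (newton-shift a t w N wz) (*-congʳ (rising-pascal t N)) ⟩
    newton a t N ⊖ w ⊛ newton b t N ⊕ (rising t (suc N) ⊕ u) ⊛ ι (a N)
      ≈⟨ solve 6 (λ p w q r u a → p :- w :* q :+ (r :+ u) :* a := (p :+ r :* a) :- w :* q :+ u :* a) refl _ _ _ _ _ _ ⟩
    newton a t (suc N) ⊖ w ⊛ newton b t N ⊕ u ⊛ ι (a N)
      ≈⟨ +-congˡ step ⟩
    newton a t (suc N) ⊖ w ⊛ newton b t N ⊕ ⊝ (w ⊛ (rising t (suc N) ⊛ ι (b N)))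
      ≈⟨ solve 4 (λ p w q r → p :- w :* q :+ :- (w :* r) := p :- w :* (q :+ r)) refl _ _ _ _ ⟩
    newton a t (suc N) ⊖ w ⊛ newton b t (suc N) ∎
    where
    u = rising (t ⊕ 1#) N
    b = λ n → nat (suc n) * a n

    step : u ⊛ ι (a N) ≈ ⊝ (w ⊛ (rising t (suc N) ⊛ ι (b N)))
    step = begin
      u ⊛ ι (a N)
        ≈⟨ trans (*-congʳ wz) (*-identityˡ _) ⟨
      w ⊛ (⊝ t) ⊛ (u ⊛ ι (a N))
        ≈⟨ solve 4 (λ w t u a → w :* (:- t) :* (u :* a) := :- (w :* ((t :* u) :* a))) refl _ _ _ _ ⟩
      ⊝ (w ⊛ (t ⊛ u ⊛ ι (a N)))
        ≈⟨ -‿cong (*-congˡ (*-congʳ (rising-shift t N))) ⟩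
      ⊝ (w ⊛ (ι (nat (suc N)) ⊛ rising t (suc N) ⊛ ι (a N)))
        ≈⟨ -‿cong (*-congˡ (trans (solve 3 (λ k r a → k :* r :* a := r :* (k :* a)) refl _ _ _) (*-congˡ (sym (*-homo _ _))))) ⟩
      ⊝ (w ⊛ (rising t (suc N) ⊛ ι (b N))) ∎

  -- Abel summation for multiplication by t = - 1 / w; the last node leaves a boundary term.
  newton-summation : ∀ (c : ℕ → ℚ) t w N → w ⊛ (⊝ t) ≈ 1# →
    newton (λ n → c (suc n)) t N ≈
    w ⊛ newton (λ n → nat (suc n) * (c (suc n) - c n)) t N ⊕ (rising (t ⊕ 1#) N ⊛ ι (c N) ⊖ ι (c 0))
  newton-summation c t w zero wz = begin
    0#                                            ≈⟨ +-identityˡ 0# ⟨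
    0# ⊕ 0#                                       ≈⟨ +-cong (zeroʳ w) (-‿inverseʳ (ι (c 0))) ⟨
    w ⊛ 0# ⊕ (ι (c 0) ⊖ ι (c 0))                  ≈⟨ +-congˡ (+-congʳ (*-identityˡ _)) ⟨
    w ⊛ 0# ⊕ (1# ⊛ ι (c 0) ⊖ ι (c 0))             ∎
  newton-summation c t w (suc N) wz = begin
    newton (λ n → c (suc n)) t N ⊕ r ⊛ ι (c (suc N))
      ≈⟨ +-congʳ (newton-summation c t w N wz) ⟩
    w ⊛ newton d t N ⊕ (u ⊛ ι (c N) ⊖ ι (c 0)) ⊕ r ⊛ ι (c (suc N))
      ≈⟨ solve 7 (λ w p u a b r e → w :* p :+ (u :* a :- e) :+ r :* b
             := w :* p :+ :- (u :* (b :- a)) :+ ((r :+ u) :* b :- e)) refl w _ u (ι (c N)) (ι (c (suc N))) r _ ⟩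
    w ⊛ newton d t N ⊕ ⊝ (u ⊛ (ι (c (suc N)) ⊖ ι (c N))) ⊕ ((r ⊕ u) ⊛ ι (c (suc N)) ⊖ ι (c 0))
      ≈⟨ +-cong (+-congˡ step) (+-congʳ (*-congʳ (sym (rising-pascal t N)))) ⟩
    w ⊛ newton d t N ⊕ w ⊛ (r ⊛ ι (d N)) ⊕ (rising (t ⊕ 1#) (suc N) ⊛ ι (c (suc N)) ⊖ ι (c 0))
      ≈⟨ +-congʳ (sym (distribˡ w _ _)) ⟩
    w ⊛ newton d t (suc N) ⊕ (rising (t ⊕ 1#) (suc N) ⊛ ι (c (suc N)) ⊖ ι (c 0)) ∎
    where
    u = rising (t ⊕ 1#) N
    r = rising t (suc N)
    d = λ n → nat (suc n) * (c (suc n) - c n)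

    step : ⊝ (u ⊛ (ι (c (suc N)) ⊖ ι (c N))) ≈ w ⊛ (r ⊛ ι (d N))
    step = begin
      ⊝ (u ⊛ (ι (c (suc N)) ⊖ ι (c N)))
        ≈⟨ trans (*-congʳ wz) (*-identityˡ _) ⟨
      w ⊛ (⊝ t) ⊛ ⊝ (u ⊛ (ι (c (suc N)) ⊖ ι (c N)))
        ≈⟨ solve 5 (λ w t u a b → w :* (:- t) :* :- (u :* (a :- b)) := w :* ((t :* u) :* (a :- b))) refl _ _ _ _ _ ⟩
      w ⊛ (t ⊛ u ⊛ (ι (c (suc N)) ⊖ ι (c N)))
        ≈⟨ *-congˡ (*-cong (rising-shift t N) (trans (+-congˡ (sym (-‿homo _))) (sym (+-homo _ _)))) ⟩
      w ⊛ (ι (nat (suc N)) ⊛ r ⊛ ι (c (suc N) - c N))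
        ≈⟨ *-congˡ (trans (solve 3 (λ k r a → k :* r :* a := r :* (k :* a)) refl _ _ _) (*-congˡ (sym (*-homo _ _)))) ⟩
      w ⊛ (r ⊛ ι (d N)) ∎

  -- Drops the first interpolation node k, so that the series is expanded from node k + 1.
  newton-recentre : ∀ s k t N →
    newton (λ n → table s n k) t (suc N) ≈
    newton (λ n → table s n (suc k)) (t ⊕ 1#) N ⊖ ι (s k) ⊕ rising (t ⊕ 1#) (suc N) ⊛ ι (table s N k)
  newton-recentre s k t zero = begin
    0# ⊕ rising t 1 ⊛ ι (s k)
      ≈⟨ solve 4 (λ r o a z → z :+ r :* a := z :- a :+ (r :* a :+ a)) refl (rising t 1) 1# (ι (s k)) 0# ⟩
    0# ⊖ ι (s k) ⊕ (rising t 1 ⊛ ι (s k) ⊕ ι (s k))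
      ≈⟨ +-congˡ (+-congˡ (*-identityˡ _)) ⟨
    0# ⊖ ι (s k) ⊕ (rising t 1 ⊛ ι (s k) ⊕ 1# ⊛ ι (s k))
      ≈⟨ +-congˡ (distribʳ _ _ _) ⟨
    0# ⊖ ι (s k) ⊕ (rising t 1 ⊕ 1#) ⊛ ι (s k)
      ≈⟨ +-congˡ (*-congʳ (rising-pascal t 0)) ⟨
    0# ⊖ ι (s k) ⊕ rising (t ⊕ 1#) 1 ⊛ ι (s k) ∎
  newton-recentre s k t (suc N) = begin
    newton a t (suc N) ⊕ rising t (2 ℕ.+ N) ⊛ ι (a N - b N)
      ≈⟨ +-cong (newton-recentre s k t N) (*-congˡ difference) ⟩
    newton b (t ⊕ 1#) N ⊖ ι (s k) ⊕ u ⊛ ι (a N) ⊕ rising t (2 ℕ.+ N) ⊛ (ι (a N) ⊖ ι (b N))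
      ≈⟨ solve 6 (λ p e u x y r → p :- e :+ u :* x :+ r :* (x :- y)
             := p :+ u :* y :- e :+ (r :+ u) :* (x :- y)) refl _ _ u (ι (a N)) (ι (b N)) _ ⟩
    newton b (t ⊕ 1#) (suc N) ⊖ ι (s k) ⊕ (rising t (2 ℕ.+ N) ⊕ u) ⊛ (ι (a N) ⊖ ι (b N))
      ≈⟨ +-congˡ (*-cong (sym (rising-pascal t (suc N))) (sym difference)) ⟩
    newton b (t ⊕ 1#) (suc N) ⊖ ι (s k) ⊕ rising (t ⊕ 1#) (2 ℕ.+ N) ⊛ ι (a N - b N) ∎
    where
    u = rising (t ⊕ 1#) (suc N)
    a = λ n → table s n k
    b = λ n → table s n (suc k)
    difference : ι (a N - b N) ≈ ι (a N) ⊖ ι (b N)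
    difference = trans (+-homo _ _) (+-congˡ (-‿homo _))

-- Elementary identities and inequalities in ℚ

open ≡ using (refl; sym; trans; cong; cong₂; subst)
open ℚ-Solver.+-*-Solver using (solve; _:=_; _:+_; _:*_; :-_; _:-_; con)

infixr 8 _^^_

_^^_ : ℚ → ℕ → ℚ
x ^^ zero  = 1ℚ
x ^^ suc k = x * x ^^ k

0≤1 : 0ℚ ≤ 1ℚ
0≤1 = ℚ.<⇒≤ (ℚ.positive⁻¹ 1ℚ)

0≤inv : ∀ n → 0ℚ ≤ inv n
0≤inv n = ℚ.<⇒≤ (inv-pos n)

0≤+ : ∀ {p q} → 0ℚ ≤ p → 0ℚ ≤ q → 0ℚ ≤ p + q
0≤+ {p} {q} = ℚ.+-mono-≤ {0ℚ} {p} {0ℚ} {q}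

*-mono : ∀ {p q r s} → 0ℚ ≤ p → 0ℚ ≤ s → p ≤ q → r ≤ s → p * r ≤ q * s
*-mono {p} {q} {r} {s} 0≤p 0≤s p≤q r≤s =
  ℚ.≤-trans (ℚ.*-monoˡ-≤-nonNeg p {{nonNegative 0≤p}} r≤s)
            (ℚ.*-monoʳ-≤-nonNeg s {{nonNegative 0≤s}} p≤q)

0≤* : ∀ {p q} → 0ℚ ≤ p → 0ℚ ≤ q → 0ℚ ≤ p * q
0≤* {p} {q} 0≤p 0≤q = subst (_≤ p * q) (ℚ.*-zeroʳ p) (ℚ.*-monoˡ-≤-nonNeg p {{nonNegative 0≤p}} 0≤q)

p≤q+p : ∀ p {q} → 0ℚ ≤ q → p ≤ q + p
p≤q+p p {q} 0≤q = subst (_≤ q + p) (ℚ.+-identityˡ p) (ℚ.+-monoˡ-≤ p 0≤q)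

0≤nat : ∀ n → 0ℚ ≤ nat n
0≤nat zero    = ℚ.≤-refl
0≤nat (suc n) = 0≤+ 0≤1 (0≤nat n)

nat-+ : ∀ m n → nat (m ℕ.+ n) ≡ nat m + nat n
nat-+ zero    n = sym (ℚ.+-identityˡ (nat n))
nat-+ (suc m) n = trans (cong (1ℚ +_) (nat-+ m n)) (sym (ℚ.+-assoc 1ℚ (nat m) (nat n)))

inv*nat*  : ∀ n x → inv n * (nat (suc n) * x) ≡ x
inv*nat* n x = trans (solve 3 (λ i k x → i :* (k :* x) := (k :* i) :* x) refl (inv n) (nat (suc n)) x)
                     (trans (cong (_* x) (nat*inv n)) (ℚ.*-identityˡ x))

nat*inv* : ∀ n x → nat (suc n) * (inv n * x) ≡ x
nat*inv* n x = trans (sym (ℚ.*-assoc (nat (suc n)) (inv n) x))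
                     (trans (cong (_* x) (nat*inv n)) (ℚ.*-identityˡ x))

0≤nat*⇒0≤ : ∀ n x → 0ℚ ≤ nat (suc n) * x → 0ℚ ≤ x
0≤nat*⇒0≤ n x p = subst (0ℚ ≤_) (inv*nat* n x) (0≤* (0≤inv n) p)

nat*-injective : ∀ n x y → nat (suc n) * x ≡ y → x ≡ inv n * y
nat*-injective n x y p = trans (sym (inv*nat* n x)) (cong (inv n *_) p)

recip-* : ∀ a b → ℤ.+ 1 / (suc a ℕ.* suc b) ≡ inv a * inv b
recip-* a b = ℚ.toℚᵘ-injective (begin
  toℚᵘ (ℤ.+ 1 / (suc a ℕ.* suc b))   ≈⟨ toℚᵘ-/ _ ⟩
  mkℚᵘ (ℤ.+ 1) a ℚᵘ.* mkℚᵘ (ℤ.+ 1) b   ≈⟨ ℚᵘ.*-cong (toℚᵘ-/ a) (toℚᵘ-/ b) ⟨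
  toℚᵘ (inv a) ℚᵘ.* toℚᵘ (inv b)   ≈⟨ ℚ.toℚᵘ-homo-* (inv a) (inv b) ⟨
  toℚᵘ (inv a * inv b)             ∎)
  where open ℚᵘ.≃-Reasoning

1/^≡inv^^ : ∀ n k → 1/ suc n ^ k ≡ inv n ^^ k
1/^≡inv^^ n zero    = refl
1/^≡inv^^ n (suc k) = step (suc n ℕ.^ k) {{ℕ.m^n≢0 (suc n) k}} (1/^≡inv^^ n k)
  where
  step : ∀ d .{{_ : NonZero d}} → ℤ.+ 1 / d ≡ inv n ^^ k →
         (ℤ.+ 1 / (suc n ℕ.* d)) {{ℕ.m*n≢0 (suc n) d}} ≡ inv n * inv n ^^ k
  step (suc d) p = trans (recip-* n d) (cong (inv n *_) p)

-- Difference tables and Hoffman duality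

-- Subtracting neighbouring columns in row n gives row n + 1. Column 0 of the next row needs column
-- 1 of this one, so the two identities are proved together. In the second, all coefficients are
-- nonnegative, which later carries complete monotonicity from s to its means t.
table-average : ∀ s t → t 0 ≡ s 0 →
  (∀ j → nat (2 ℕ.+ j) * t (suc j) ≡ nat (suc j) * t j + s (suc j)) →
  ∀ n → (nat (suc n) * table t n 0 ≡ table s n 0) ×
        (∀ j → nat (suc n) * table t n (suc j) ≡ table s n (suc j) + nat (suc j) * table t (suc n) j)
table-average s t t₀ tₛ zero =
  trans (ℚ.*-identityˡ (t 0)) t₀ ,
  λ j → trans (solve 3 (λ x k y → (con 1ℚ :+ con 0ℚ) :* y
                 := (con 1ℚ :+ k) :* y :- k :* x :+ k :* (x :- y)) refl (t j) (nat (suc j)) (t (suc j)))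
        (trans (cong (λ z → z - nat (suc j) * t j + nat (suc j) * (t j - t (suc j))) (tₛ j))
               (solve 4 (λ x k y s → (k :* x :+ s) :- k :* x :+ k :* (x :- y) := s :+ k :* (x :- y)) refl
                 (t j) (nat (suc j)) (t (suc j)) (s (suc j))))
table-average s t t₀ tₛ (suc n) with table-average s t t₀ tₛ n
... | h₀ , hₛ =
  trans (solve 3 (λ k x y → (con 1ℚ :+ k) :* (x :- y)
            := k :* x :- k :* y :+ (con 1ℚ :+ con 0ℚ) :* (x :- y)) refl (nat (suc n)) (table t n 0) (table t n 1))
  (trans (cong₂ (λ a b → a - b + nat 1 * (table t n 0 - table t n 1)) h₀ (hₛ 0))
         (solve 3 (λ a b c → a :- (b :+ c) :+ c := a :- b) refl
            (table s n 0) (table s n 1) (nat 1 * (table t n 0 - table t n 1)))) ,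
  λ j →
  trans (solve 3 (λ k x y → (con 1ℚ :+ k) :* (x :- y)
            := k :* x :- k :* y :+ (x :- y)) refl (nat (suc n)) (table t n (suc j)) (table t n (2 ℕ.+ j)))
  (trans (cong₂ (λ a b → a - b + (table t n (suc j) - table t n (2 ℕ.+ j))) (hₛ j) (hₛ (suc j)))
         (solve 6 (λ a b i x y z → (a :+ i :* (x :- y)) :- (b :+ (con 1ℚ :+ i) :* (y :- z)) :+ (y :- z)
                 := (a :- b) :+ i :* ((x :- y) :- (y :- z))) refl
            (table s n (suc j)) (table s n (2 ℕ.+ j)) (nat (suc j))
            (table t n j) (table t n (suc j)) (table t n (2 ℕ.+ j))))

-- The coefficient on the left grows by one from column to column, so subtracting neighbouring
-- columns leaves one surplus entry of row n, which joins the last term. Again all coefficients are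
-- nonnegative.
table-divide : ∀ h f → (∀ j → nat (suc j) * f j ≡ h j) →
  ∀ n j → (1ℚ + nat (suc n) + nat j) * table f (suc n) j ≡ table h (suc n) j + nat (suc n) * table f n j
table-divide h f p zero j =
  trans (solve 3 (λ j x y → (con 1ℚ :+ (con 1ℚ :+ con 0ℚ) :+ j) :* (x :- y)
             := (con 1ℚ :+ j) :* x :- (con 1ℚ :+ (con 1ℚ :+ j)) :* y :+ (con 1ℚ :+ con 0ℚ) :* x) refl
           (nat j) (f j) (f (suc j)))
        (cong₂ (λ a b → a - b + nat 1 * f j) (p j) (p (suc j)))
table-divide h f p (suc n) j =
  trans (solve 4 (λ k j x y → (con 1ℚ :+ (con 1ℚ :+ k) :+ j) :* (x :- y)
             := (con 1ℚ :+ k :+ j) :* x :- (con 1ℚ :+ k :+ (con 1ℚ :+ j)) :* y :+ x) refl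
           (nat (suc n)) (nat j) (table f (suc n) j) (table f (suc n) (suc j)))
  (trans (cong₂ (λ a b → a - b + table f (suc n) j) (table-divide h f p n j) (table-divide h f p n (suc j)))
         (solve 5 (λ a b k x y → (a :+ k :* x) :- (b :+ k :* y) :+ (x :- y)
                 := (a :- b) :+ (con 1ℚ :+ k) :* (x :- y)) refl
            (table h (suc n) j) (table h (suc n) (suc j)) (nat (suc n)) (table f n j) (table f n (suc j))))

open Rising ℚ-algebra using (Σ<; Σ<-cong)

average divide : (ℕ → ℚ) → ℕ → ℚ
average s j = inv j * Σ< (suc j) s
divide  h j = inv j * h j

-- Hausdorff's condition for the moments of a positive measure on [0,1]; it replaces the measure
-- throughout.
CompletelyMonotone : (ℕ → ℚ) → Set
CompletelyMonotone s = ∀ n j → 0ℚ ≤ table s n j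

average₀ : ∀ s → average s 0 ≡ s 0
average₀ s = solve 1 (λ x → con 1ℚ :* (con 0ℚ :+ x) := x) refl (s 0)

averageₛ : ∀ s j → nat (2 ℕ.+ j) * average s (suc j) ≡ nat (suc j) * average s j + s (suc j)
averageₛ s j = trans (nat*inv* (suc j) (Σ< (2 ℕ.+ j) s)) (cong (_+ s (suc j)) (sym (nat*inv* j (Σ< (suc j) s))))

-- The recursion lowers the column while the row grows, hence the statement for all rows at once.
average-CM : ∀ s → CompletelyMonotone s → CompletelyMonotone (average s)
average-CM s cm n zero    = 0≤nat*⇒0≤ n _
  (subst (0ℚ ≤_) (sym (proj₁ (table-average s (average s) (average₀ s) (averageₛ s) n))) (cm n 0))
average-CM s cm n (suc j) = 0≤nat*⇒0≤ n _
  (subst (0ℚ ≤_) (sym (proj₂ (table-average s (average s) (average₀ s) (averageₛ s) n) j))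
    (0≤+ (cm n (suc j)) (0≤* (0≤nat (suc j)) (average-CM s cm (suc n) j))))

divide-CM : ∀ h → CompletelyMonotone h → CompletelyMonotone (divide h)
divide-CM h cm zero    j = 0≤* (0≤inv j) (cm 0 j)
divide-CM h cm (suc n) j = 0≤nat*⇒0≤ (suc n ℕ.+ j) _
  (subst (0ℚ ≤_)
    (sym (trans (cong (_* table (divide h) (suc n) j) (trans (cong (1ℚ +_) (nat-+ (suc n) j)) (sym (ℚ.+-assoc 1ℚ (nat (suc n)) (nat j)))))
                (table-divide h (divide h) (λ j → nat*inv* j (h j)) n j)))
    (0≤+ (cm (suc n) j) (0≤* (0≤nat (suc n)) (divide-CM h cm n j))))

table-≤ : ∀ s → CompletelyMonotone s → ∀ n j → table s n j ≤ s j
table-≤ s cm zero    j = ℚ.≤-refl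
table-≤ s cm (suc n) j = ℚ.≤-trans
  (ℚ.≤-trans (ℚ.+-monoʳ-≤ (table s n j) (ℚ.neg-antimono-≤ (cm n (suc j)))) (ℚ.≤-reflexive (ℚ.+-identityʳ _)))
  (table-≤ s cm n j)

-- The substitution u ↦ 1 - u in the integral representation of table: this is Hoffman duality.
dual : (ℕ → ℚ) → ℕ → ℚ
dual s n = table s n 0

-- Together with `dual-divide` this says that duality exchanges the two operations: a mean becomes a
-- division by n + 1, and a division becomes a mean.
dual-average : ∀ s n → dual (average s) n ≡ inv n * dual s n
dual-average s n = nat*-injective n _ _ (proj₁ (table-average s (average s) (average₀ s) (averageₛ s) n))

dual-divide : ∀ h n → dual (divide h) n ≡ inv n * Σ< (suc n) (dual h)
dual-divide h n = nat*-injective n _ _ (go n)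
  where
  f = divide h

  go : ∀ n → nat (suc n) * dual f n ≡ Σ< (suc n) (dual h)
  go zero    = solve 1 (λ x → (con 1ℚ :+ con 0ℚ) :* (con 1ℚ :* x) := con 0ℚ :+ x) refl (h 0)
  go (suc n) = trans (solve 2 (λ k x → (con 1ℚ :+ k) :* x := (con 1ℚ :+ k :+ con 0ℚ) :* x) refl (nat (suc n)) (dual f (suc n)))
    (trans (table-divide h f (λ j → nat*inv* j (h j)) n 0)
    (trans (ℚ.+-comm (dual h (suc n)) _) (cong (_+ dual h (suc n)) (go n))))

Σ<≡∑ : ∀ {g} {f : (i : ℕ) .{{_ : NonZero i}} → ℚ} n → (∀ k → g k ≡ f (suc k)) → Σ< n g ≡ ∑ n f
Σ<≡∑ zero    p = refl
Σ<≡∑ (suc n) p = cong₂ _+_ (Σ<≡∑ n p) (p n)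

ones : ℕ → Index
ones k = (1 ∷ []) ×× k

Dual : (ℕ → ℚ) → Index → Set
Dual s l = ∀ n → dual s n ≡ inv n * ζ⋆[ suc n ] l

Dual-divide : ∀ {h} l → Dual h l → Dual (divide h) (1 ∷ l)
Dual-divide {h} l d n = trans (dual-divide h n) (cong (inv n *_) (Σ<≡∑ (suc n) λ k →
  trans (d k) (cong (_* ζ⋆[ suc k ] l) (sym (trans (1/^≡inv^^ k 1) (ℚ.*-identityʳ (inv k)))))))

-- `average` puts a second factor `inv k` on the k-th dual value before `divide` sums these values;
-- so the new outermost exponent is 2 and not 1.
Dual-average : ∀ {s} l → Dual s l → Dual (divide (average s)) (2 ∷ l)
Dual-average {s} l d n = trans (dual-divide (average s) n) (cong (inv n *_) (Σ<≡∑ (suc n) λ k →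
  trans (dual-average s k) (trans (cong (inv k *_) (d k)) (trans
    (solve 2 (λ i z → i :* (i :* z) := i :* (i :* con 1ℚ) :* z) refl (inv k) (ζ⋆[ suc k ] l))
    (cong (_* ζ⋆[ suc k ] l) (sym (1/^≡inv^^ k 2)))))))

divides : ℕ → (ℕ → ℚ) → ℕ → ℚ
divides zero    h = h
divides (suc k) h = divide (divides k h)

divides-CM : ∀ k h → CompletelyMonotone h → CompletelyMonotone (divides k h)
divides-CM zero    h cm = cm
divides-CM (suc k) h cm = divide-CM _ (divides-CM k h cm)

divides-^^ : ∀ k h j → divides k h j ≡ inv j ^^ k * h j
divides-^^ zero    h j = sym (ℚ.*-identityˡ (h j))
divides-^^ (suc k) h j = trans (cong (inv j *_) (divides-^^ k h j)) (sym (ℚ.*-assoc (inv j) (inv j ^^ k) (h j)))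

Dual-divides : ∀ {h} l k → Dual h l → Dual (divides k h) (ones k ++ l)
Dual-divides l zero    d = d
Dual-divides l (suc k) d = Dual-divide (ones k ++ l) (Dual-divides l k d)

table-1 : ∀ n j → table (λ _ → 1ℚ) (suc n) j ≡ 0ℚ
table-1 zero    j = refl
table-1 (suc n) j = cong₂ _-_ (table-1 n j) (table-1 n (suc j))

one-CM : CompletelyMonotone (λ _ → 1ℚ)
one-CM zero    j = 0≤1
one-CM (suc n) j = ℚ.≤-reflexive (sym (table-1 n j))

-- The constant sequence belongs to the point mass at u = 1, whose dual is 1 at n = 0 and 0
-- elsewhere. The first division turns this into `inv n`, the case of the empty index.
Dual-one : ∀ k → Dual (divides (suc k) (λ _ → 1ℚ)) (ones k)
Dual-one zero    n = trans (dual-divide (λ _ → 1ℚ) n) (cong (inv n *_) (go n))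
  where
  go : ∀ n → Σ< (suc n) (dual (λ _ → 1ℚ)) ≡ 1ℚ
  go zero    = refl
  go (suc n) = trans (cong₂ _+_ (go n) (table-1 n 0)) refl
Dual-one (suc k) = Dual-divide (ones k) (Dual-one k)

-- The index of the theorem for m + 1 and p + 1.
block : ℕ → ℕ → Index
block m p = (ones m ++ 2 ∷ []) ×× p ++ ones (suc m)

block-suc : ∀ m p → block m (suc p) ≡ ones m ++ 2 ∷ block m p
block-suc m p = trans (List.++-assoc (ones m ++ 2 ∷ []) ((ones m ++ 2 ∷ []) ×× p) (ones (suc m)))
                      (List.++-assoc (ones m) (2 ∷ []) (block m p))

-- level m p j is the term n = j + 1 of ζ⋆({m + 2}_{p + 1}), whose partial sums are levelSum m (p + 1).
level : ℕ → ℕ → ℕ → ℚ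
level m zero    = divides (2 ℕ.+ m) (λ _ → 1ℚ)
level m (suc p) = divides m (divide (average (level m p)))

level-CM : ∀ m p → CompletelyMonotone (level m p)
level-CM m zero    = divides-CM (2 ℕ.+ m) _ one-CM
level-CM m (suc p) = divides-CM m _ (divide-CM _ (average-CM _ (level-CM m p)))

level-dual : ∀ m p → Dual (level m p) (block m p)
level-dual m zero    = Dual-one (suc m)
level-dual m (suc p) = subst (Dual (level m (suc p))) (sym (block-suc m p))
  (Dual-divides (2 ∷ block m p) m (Dual-average (block m p) (level-dual m p)))

levelSum : ℕ → ℕ → ℕ → ℚ
levelSum m zero    N = 1ℚ
levelSum m (suc p) N = Σ< N (level m p)

level-^^ : ∀ m p j → level m p j ≡ inv j ^^ (2 ℕ.+ m) * levelSum m p (suc j)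
level-^^ m zero    j = divides-^^ (2 ℕ.+ m) _ j
level-^^ m (suc p) j = trans (divides-^^ m _ j)
  (solve 3 (λ i e s → e :* (i :* (i :* s)) := i :* (i :* e) :* s) refl (inv j) (inv j ^^ m) (Σ< (suc j) (level m p)))

-- Estimates up to powers of a logarithm

-- 1 plus the n-th harmonic number. The start at 1 makes its powers increase with the exponent.
ℓ : ℕ → ℚ
ℓ zero    = 1ℚ
ℓ (suc n) = ℓ n + inv n

ℓ-step : ∀ n → ℓ n ≤ ℓ (suc n)
ℓ-step n = ℚ.≤-trans (ℚ.≤-reflexive (sym (ℚ.+-identityʳ (ℓ n)))) (ℚ.+-monoʳ-≤ (ℓ n) (0≤inv n))

ℓ-mono′ : ∀ {m n} → m ℕ.≤′ n → ℓ m ≤ ℓ n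
ℓ-mono′ ℕ.≤′-refl     = ℚ.≤-refl
ℓ-mono′ (ℕ.≤′-step {n = n} p) = ℚ.≤-trans (ℓ-mono′ p) (ℓ-step n)

ℓ-mono : ∀ {m n} → m ℕ.≤ n → ℓ m ≤ ℓ n
ℓ-mono p = ℓ-mono′ (ℕ.≤⇒≤′ p)

1≤ℓ : ∀ n → 1ℚ ≤ ℓ n
1≤ℓ n = ℓ-mono (ℕ.z≤n {n})

0≤ℓ : ∀ n → 0ℚ ≤ ℓ n
0≤ℓ n = ℚ.≤-trans 0≤1 (1≤ℓ n)

0≤^^ : ∀ {x} → 0ℚ ≤ x → ∀ k → 0ℚ ≤ x ^^ k
0≤^^ p zero    = 0≤1
0≤^^ p (suc k) = 0≤* p (0≤^^ p k)

^^-mono : ∀ {x y} → 0ℚ ≤ x → x ≤ y → ∀ k → x ^^ k ≤ y ^^ k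
^^-mono 0≤x x≤y zero    = ℚ.≤-refl
^^-mono 0≤x x≤y (suc k) = *-mono 0≤x (0≤^^ (ℚ.≤-trans 0≤x x≤y) k) x≤y (^^-mono 0≤x x≤y k)

infixl 6 _∔_
infixl 7 _∙_

-- Polynomials in the logarithm with nonnegative coefficients, kept as syntax: an estimate combines
-- the bounds of its ingredients without choosing exponents or constants, which `Bound-power`
-- extracts at the end.
data Bound : Set where
  𝟏 log   : Bound
  _∔_ _∙_ : Bound → Bound → Bound

⟦_⟧ : Bound → ℚ → ℚ
⟦ 𝟏 ⟧     x = 1ℚ
⟦ log ⟧   x = x
⟦ d ∔ e ⟧ x = ⟦ d ⟧ x + ⟦ e ⟧ x
⟦ d ∙ e ⟧ x = ⟦ d ⟧ x * ⟦ e ⟧ x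

0≤⟦_⟧ : ∀ e {x} → 0ℚ ≤ x → 0ℚ ≤ ⟦ e ⟧ x
0≤⟦ 𝟏 ⟧     p = 0≤1
0≤⟦ log ⟧   p = p
0≤⟦ d ∔ e ⟧ p = 0≤+ (0≤⟦ d ⟧ p) (0≤⟦ e ⟧ p)
0≤⟦ d ∙ e ⟧ p = 0≤* (0≤⟦ d ⟧ p) (0≤⟦ e ⟧ p)

logPower : ℕ → Bound
logPower zero    = 𝟏
logPower (suc k) = log ∙ logPower k

⟦logPower⟧ : ∀ k x → ⟦ logPower k ⟧ x ≡ x ^^ k
⟦logPower⟧ zero    x = refl
⟦logPower⟧ (suc k) x = cong (x *_) (⟦logPower⟧ k x)

Family : Set
Family = ℕ → ℕ → ℚ

-- a M j = O(φ M j) for j ≤ M, up to powers of log M; there are M + 1 terms, so inv₁ is 1 / N.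
Õ : Family → Family → Set
Õ φ a = ∃[ e ] ∀ M j → j ℕ.≤ M → ∣ a M j ∣ ≤ ⟦ e ⟧ (ℓ (suc M)) * φ M j

one inv₁ inv₂ inv₁₂ : Family
one   M j = 1ℚ
inv₁  M j = inv M
inv₂  M j = inv j
inv₁₂ M j = inv M * inv j

module _ {φ : Family} where

  Õ-mono : ∀ {ψ a} → (∀ M j → j ℕ.≤ M → φ M j ≤ ψ M j) → Õ φ a → Õ ψ a
  Õ-mono p (e , h) = e , λ M j j≤M → ℚ.≤-trans (h M j j≤M)
    (ℚ.*-monoˡ-≤-nonNeg (⟦ e ⟧ (ℓ (suc M))) {{nonNegative (0≤⟦ e ⟧ (0≤ℓ (suc M)))}} (p M j j≤M))

  Õ-resp : ∀ {a b} → (∀ M j → j ℕ.≤ M → a M j ≡ b M j) → Õ φ a → Õ φ b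
  Õ-resp p (e , h) = e , λ M j j≤M → subst (λ z → ∣ z ∣ ≤ ⟦ e ⟧ (ℓ (suc M)) * φ M j) (p M j j≤M) (h M j j≤M)

  Õ-+ : ∀ {a b} → Õ φ a → Õ φ b → Õ φ (λ M j → a M j + b M j)
  Õ-+ {a} {b} (d , g) (e , h) = d ∔ e , λ M j j≤M → ℚ.≤-trans (ℚ.∣p+q∣≤∣p∣+∣q∣ (a M j) (b M j))
    (ℚ.≤-trans (ℚ.+-mono-≤ (g M j j≤M) (h M j j≤M))
               (ℚ.≤-reflexive (sym (ℚ.*-distribʳ-+ (φ M j) (⟦ d ⟧ (ℓ (suc M))) (⟦ e ⟧ (ℓ (suc M)))))))

  Õ-neg : ∀ {a} → Õ φ a → Õ φ (λ M j → - a M j)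
  Õ-neg {a} (e , h) = e , λ M j j≤M → subst (_≤ _) (sym (ℚ.∣-p∣≡∣p∣ (a M j))) (h M j j≤M)

  Õ-* : ∀ {ψ a b} → Õ φ a → Õ ψ b → Õ (λ M j → φ M j * ψ M j) (λ M j → a M j * b M j)
  Õ-* {ψ} {a} {b} (d , g) (e , h) = d ∙ e , λ M j j≤M → begin
    ∣ a M j * b M j ∣              ≡⟨ ℚ.∣p*q∣≡∣p∣*∣q∣ (a M j) (b M j) ⟩
    ∣ a M j ∣ * ∣ b M j ∣          ≤⟨ *-mono (ℚ.0≤∣p∣ (a M j)) (ℚ.≤-trans (ℚ.0≤∣p∣ (b M j)) (h M j j≤M)) (g M j j≤M) (h M j j≤M) ⟩
    (⟦ d ⟧ (ℓ (suc M)) * φ M j) * (⟦ e ⟧ (ℓ (suc M)) * ψ M j)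
      ≡⟨ solve 4 (λ a b c d → (a :* b) :* (c :* d) := (a :* c) :* (b :* d)) refl
           (⟦ d ⟧ (ℓ (suc M))) (φ M j) (⟦ e ⟧ (ℓ (suc M))) (ψ M j) ⟩
    ⟦ d ∙ e ⟧ (ℓ (suc M)) * (φ M j * ψ M j) ∎
    where open ℚ.≤-Reasoning

  Õ-one* : ∀ {a b} → Õ one a → Õ φ b → Õ φ (λ M j → a M j * b M j)
  Õ-one* {a} {b} (d , g) (e , h) = d ∙ e , λ M j j≤M → begin
    ∣ a M j * b M j ∣              ≡⟨ ℚ.∣p*q∣≡∣p∣*∣q∣ (a M j) (b M j) ⟩
    ∣ a M j ∣ * ∣ b M j ∣          ≤⟨ *-mono (ℚ.0≤∣p∣ (a M j)) (ℚ.≤-trans (ℚ.0≤∣p∣ (b M j)) (h M j j≤M)) (g M j j≤M) (h M j j≤M) ⟩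
    (⟦ d ⟧ (ℓ (suc M)) * 1ℚ) * (⟦ e ⟧ (ℓ (suc M)) * φ M j)
      ≡⟨ solve 3 (λ a b c → (a :* con 1ℚ) :* (b :* c) := (a :* b) :* c) refl
           (⟦ d ⟧ (ℓ (suc M))) (⟦ e ⟧ (ℓ (suc M))) (φ M j) ⟩
    ⟦ d ∙ e ⟧ (ℓ (suc M)) * φ M j ∎
    where open ℚ.≤-Reasoning

  Õ-0 : (∀ M j → 0ℚ ≤ φ M j) → Õ φ (λ _ _ → 0ℚ)
  Õ-0 p = 𝟏 , λ M j _ → 0≤* 0≤1 (p M j)

-- The numbers `inv i` with i < j add up to less than `ℓ j`, so a summation costs one more factor
-- `log`. The range includes j = M + 1, the full sum.
Σ-bound : ∀ (g : ℕ → ℚ) → (∀ M → 0ℚ ≤ g M) → ∀ {a} → Õ (λ M j → g M * inv j) a →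
          ∃[ e ] ∀ M j → j ℕ.≤ suc M → ∣ Σ< j (a M) ∣ ≤ ⟦ e ⟧ (ℓ (suc M)) * g M
Σ-bound g 0≤g {a} (e , h) = e ∙ log , λ M j j≤ → ℚ.≤-trans (go M j j≤)
  (ℚ.≤-trans (ℚ.*-monoˡ-≤-nonNeg (⟦ e ⟧ (ℓ (suc M)) * g M) {{nonNegative (0≤E M)}} (ℓ-mono j≤))
    (ℚ.≤-reflexive (solve 3 (λ a b c → a :* b :* c := a :* c :* b) refl (⟦ e ⟧ (ℓ (suc M))) (g M) (ℓ (suc M)))))
  where
  open ℚ.≤-Reasoning

  0≤E : ∀ M → 0ℚ ≤ ⟦ e ⟧ (ℓ (suc M)) * g M
  0≤E M = 0≤* (0≤⟦ e ⟧ (0≤ℓ (suc M))) (0≤g M)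

  go : ∀ M j → j ℕ.≤ suc M → ∣ Σ< j (a M) ∣ ≤ ⟦ e ⟧ (ℓ (suc M)) * g M * ℓ j
  go M zero    _ = 0≤* (0≤E M) 0≤1
  go M (suc j) (ℕ.s≤s j≤M) = begin
    ∣ Σ< j (a M) + a M j ∣
      ≤⟨ ℚ.∣p+q∣≤∣p∣+∣q∣ (Σ< j (a M)) (a M j) ⟩
    ∣ Σ< j (a M) ∣ + ∣ a M j ∣
      ≤⟨ ℚ.+-mono-≤ (go M j (ℕ.m≤n⇒m≤1+n j≤M)) (h M j j≤M) ⟩
    ⟦ e ⟧ (ℓ (suc M)) * g M * ℓ j + ⟦ e ⟧ (ℓ (suc M)) * (g M * inv j)
      ≡⟨ solve 4 (λ a b c d → a :* b :* c :+ a :* (b :* d) := a :* b :* (c :+ d)) refl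
           (⟦ e ⟧ (ℓ (suc M))) (g M) (ℓ j) (inv j) ⟩
    ⟦ e ⟧ (ℓ (suc M)) * g M * ℓ (suc j) ∎

inv≤1 : ∀ n → inv n ≤ 1ℚ
inv≤1 n = recip-anti (suc n) 1 (ℕ.s≤s ℕ.z≤n)

inv^^≤1 : ∀ n k → inv n ^^ k ≤ 1ℚ
inv^^≤1 n zero    = ℚ.≤-refl
inv^^≤1 n (suc k) = ℚ.≤-trans (*-mono (0≤inv n) 0≤1 (inv≤1 n) (inv^^≤1 n k)) (ℚ.≤-reflexive (ℚ.*-identityˡ 1ℚ))

inv₂⊆one : ∀ {a} → Õ inv₂ a → Õ one a
inv₂⊆one = Õ-mono (λ M j _ → inv≤1 j)

inv²⊆inv₂ : ∀ {a} → Õ (λ M j → inv j * inv j) a → Õ inv₂ a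
inv²⊆inv₂ = Õ-mono (λ M j _ → ℚ.≤-trans (*-mono (0≤inv j) (0≤inv j) (inv≤1 j) ℚ.≤-refl) (ℚ.≤-reflexive (ℚ.*-identityˡ (inv j))))

inv^^-Õ : ∀ k → Õ (λ M j → inv j * inv j) (λ M j → inv j ^^ (2 ℕ.+ k))
inv^^-Õ k = 𝟏 , λ M j _ → begin
  ∣ inv j ^^ (2 ℕ.+ k) ∣      ≡⟨ ℚ.0≤p⇒∣p∣≡p (0≤^^ (0≤inv j) (2 ℕ.+ k)) ⟩
  inv j * (inv j * inv j ^^ k) ≤⟨ *-mono (0≤inv j) (0≤* (0≤inv j) 0≤1) ℚ.≤-refl (*-mono (0≤inv j) 0≤1 ℚ.≤-refl (inv^^≤1 j k)) ⟩
  inv j * (inv j * 1ℚ)         ≡⟨ solve 1 (λ i → i :* (i :* con 1ℚ) := con 1ℚ :* (i :* i)) refl (inv j) ⟩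
  1ℚ * (inv j * inv j)         ∎
  where open ℚ.≤-Reasoning

level-Õ : ∀ m p → Õ (λ M j → inv j * inv j) (λ M j → level m p j)
levelSum-bound : ∀ m p → ∃[ e ] ∀ M j → j ℕ.≤ suc M → ∣ levelSum m p j ∣ ≤ ⟦ e ⟧ (ℓ (suc M)) * 1ℚ

level-Õ m p = Õ-resp (λ M j _ → trans (ℚ.*-comm _ (inv j ^^ (2 ℕ.+ m))) (sym (level-^^ m p j)))
  (Õ-one* {a = λ M j → levelSum m p (suc j)} (proj₁ (levelSum-bound m p) , λ M j j≤M → proj₂ (levelSum-bound m p) M (suc j) (ℕ.s≤s j≤M))
          (inv^^-Õ m))

levelSum-bound m zero    = 𝟏 , λ M j _ → ℚ.≤-refl
levelSum-bound m (suc p) = Σ-bound (λ _ → 1ℚ) (λ _ → 0≤1)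
  (Õ-mono (λ M j _ → ℚ.≤-reflexive (sym (ℚ.*-identityˡ (inv j)))) (inv²⊆inv₂ (level-Õ m p)))

product-≤ : ∀ a b → inv a * inv b ≤ inv (a ℕ.+ b)
product-≤ a b = ℚ.≤-trans (ℚ.≤-reflexive (sym (recip-* a b)))
  (recip-anti (suc a ℕ.* suc b) (suc (a ℕ.+ b))
    (ℕ.s≤s (ℕ.≤-trans (ℕ.≤-reflexive (ℕ.+-comm a b)) (ℕ.+-monoʳ-≤ b (ℕ.m≤m*n a (suc b))))))

Σ<-Õ : ∀ {a} → Õ inv₂ a → Õ one (λ M j → Σ< j (a M))
Σ<-Õ {a} p = proj₁ q , λ M j j≤M → proj₂ q M j (ℕ.m≤n⇒m≤1+n j≤M)
  where
  q = Σ-bound (λ _ → 1ℚ) (λ _ → 0≤1) (Õ-mono (λ M j _ → ℚ.≤-reflexive (sym (ℚ.*-identityˡ (inv j)))) p)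

Σ<-total : ∀ {a} → Õ inv₁₂ a → Õ inv₁ (λ M _ → Σ< (suc M) (a M))
Σ<-total p = proj₁ q , λ M j _ → proj₂ q M (suc M) ℕ.≤-refl
  where
  q = Σ-bound inv 0≤inv p

PositiveIndex : Index → Set
PositiveIndex = All NonZero

ζ⋆-bound : ∀ {l} → PositiveIndex l → ∃[ e ] ∀ M j → j ℕ.≤ suc M → ∣ ζ⋆[ j ] l ∣ ≤ ⟦ e ⟧ (ℓ (suc M)) * 1ℚ
ζ⋆-bound {[]}        _        = 𝟏 , λ M j _ → ℚ.≤-refl
ζ⋆-bound {suc k ∷ l} (_ ∷ ps) = proj₁ q , λ M j j≤ →
  subst (λ z → ∣ z ∣ ≤ ⟦ proj₁ q ⟧ (ℓ (suc M)) * 1ℚ) (Σ<≡∑ j (λ i → refl)) (proj₂ q M j j≤)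
  where
  h = ζ⋆-bound ps

  term : Õ inv₂ (λ M j → 1/ suc j ^ suc k * ζ⋆[ suc j ] l)
  term = Õ-resp (λ M j _ → ℚ.*-comm (ζ⋆[ suc j ] l) (1/ suc j ^ suc k))
    (Õ-one* {a = λ M j → ζ⋆[ suc j ] l} (proj₁ h , λ M j j≤M → proj₂ h M (suc j) (ℕ.s≤s j≤M))
            (𝟏 , λ M j _ → begin
      ∣ 1/ suc j ^ suc k ∣       ≡⟨ cong ∣_∣ (1/^≡inv^^ j (suc k)) ⟩
      ∣ inv j ^^ suc k ∣         ≡⟨ ℚ.0≤p⇒∣p∣≡p (0≤^^ (0≤inv j) (suc k)) ⟩
      inv j * inv j ^^ k         ≤⟨ *-mono (0≤inv j) 0≤1 ℚ.≤-refl (inv^^≤1 j k) ⟩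
      inv j * 1ℚ                 ≡⟨ ℚ.*-comm (inv j) 1ℚ ⟩
      1ℚ * inv j                 ∎))
    where open ℚ.≤-Reasoning

  q = Σ-bound (λ _ → 1ℚ) (λ _ → 0≤1) (Õ-mono (λ M j _ → ℚ.≤-reflexive (sym (ℚ.*-identityˡ (inv j)))) term)

ones-positive : ∀ k {l} → PositiveIndex l → PositiveIndex (ones k ++ l)
ones-positive zero    p = p
ones-positive (suc k) p = _ ∷ ones-positive k p

block-positive : ∀ m p → PositiveIndex (block m p)
block-positive m zero    = subst PositiveIndex (List.++-identityʳ (ones (suc m))) (ones-positive (suc m) [])
block-positive m (suc p) = subst PositiveIndex (sym (block-suc m p)) (ones-positive m (_ ∷ block-positive m p))

-- Newton series at x - j

module X = PowerSeries ℚ-algebra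

𝕏 : ℚ-Algebra
𝕏 = X.powerSeries

module 𝕏 where
  open ℚ-Algebra 𝕏 public
  open Rising 𝕏 public

open X using (Series; _≋_; _⊕_; _⊛_; ⊝_; const)
open 𝕏.Solver using () renaming
  (solve to solveₓ; _:=_ to _:=ₓ_; _:+_ to _:+ₓ_; _:*_ to _:*ₓ_; _:-_ to _:-ₓ_; :-_ to :-ₓ_)

Σ<-coeff : ∀ N F r → 𝕏.Σ< N F r ≡ Σ< N (λ n → F n r)
Σ<-coeff zero    F r = X.const-0 r
Σ<-coeff (suc N) F r = cong (_+ F N r) (Σ<-coeff N F r)

⊛-const : ∀ f c r → (f ⊛ const c) r ≡ f r * c
⊛-const f c r = trans (X.⊛-comm f (const c) r) (trans (X.const-⊛ c f r) (ℚ.*-comm c (f r)))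

linear : ∀ f c g → g ≋ const c ⊕ X.X → f ⊛ g ≋ (λ r → c * f r) ⊕ X.X ⊛ f
linear f c g p r = trans (X.⊛-comm f g r) (trans (X.⊛-cong p (λ _ → refl) r)
  (trans (X.⊛-distribʳ f (const c) X.X r) (cong (_+ (X.X ⊛ f) r) (X.const-⊛ c f r))))

linear₀ : ∀ f c g → g ≋ const c ⊕ X.X → (f ⊛ g) 0 ≡ c * f 0
linear₀ f c g p = trans (linear f c g p 0) (solve 2 (λ c x → c :* x :+ con 0ℚ :* x := c :* x) refl c (f 0))

linearₛ : ∀ f c g → g ≋ const c ⊕ X.X → ∀ r → (f ⊛ g) (suc r) ≡ c * f (suc r) + f r
linearₛ f c g p r = trans (linear f c g p (suc r)) (cong (c * f (suc r) +_) (X.X-⊛ f r))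

-- The point x - j, where x is a formal variable.
node : ℕ → Series
node j = X.X 𝕏.- 𝕏.ι (nat j)

node-linear : ∀ j n → node j ⊕ 𝕏.ι (nat n) ≋ const (nat n - nat j) ⊕ X.X
node-linear j n zero          = solve 2 (λ n j → con 0ℚ :+ :- j :+ n := n :- j :+ con 0ℚ) refl (nat n) (nat j)
node-linear j n (suc zero)    = refl
node-linear j n (suc (suc _)) = refl

node-suc : ∀ j → node (suc j) ⊕ const 1ℚ ≋ node j
node-suc j zero    = solve 1 (λ j → con 0ℚ :+ :- (con 1ℚ :+ j) :+ con 1ℚ := con 0ℚ :- j) refl (nat j)
node-suc j (suc r) = ℚ.+-identityʳ _

-- w j = 1 / (j + 1 - x)
w : ℕ → Series
w j r = inv j ^^ suc r

w-inverse : ∀ j → w j ⊛ (⊝ node (suc j)) ≋ const 1ℚ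
w-inverse j r = trans (X.⊛-comm (w j) (⊝ node (suc j)) r)
  (trans (sym (-‿distribˡ-* (node (suc j)) (w j) r)) (trans (cong -_ (X.⊛-comm (node (suc j)) (w j) r)) (go r)))
  where
  open Algebra.Properties.Ring 𝕏.ring using (-‿distribˡ-*)
  lin : node (suc j) ≋ const (- nat (suc j)) ⊕ X.X
  lin zero          = solve 1 (λ j → con 0ℚ :+ :- j := :- j :+ con 0ℚ) refl (nat (suc j))
  lin (suc zero)    = refl
  lin (suc (suc _)) = refl

  go : ∀ r → - (w j ⊛ node (suc j)) r ≡ const 1ℚ r
  go zero    = trans (cong -_ (linear₀ (w j) _ _ lin))
    (trans (solve 2 (λ k i → :- (:- k :* (i :* con 1ℚ)) := k :* i) refl (nat (suc j)) (inv j)) (nat*inv j))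
  go (suc r) = trans (cong -_ (linearₛ (w j) _ _ lin r))
    (trans (solve 3 (λ k i e → :- (:- k :* (i :* e) :+ e) := k :* (i :* e) :- e) refl (nat (suc j)) (inv j) (w j r))
    (trans (cong (_- w j r) (nat*inv* j (w j r))) (ℚ.+-inverseʳ (w j r))))

-- Coefficientwise domination by B / (1 - ℓ_n x).
LogBounded : ℕ → ℚ → Series → Set
LogBounded n B f = ∀ r → ∣ f r ∣ ≤ ℓ n ^^ r * B

-- The coefficient f r enters with weight 1 = (n + 1) · `inv n`. So n + 1 comes out as a common
-- factor and the base of the bound grows by `inv n`, that is, from `ℓ n` to `ℓ (suc n)`.
LogBounded-linear : ∀ {n B f} c g → g ≋ const c ⊕ X.X → ∣ c ∣ ≤ nat (suc n) → 0ℚ ≤ B →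
                    LogBounded n B f → LogBounded (suc n) (nat (suc n) * B) (f ⊛ g)
LogBounded-linear {n} {B} {f} c g p c≤ 0≤B h zero = begin
  ∣ (f ⊛ g) 0 ∣              ≡⟨ cong ∣_∣ (linear₀ f c g p) ⟩
  ∣ c * f 0 ∣                ≡⟨ ℚ.∣p*q∣≡∣p∣*∣q∣ c (f 0) ⟩
  ∣ c ∣ * ∣ f 0 ∣            ≤⟨ *-mono (ℚ.0≤∣p∣ c) (0≤* 0≤1 0≤B) c≤ (h 0) ⟩
  nat (suc n) * (1ℚ * B)     ≡⟨ solve 2 (λ k b → k :* (con 1ℚ :* b) := con 1ℚ :* (k :* b)) refl (nat (suc n)) B ⟩
  1ℚ * (nat (suc n) * B)     ∎
  where open ℚ.≤-Reasoning
LogBounded-linear {n} {B} {f} c g p c≤ 0≤B h (suc r) = begin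
  ∣ (f ⊛ g) (suc r) ∣
    ≡⟨ cong ∣_∣ (linearₛ f c g p r) ⟩
  ∣ c * f (suc r) + f r ∣
    ≤⟨ ℚ.∣p+q∣≤∣p∣+∣q∣ (c * f (suc r)) (f r) ⟩
  ∣ c * f (suc r) ∣ + ∣ f r ∣
    ≡⟨ cong (_+ ∣ f r ∣) (ℚ.∣p*q∣≡∣p∣*∣q∣ c (f (suc r))) ⟩
  ∣ c ∣ * ∣ f (suc r) ∣ + ∣ f r ∣
    ≤⟨ ℚ.+-mono-≤ (*-mono (ℚ.0≤∣p∣ c) (0≤* (0≤^^ (0≤ℓ n) (suc r)) 0≤B) c≤ (h (suc r))) (h r) ⟩
  nat (suc n) * (ℓ n * ℓ n ^^ r * B) + ℓ n ^^ r * B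
    ≡⟨ cong (nat (suc n) * (ℓ n * ℓ n ^^ r * B) +_) (cong (_* B) (sym (nat*inv* n (ℓ n ^^ r)))) ⟩
  nat (suc n) * (ℓ n * ℓ n ^^ r * B) + nat (suc n) * (inv n * ℓ n ^^ r) * B
    ≡⟨ solve 5 (λ k l e b i → k :* (l :* e :* b) :+ k :* (i :* e) :* b := (l :+ i) :* e :* (k :* b)) refl
         (nat (suc n)) (ℓ n) (ℓ n ^^ r) B (inv n) ⟩
  ℓ (suc n) * ℓ n ^^ r * (nat (suc n) * B)
    ≤⟨ ℚ.*-monoʳ-≤-nonNeg (nat (suc n) * B) {{nonNegative (0≤* (0≤nat (suc n)) 0≤B)}}
         (ℚ.*-monoˡ-≤-nonNeg (ℓ (suc n)) {{nonNegative (0≤ℓ (suc n))}} (^^-mono (0≤ℓ n) (ℓ-step n) r)) ⟩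
  ℓ (suc n) ^^ suc r * (nat (suc n) * B) ∎
  where open ℚ.≤-Reasoning

LogBounded-scale : ∀ {n B f} k → LogBounded n B f → LogBounded n (B * inv k) (f ⊛ 𝕏.ι (inv k))
LogBounded-scale {n} {B} {f} k h r = begin
  ∣ (f ⊛ const (inv k)) r ∣   ≡⟨ cong ∣_∣ (⊛-const f (inv k) r) ⟩
  ∣ f r * inv k ∣             ≡⟨ ℚ.∣p*q∣≡∣p∣*∣q∣ (f r) (inv k) ⟩
  ∣ f r ∣ * ∣ inv k ∣         ≡⟨ cong (∣ f r ∣ *_) (ℚ.0≤p⇒∣p∣≡p (0≤inv k)) ⟩
  ∣ f r ∣ * inv k             ≤⟨ ℚ.*-monoʳ-≤-nonNeg (inv k) {{nonNegative (0≤inv k)}} (h r) ⟩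
  ℓ n ^^ r * B * inv k        ≡⟨ ℚ.*-assoc (ℓ n ^^ r) B (inv k) ⟩
  ℓ n ^^ r * (B * inv k)      ∎
  where open ℚ.≤-Reasoning

LogBounded-resp : ∀ {n B C f g} → f ≋ g → B ≡ C → LogBounded n B f → LogBounded n C g
LogBounded-resp {n} p refl h r = subst (λ z → ∣ z ∣ ≤ ℓ n ^^ r * _) (p r) (h r)

∣nat-nat∣≤ : ∀ {j n} → j ℕ.≤ n → ∣ nat n - nat j ∣ ≤ nat n
∣nat-nat∣≤ {j} {n} j≤n = begin
  ∣ nat n - nat j ∣                ≡⟨ cong (λ z → ∣ nat z - nat j ∣) (ℕ.m+[n∸m]≡n j≤n) ⟨
  ∣ nat (j ℕ.+ (n ∸ j)) - nat j ∣  ≡⟨ cong ∣_∣ (trans (cong (_- nat j) (nat-+ j (n ∸ j)))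
                                       (solve 2 (λ a b → a :+ b :- a := b) refl (nat j) (nat (n ∸ j)))) ⟩
  ∣ nat (n ∸ j) ∣                  ≡⟨ ℚ.0≤p⇒∣p∣≡p (0≤nat (n ∸ j)) ⟩
  nat (n ∸ j)                      ≤⟨ p≤q+p (nat (n ∸ j)) (0≤nat j) ⟩
  nat j + nat (n ∸ j)              ≡⟨ nat-+ j (n ∸ j) ⟨
  nat (j ℕ.+ (n ∸ j))              ≡⟨ cong nat (ℕ.m+[n∸m]≡n j≤n) ⟩
  nat n                            ∎
  where open ℚ.≤-Reasoning

-- The constant terms of x - j, ..., x - 1 have absolute values j, ..., 1, which j! cancels. The new
-- factor x - (j + 1) appears at the front of the product, hence the detour through `rising-shift`.
rising-diagonal : ∀ j → LogBounded j 1ℚ (𝕏.rising (node j) j)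
rising-diagonal zero zero    = ℚ.≤-refl
rising-diagonal zero (suc r) = 0≤* (0≤^^ (0≤ℓ 0) (suc r)) 0≤1
rising-diagonal (suc j) = LogBounded-resp {suc j} eq (nat*inv-1 j)
  (LogBounded-scale {suc j} {nat (suc j) * 1ℚ} j
    (LogBounded-linear {j} (0ℚ - nat (suc j)) (node (suc j) ⊕ 𝕏.ι 0ℚ) (node-linear (suc j) 0)
      (ℚ.≤-reflexive (trans (cong ∣_∣ (ℚ.+-identityˡ (- nat (suc j))))
        (trans (ℚ.∣-p∣≡∣p∣ (nat (suc j))) (ℚ.0≤p⇒∣p∣≡p (0≤nat (suc j))))))
      0≤1 (rising-diagonal j)))
  where
  nat*inv-1 : ∀ j → nat (suc j) * 1ℚ * inv j ≡ 1ℚ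
  nat*inv-1 j = trans (cong (_* inv j) (ℚ.*-identityʳ (nat (suc j)))) (nat*inv j)

  open Relation.Binary.Reasoning.Setoid 𝕏.setoid
  u = 𝕏.rising (node j) j
  t = node (suc j)

  eq : u ⊛ (t ⊕ 𝕏.ι 0ℚ) ⊛ 𝕏.ι (inv j) ≋ 𝕏.rising t (suc j)
  eq = begin
    u ⊛ (t ⊕ 𝕏.ι 0ℚ) ⊛ 𝕏.ι (inv j)
      ≈⟨ 𝕏.*-congʳ {𝕏.ι (inv j)} (𝕏.trans (𝕏.*-congˡ {u} (𝕏.trans (𝕏.+-congˡ {t} 𝕏.0-homo) (𝕏.+-identityʳ t))) (𝕏.*-comm u t)) ⟩
    t ⊛ u ⊛ 𝕏.ι (inv j)
      ≈⟨ 𝕏.*-congʳ {𝕏.ι (inv j)} (𝕏.*-congˡ {t} (𝕏.rising-cong (node-suc j) j)) ⟨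
    t ⊛ 𝕏.rising (t ⊕ const 1ℚ) j ⊛ 𝕏.ι (inv j)
      ≈⟨ 𝕏.*-congʳ {𝕏.ι (inv j)} (𝕏.rising-shift t j) ⟩
    𝕏.ι (nat (suc j)) ⊛ 𝕏.rising t (suc j) ⊛ 𝕏.ι (inv j)
      ≈⟨ (λ r → trans (⊛-const _ (inv j) r) (trans (cong (_* inv j) (X.const-⊛ (nat (suc j)) _ r))
           (trans (ℚ.*-comm _ (inv j)) (inv*nat* j _)))) ⟩
    𝕏.rising t (suc j) ∎

-- For j ≤ n one of the n + 1 factors is x, which merely shifts coefficients instead of multiplying
-- them: this is the source of 1 / N in all estimates. It enters in the base case n = j; each later
-- factor is balanced by its denominator.
rising-bound′ : ∀ {j n} → j ℕ.≤′ n → LogBounded n (inv n) (𝕏.rising (node j) (suc n))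
rising-bound′ {j} ℕ.≤′-refl = LogBounded-resp {j} (λ _ → refl) (ℚ.*-identityˡ (inv j))
  (LogBounded-scale {j} {1ℚ} j go)
  where
  u = 𝕏.rising (node j) j
  lin : node j ⊕ 𝕏.ι (nat j) ≋ const 0ℚ ⊕ X.X
  lin r = trans (node-linear j j r) (cong (λ c → const c r + X.X r) (ℚ.+-inverseʳ (nat j)))

  go : LogBounded j 1ℚ (u ⊛ (node j ⊕ 𝕏.ι (nat j)))
  go zero    = subst (λ z → ∣ z ∣ ≤ 1ℚ * 1ℚ) (sym (trans (linear₀ u 0ℚ _ lin) (ℚ.*-zeroˡ (u 0)))) 0≤1
  go (suc r) = begin
    ∣ (u ⊛ (node j ⊕ 𝕏.ι (nat j))) (suc r) ∣
      ≡⟨ cong ∣_∣ (trans (linearₛ u 0ℚ _ lin r) (trans (cong (_+ u r) (ℚ.*-zeroˡ (u (suc r)))) (ℚ.+-identityˡ (u r)))) ⟩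
    ∣ u r ∣
      ≤⟨ rising-diagonal j r ⟩
    ℓ j ^^ r * 1ℚ
      ≡⟨ cong (_* 1ℚ) (ℚ.*-identityˡ (ℓ j ^^ r)) ⟨
    1ℚ * ℓ j ^^ r * 1ℚ
      ≤⟨ ℚ.*-monoʳ-≤-nonNeg 1ℚ (ℚ.*-monoʳ-≤-nonNeg (ℓ j ^^ r) {{nonNegative (0≤^^ (0≤ℓ j) r)}} (1≤ℓ j)) ⟩
    ℓ j ^^ suc r * 1ℚ ∎
    where open ℚ.≤-Reasoning
rising-bound′ {j} (ℕ.≤′-step {n} p) = LogBounded-resp {suc n} (λ _ → refl)
  (trans (cong (_* inv (suc n)) (nat*inv n)) (ℚ.*-identityˡ (inv (suc n))))
  (LogBounded-scale {suc n} {nat (suc n) * inv n} (suc n)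
    (LogBounded-linear {n} (nat (suc n) - nat j) (node j ⊕ 𝕏.ι (nat (suc n))) (node-linear j (suc n))
      (∣nat-nat∣≤ (ℕ.m≤n⇒m≤1+n (ℕ.≤′⇒≤ p))) (0≤inv n) (rising-bound′ p)))

rising-bound : ∀ {j n} → j ℕ.≤ n → LogBounded n (inv n) (𝕏.rising (node j) (suc n))
rising-bound j≤n = rising-bound′ (ℕ.≤⇒≤′ j≤n)

-- Estimates for families of series in x

Õx : Family → (ℕ → ℕ → Series) → Set
Õx φ F = ∀ r → Õ φ (λ M j → F M j r)

Õx-resp : ∀ {φ F G} → (∀ M j → j ℕ.≤ M → F M j ≋ G M j) → Õx φ F → Õx φ G
Õx-resp p h r = Õ-resp (λ M j j≤M → p M j j≤M r) (h r)

Õx-+ : ∀ {φ F G} → Õx φ F → Õx φ G → Õx φ (λ M j → F M j ⊕ G M j)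
Õx-+ h k r = Õ-+ (h r) (k r)

Õx-neg : ∀ {φ F} → Õx φ F → Õx φ (λ M j → ⊝ F M j)
Õx-neg h r = Õ-neg (h r)

Õx-* : ∀ {φ ψ F G} → Õx φ F → Õx ψ G → Õx (λ M j → φ M j * ψ M j) (λ M j → F M j ⊛ G M j)
Õx-* {φ} {ψ} {F} {G} h k r = X.⊛-closure {ℕ × ℕ}
  (λ a → Õ φ (λ M j → a (M , j))) (λ a → Õ ψ (λ M j → a (M , j)))
  (λ a → Õ (λ M j → φ M j * ψ M j) (λ M j → a (M , j)))
  Õ-* Õ-+ (λ (M , j) → F M j) (λ (M , j) → G M j) r (λ i _ → h i) (λ i _ → k i)

Õx-one* : ∀ {φ F G} → Õx one F → Õx φ G → Õx φ (λ M j → F M j ⊛ G M j)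
Õx-one* {φ} h k r = Õ-mono (λ M j _ → ℚ.≤-reflexive (ℚ.*-identityˡ (φ M j))) (Õx-* h k r)

Õx-const : ∀ {a} → Õ one a → Õx one (λ M j → const (a M j))
Õx-const h zero    = h
Õx-const h (suc r) = Õ-0 (λ _ _ → 0≤1)

w-Õ : Õx inv₂ (λ M j → w j)
w-Õ r = 𝟏 , λ M j _ → begin
  ∣ inv j * inv j ^^ r ∣  ≡⟨ ℚ.0≤p⇒∣p∣≡p (0≤^^ (0≤inv j) (suc r)) ⟩
  inv j * inv j ^^ r      ≤⟨ *-mono (0≤inv j) 0≤1 ℚ.≤-refl (inv^^≤1 j r) ⟩
  inv j * 1ℚ              ≡⟨ ℚ.*-comm (inv j) 1ℚ ⟩
  1ℚ * inv j              ∎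
  where open ℚ.≤-Reasoning

w-Õ-one : Õx one (λ M j → w j)
w-Õ-one r = inv₂⊆one (w-Õ r)

w^ : ℕ → ℕ → Series
w^ zero    j = const 1ℚ
w^ (suc k) j = w j ⊛ w^ k j

w^-Õ-one : ∀ k → Õx one (λ M j → w^ k j)
w^-Õ-one zero    = Õx-const (𝟏 , λ _ _ _ → ℚ.≤-refl)
w^-Õ-one (suc k) = Õx-one* w-Õ-one (w^-Õ-one k)

w^-Õ : ∀ k → Õx inv₂ (λ M j → w^ (suc k) j)
w^-Õ k = Õx-resp (λ M j _ → X.⊛-comm (w^ k j) (w j)) (Õx-one* (w^-Õ-one k) w-Õ)

ρ : ℕ → ℕ → Series
ρ M j = 𝕏.rising (node j) (suc M)

LogBounded⇒≤ : ∀ {n M B f} → n ℕ.≤ suc M → 0ℚ ≤ B → LogBounded n B f →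
               ∀ r → ∣ f r ∣ ≤ ⟦ logPower r ⟧ (ℓ (suc M)) * B
LogBounded⇒≤ {n} {M} {B} n≤ 0≤B h r = ℚ.≤-trans (h r) (ℚ.*-monoʳ-≤-nonNeg B {{nonNegative 0≤B}}
  (ℚ.≤-trans (^^-mono (0≤ℓ n) (ℓ-mono n≤) r) (ℚ.≤-reflexive (sym (⟦logPower⟧ r (ℓ (suc M)))))))

ρ-Õ : Õx inv₁ ρ
ρ-Õ r = logPower r , λ M j j≤M → LogBounded⇒≤ (ℕ.n≤1+n M) (0≤inv M) (rising-bound j≤M) r

-- Newton series of harmonic sums, letter by letter

partial : Index → ℕ → ℕ → Series
partial l M j = 𝕏.newton (λ n → ζ⋆[ suc n ] l) (node (suc j)) (suc M)


ρ-node : ∀ M j → 𝕏.rising (node (suc j) ⊕ const 1ℚ) (suc M) ≋ ρ M j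
ρ-node M j = 𝕏.rising-cong (node-suc j) (suc M)

-- Abel summation replaces c by its scaled differences d at the price of one factor `w j`: this
-- strips a letter from the index. As c 0 = 0, only the boundary term with `ρ` remains.
newton-word : ∀ (c : ℕ → ℚ) (d : ℕ → ℚ) → c 0 ≡ 0ℚ → (∀ n → nat (suc n) * (c (suc n) - c n) ≡ d n) → ∀ M j →
  𝕏.newton (λ n → c (suc n)) (node (suc j)) (suc M) ≋
  w j ⊛ 𝕏.newton d (node (suc j)) (suc M) ⊕ ρ M j ⊛ const (c (suc M))
newton-word c d c₀ p M j = begin
  𝕏.newton (λ n → c (suc n)) t (suc M)
    ≈⟨ 𝕏.newton-summation c t (w j) (suc M) (w-inverse j) ⟩
  w j ⊛ 𝕏.newton (λ n → nat (suc n) * (c (suc n) - c n)) t (suc M) ⊕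
    (𝕏.rising (t ⊕ const 1ℚ) (suc M) ⊛ const (c (suc M)) 𝕏.- const (c 0))
    ≈⟨ 𝕏.+-cong (𝕏.*-congˡ {w j} (𝕏.newton-cong t (suc M) p))
         (𝕏.trans (𝕏.+-cong (𝕏.*-congʳ {const (c (suc M))} (ρ-node M j))
           (𝕏.trans (𝕏.-‿cong {const (c 0)} {const 0ℚ} (λ r → cong (λ z → const z r) c₀)) (λ { zero → refl ; (suc r) → refl })))
           (𝕏.+-identityʳ _)) ⟩
  w j ⊛ 𝕏.newton d t (suc M) ⊕ ρ M j ⊛ const (c (suc M)) ∎
  where
  open Relation.Binary.Reasoning.Setoid 𝕏.setoid
  t = node (suc j)

partial-1 : ∀ l M j → partial (1 ∷ l) M j ≋ w j ⊛ partial l M j ⊕ ρ M j ⊛ const (ζ⋆[ suc M ] (1 ∷ l))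
partial-1 l = newton-word (λ n → ζ⋆[ n ] (1 ∷ l)) (λ n → ζ⋆[ suc n ] l) refl λ n →
  trans (cong (nat (suc n) *_) (trans
    (solve 2 (λ a b → a :+ b :- a := b) refl (ζ⋆[ n ] (1 ∷ l)) (1/ suc n ^ 1 * ζ⋆[ suc n ] l))
    (cong (_* ζ⋆[ suc n ] l) (trans (1/^≡inv^^ n 1) (ℚ.*-identityʳ (inv n))))))
  (nat*inv* n (ζ⋆[ suc n ] l))

partial-2 : ∀ l M j → partial (2 ∷ l) M j ≋
  w j ⊛ 𝕏.newton (λ n → inv n * ζ⋆[ suc n ] l) (node (suc j)) (suc M) ⊕ ρ M j ⊛ const (ζ⋆[ suc M ] (2 ∷ l))
partial-2 l = newton-word (λ n → ζ⋆[ n ] (2 ∷ l)) (λ n → inv n * ζ⋆[ suc n ] l) refl λ n →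
  trans (cong (nat (suc n) *_) (trans
    (solve 2 (λ a b → a :+ b :- a := b) refl (ζ⋆[ n ] (2 ∷ l)) (1/ suc n ^ 2 * ζ⋆[ suc n ] l))
    (trans (cong (_* ζ⋆[ suc n ] l) (trans (1/^≡inv^^ n 2) (cong (inv n *_) (ℚ.*-identityʳ (inv n)))))
           (ℚ.*-assoc (inv n) (inv n) (ζ⋆[ suc n ] l)))))
  (nat*inv* n (inv n * ζ⋆[ suc n ] l))

newton-0 : ∀ t N → 𝕏.newton (λ _ → 0ℚ) t N ≋ const 0ℚ
newton-0 t zero    = 𝕏.refl
newton-0 t (suc N) = 𝕏.trans (𝕏.+-cong (newton-0 t N)
  (𝕏.trans (𝕏.*-congˡ {𝕏.rising t (suc N)} 𝕏.0-homo) (𝕏.zeroʳ (𝕏.rising t (suc N))))) (𝕏.+-identityˡ (const 0ℚ))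

-- The coefficients are constant, so the summed differences vanish and only the boundary terms
-- survive. Up to the small `ρ` this is - 1, the constant term of `newtonSeries`.
partial-[] : ∀ M j → partial [] M j ≋ ρ M j 𝕏.- const 1ℚ
partial-[] M j = begin
  partial [] M j
    ≈⟨ 𝕏.newton-summation (λ _ → 1ℚ) t (w j) (suc M) (w-inverse j) ⟩
  w j ⊛ 𝕏.newton (λ n → nat (suc n) * (1ℚ - 1ℚ)) t (suc M) ⊕
    (𝕏.rising (t ⊕ const 1ℚ) (suc M) ⊛ const 1ℚ 𝕏.- const 1ℚ)
    ≈⟨ 𝕏.+-cong
         (𝕏.trans (𝕏.*-congˡ {w j} (𝕏.trans (𝕏.newton-cong t (suc M) (λ n → ℚ.*-zeroʳ (nat (suc n)))) (newton-0 t (suc M)))) (𝕏.zeroʳ (w j)))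
         (𝕏.+-congʳ {𝕏.- const 1ℚ} (𝕏.trans (𝕏.*-identityʳ (𝕏.rising (t ⊕ const 1ℚ) (suc M))) (ρ-node M j))) ⟩
  const 0ℚ ⊕ (ρ M j 𝕏.- const 1ℚ)
    ≈⟨ 𝕏.+-identityˡ _ ⟩
  ρ M j 𝕏.- const 1ℚ ∎
  where
  open Relation.Binary.Reasoning.Setoid 𝕏.setoid
  t = node (suc j)

ζ⋆-Õx : ∀ {l} → PositiveIndex l → Õx one (λ M j → const (ζ⋆[ suc M ] l))
ζ⋆-Õx p = Õx-const (proj₁ (ζ⋆-bound p) , λ M j _ → proj₂ (ζ⋆-bound p) M (suc M) ℕ.≤-refl)

partial-ones : ∀ k {l} → PositiveIndex l →
  Õx inv₁ (λ M j → partial (ones k ++ l) M j 𝕏.- w^ k j ⊛ partial l M j)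
partial-ones zero    {l} p = Õx-resp
  (λ M j _ → 𝕏.sym (𝕏.trans (𝕏.+-congˡ {partial l M j} (𝕏.-‿cong (𝕏.*-identityˡ (partial l M j)))) (𝕏.-‿inverseʳ (partial l M j))))
  (λ { zero → Õ-0 (λ M _ → 0≤inv M) ; (suc r) → Õ-0 (λ M _ → 0≤inv M) })
partial-ones (suc k) {l} p = Õx-resp
  (λ M j _ → 𝕏.trans
    (solveₓ 5 (λ w s v z e → w :*ₓ (s :-ₓ v :*ₓ z) :+ₓ e :=ₓ w :*ₓ s :+ₓ e :-ₓ w :*ₓ v :*ₓ z) 𝕏.refl
      (w j) (partial (ones k ++ l) M j) (w^ k j) (partial l M j) _)
    (𝕏.+-congʳ (𝕏.sym (partial-1 (ones k ++ l) M j))))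
  (Õx-+ (Õx-one* w-Õ-one (partial-ones k p))
        (Õx-resp (λ M j _ → X.⊛-comm (const (ζ⋆[ suc M ] (1 ∷ ones k ++ l))) (ρ M j)) (Õx-one* (ζ⋆-Õx (ones-positive (suc k) p)) ρ-Õ)))

-- The coefficient of y^p in a generating series; the constant term -1 makes the recurrence uniform in p.
newtonSeries : ℕ → ℕ → Series → ℕ → Series
newtonSeries m N t zero    = ⊝ const 1ℚ
newtonSeries m N t (suc p) = 𝕏.newton (dual (level m p)) t N

factor : ℕ → ℕ → Series
factor m j = w^ (2 ℕ.+ m) j

remainder : ℕ → ℕ → ℕ → ℕ → Series
remainder m M j zero    = const 0ℚ
remainder m M j (suc p) =
  newtonSeries m (suc M) (node j) (suc p) 𝕏.- newtonSeries m (suc M) (node (suc j)) (suc p)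
  ⊕ factor m j ⊛ newtonSeries m (suc M) (node (suc j)) p

newton-node : ∀ a j N → 𝕏.newton a (node j) N ≋ 𝕏.newton a (node (suc j) ⊕ const 1ℚ) N
newton-node a j N = 𝕏.Σ<-cong N (λ n → 𝕏.*-congʳ {const (a n)} (𝕏.sym (𝕏.rising-cong (node-suc j) (suc n))))

-- The factor n + 1 from the shift cancels the n⁻¹ of the dual coefficients and leaves the bare
-- harmonic sums of the block.
newtonSeries-shift : ∀ m M j p →
  newtonSeries m (suc M) (node j) (suc p) ≋
  newtonSeries m (suc M) (node (suc j)) (suc p) 𝕏.- w j ⊛ partial (block m p) M j
newtonSeries-shift m M j p = begin
  𝕏.newton a (node j) (suc M)
    ≈⟨ newton-node a j (suc M) ⟩
  𝕏.newton a (t ⊕ const 1ℚ) (suc M)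
    ≈⟨ 𝕏.newton-shift a t (w j) (suc M) (w-inverse j) ⟩
  𝕏.newton a t (suc M) 𝕏.- w j ⊛ 𝕏.newton (λ n → nat (suc n) * a n) t (suc M)
    ≈⟨ 𝕏.+-congˡ {𝕏.newton a t (suc M)} (𝕏.-‿cong (𝕏.*-congˡ {w j} (𝕏.newton-cong t (suc M) λ n →
         trans (cong (nat (suc n) *_) (level-dual m p n)) (nat*inv* n (ζ⋆[ suc n ] (block m p)))))) ⟩
  𝕏.newton a t (suc M) 𝕏.- w j ⊛ partial (block m p) M j ∎
  where
  open Relation.Binary.Reasoning.Setoid 𝕏.setoid
  t = node (suc j)
  a = dual (level m p)

-- The w of `newtonSeries-shift` supplies 1 / (j + 1), and the boundary terms collected in `main`
-- supply 1 / N. Between the constant terms in y the recurrence is exact.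
remainder-Õ : ∀ m p → Õx inv₁₂ (λ M j → remainder m M j p)
remainder-Õ m zero    zero    = Õ-0 (λ M j → 0≤* (0≤inv M) (0≤inv j))
remainder-Õ m zero    (suc r) = Õ-0 (λ M j → 0≤* (0≤inv M) (0≤inv j))
remainder-Õ m (suc p) = Õx-resp
  (λ M j _ → 𝕏.sym (𝕏.trans (𝕏.+-congʳ (𝕏.+-congʳ {𝕏.- K M j} (newtonSeries-shift m M j p)))
    (solveₓ 5 (λ k w s v z → k :-ₓ w :*ₓ s :-ₓ k :+ₓ w :*ₓ v :*ₓ z :=ₓ :-ₓ ((s :-ₓ v :*ₓ z) :*ₓ w)) 𝕏.refl
      (K M j) (w j) (partial (block m p) M j) (w^ (suc m) j) (newtonSeries m (suc M) (node (suc j)) p))))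
  (Õx-neg (Õx-* (main p) w-Õ))
  where
  K : ℕ → ℕ → Series
  K M j = newtonSeries m (suc M) (node (suc j)) (suc p)

  -- Stripping the leading ones, and the first 2 if there is one, yields m + 1 factors w; with the
  -- one from the shift they make up `factor`.
  main : ∀ p → Õx inv₁ (λ M j → partial (block m p) M j 𝕏.- w^ (suc m) j ⊛ newtonSeries m (suc M) (node (suc j)) p)
  main zero = Õx-resp
    (λ M j _ → 𝕏.trans (solveₓ 5 (λ s v z e o → (s :-ₓ v :*ₓ z) :+ₓ v :*ₓ e :=ₓ s :+ₓ v :*ₓ (e :-ₓ z)) 𝕏.refl
        (partial (block m 0) M j) (w^ (suc m) j) (partial [] M j) (ρ M j) (const 1ℚ))
      (𝕏.+-congˡ {partial (block m 0) M j} (𝕏.trans (𝕏.*-congˡ {w^ (suc m) j}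
        (𝕏.trans (𝕏.+-congˡ {ρ M j} (𝕏.-‿cong (partial-[] M j)))
          (solveₓ 2 (λ e o → e :-ₓ (e :-ₓ o) :=ₓ :-ₓ (:-ₓ o)) 𝕏.refl (ρ M j) (const 1ℚ))))
        (solveₓ 2 (λ v z → v :*ₓ (:-ₓ z) :=ₓ :-ₓ (v :*ₓ z)) 𝕏.refl (w^ (suc m) j) (⊝ const 1ℚ)))))
    (Õx-+ (subst (λ l → Õx inv₁ (λ M j → partial l M j 𝕏.- w^ (suc m) j ⊛ partial [] M j))
            (List.++-identityʳ (ones (suc m))) (partial-ones (suc m) []))
          (Õx-one* (w^-Õ-one (suc m)) ρ-Õ))
  main (suc p) = Õx-resp
    (λ M j _ → 𝕏.trans
      (𝕏.+-congʳ {w^ m j ⊛ (ρ M j ⊛ const (ζ⋆[ suc M ] (2 ∷ block m p)))}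
        (𝕏.+-congˡ {partial (ones m ++ 2 ∷ block m p) M j} (𝕏.-‿cong (𝕏.*-congˡ {w^ m j} (twos M j)))))
      (𝕏.trans (solveₓ 5 (λ s v w k e → (s :-ₓ v :*ₓ (w :*ₓ k :+ₓ e)) :+ₓ v :*ₓ e :=ₓ s :-ₓ w :*ₓ v :*ₓ k) 𝕏.refl
        (partial (ones m ++ 2 ∷ block m p) M j) (w^ m j) (w j) (newtonSeries m (suc M) (node (suc j)) (suc p))
        (ρ M j ⊛ const (ζ⋆[ suc M ] (2 ∷ block m p))))
        (𝕏.+-congʳ (𝕏.reflexive (cong (λ l → partial l M j) (sym (block-suc m p)))))))
    (Õx-+ (partial-ones m indexPositive)
          (Õx-one* (w^-Õ-one m) (Õx-resp (λ M j _ → X.⊛-comm (const (ζ⋆[ suc M ] (2 ∷ block m p))) (ρ M j))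
                                         (Õx-one* (ζ⋆-Õx indexPositive) ρ-Õ))))
    where
    indexPositive : PositiveIndex (2 ∷ block m p)
    indexPositive = _ ∷ block-positive m p

    -- Only one w is taken from the letter 2: what remains, n⁻¹ ζ⋆_n of the shorter block, is the
    -- dual of the previous level, hence a Newton series again.
    twos : ∀ M j → partial (2 ∷ block m p) M j ≋
           w j ⊛ newtonSeries m (suc M) (node (suc j)) (suc p) ⊕ ρ M j ⊛ const (ζ⋆[ suc M ] (2 ∷ block m p))
    twos M j = 𝕏.trans (partial-2 (block m p) M j)
      (𝕏.+-congʳ (𝕏.*-congˡ {w j} (𝕏.newton-cong (node (suc j)) (suc M) (λ n → sym (level-dual m p n)))))

-- The Newton series at the last node x - N

module _ (s : ℕ → ℚ) where

  -- At x = 0 this is exactly - (s k + ⋯ + s (k + n - 1)). For formal x, each node dropped leaves a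
  -- `correction`, which is divisible by x because its rising factorial runs from x - n up to x.
  shifted : ℕ → ℕ → Series
  shifted n k = 𝕏.newton (λ i → table s i k) (node n) n

  correction : ℕ → ℕ → Series
  correction n k = 𝕏.rising (node n) (suc n) ⊛ const (table s n k)

  shifted-suc : ∀ n k → shifted (suc n) k ≋ shifted n (suc k) 𝕏.- const (s k) ⊕ correction n k
  shifted-suc n k = 𝕏.trans (𝕏.newton-recentre s k (node (suc n)) n)
    (𝕏.+-cong (𝕏.+-congʳ {𝕏.- const (s k)} (𝕏.sym (newton-node (λ i → table s i (suc k)) n n)))
              (𝕏.*-congʳ {const (table s n k)} (𝕏.rising-cong (node-suc n) (suc n))))

  shifted-sum : ∀ M k → k ℕ.≤ suc M →
    shifted (suc M) 0 ≋ shifted (suc M ∸ k) k 𝕏.- const (Σ< k s) ⊕ 𝕏.Σ< k (λ i → correction (M ∸ i) i)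
  shifted-sum M zero    _ = 𝕏.sym (𝕏.trans (𝕏.+-identityʳ _)
    (𝕏.trans (𝕏.+-congˡ {shifted (suc M) 0} (λ { zero → refl ; (suc r) → refl })) (𝕏.+-identityʳ _)))
  shifted-sum M (suc k) (ℕ.s≤s k≤M) = begin
    shifted (suc M) 0
      ≈⟨ shifted-sum M k (ℕ.m≤n⇒m≤1+n k≤M) ⟩
    shifted (suc M ∸ k) k 𝕏.- const (Σ< k s) ⊕ S
      ≈⟨ 𝕏.+-congʳ {S} (𝕏.+-congʳ {𝕏.- const (Σ< k s)} (𝕏.trans
           (𝕏.reflexive (cong (λ n → shifted n k) (ℕ.+-∸-assoc 1 k≤M))) (shifted-suc (M ∸ k) k))) ⟩
    shifted (M ∸ k) (suc k) 𝕏.- const (s k) ⊕ correction (M ∸ k) k 𝕏.- const (Σ< k s) ⊕ S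
      ≈⟨ solveₓ 5 (λ a b c d e → a :-ₓ b :+ₓ c :-ₓ d :+ₓ e :=ₓ a :-ₓ (d :+ₓ b) :+ₓ (e :+ₓ c)) 𝕏.refl
           (shifted (M ∸ k) (suc k)) (const (s k)) (correction (M ∸ k) k) (const (Σ< k s)) S ⟩
    shifted (M ∸ k) (suc k) 𝕏.- (const (Σ< k s) ⊕ const (s k)) ⊕ (S ⊕ correction (M ∸ k) k)
      ≈⟨ 𝕏.+-congʳ {S ⊕ correction (M ∸ k) k} (𝕏.+-congˡ {shifted (M ∸ k) (suc k)} (𝕏.-‿cong (𝕏.sym (𝕏.+-homo (Σ< k s) (s k))))) ⟩
    shifted (M ∸ k) (suc k) 𝕏.- const (Σ< (suc k) s) ⊕ (S ⊕ correction (M ∸ k) k) ∎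
    where
    open Relation.Binary.Reasoning.Setoid 𝕏.setoid
    S = 𝕏.Σ< k (λ i → correction (M ∸ i) i)

defect : ℕ → ℕ → ℕ → Series
defect m M zero    = const 0ℚ
defect m M (suc p) = 𝕏.Σ< (suc M) (λ i → correction (level m p) (M ∸ i) i)

newtonSeries-end : ∀ m M p →
  newtonSeries m (suc M) (node (suc M)) p ≋ ⊝ const (levelSum m p (suc M)) ⊕ defect m M p
newtonSeries-end m M zero    = 𝕏.sym (𝕏.+-identityʳ _)
newtonSeries-end m M (suc p) = 𝕏.trans (shifted-sum s M (suc M) ℕ.≤-refl)
  (𝕏.+-congʳ {defect m M (suc p)} (𝕏.trans
    (𝕏.+-congʳ {𝕏.- const (Σ< (suc M) s)} (𝕏.reflexive (cong (λ n → shifted s n (suc M)) (ℕ.n∸n≡0 (suc M)))))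
    (𝕏.+-identityˡ _)))
  where s = level m p

-- The rising factorial is of size 1 / (M - k + 1). Complete monotonicity bounds the difference of
-- order M - k by the level itself, of size 1 / (k + 1)², where the triangle inequality would cost
-- 2^(M - k). One factor 1 / (k + 1) merges with 1 / (M - k + 1) into 1 / (M + 1); the other makes
-- the sum over k logarithmic.
correction-Õ : ∀ m p → Õx inv₁₂ (λ M k → correction (level m p) (M ∸ k) k)
correction-Õ m p r = Õ-resp (λ M k _ → sym (⊛-const (𝕏.rising (node (M ∸ k)) (suc (M ∸ k))) (table (level m p) (M ∸ k) k) r))
  (Õ-mono bound (Õ-* {φ = λ M k → inv (M ∸ k)} rise tab))
  where
  bound : ∀ M k → k ℕ.≤ M → inv (M ∸ k) * (inv k * inv k) ≤ inv M * inv k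
  bound M k k≤M = begin
    inv (M ∸ k) * (inv k * inv k)   ≡⟨ ℚ.*-assoc (inv (M ∸ k)) (inv k) (inv k) ⟨
    inv (M ∸ k) * inv k * inv k     ≤⟨ ℚ.*-monoʳ-≤-nonNeg (inv k) {{nonNegative (0≤inv k)}} (product-≤ (M ∸ k) k) ⟩
    inv (M ∸ k ℕ.+ k) * inv k       ≡⟨ cong (λ n → inv n * inv k) (ℕ.m∸n+n≡m k≤M) ⟩
    inv M * inv k                   ∎
    where open ℚ.≤-Reasoning

  rise : Õ (λ M k → inv (M ∸ k)) (λ M k → 𝕏.rising (node (M ∸ k)) (suc (M ∸ k)) r)
  rise = logPower r , λ M k _ → LogBounded⇒≤ (ℕ.m≤n⇒m≤1+n (ℕ.m∸n≤m M k)) (0≤inv (M ∸ k)) (rising-bound (ℕ.≤-refl {M ∸ k})) r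

  tab : Õ (λ M k → inv k * inv k) (λ M k → table (level m p) (M ∸ k) k)
  tab = proj₁ (level-Õ m p) , λ M k k≤M → begin
    ∣ table (level m p) (M ∸ k) k ∣  ≡⟨ ℚ.0≤p⇒∣p∣≡p (level-CM m p (M ∸ k) k) ⟩
    table (level m p) (M ∸ k) k      ≤⟨ table-≤ (level m p) (level-CM m p) (M ∸ k) k ⟩
    level m p k                      ≡⟨ ℚ.0≤p⇒∣p∣≡p (level-CM m p 0 k) ⟨
    ∣ level m p k ∣                  ≤⟨ proj₂ (level-Õ m p) M k k≤M ⟩
    _                                ∎
    where open ℚ.≤-Reasoning

Σ<-Õx-total : ∀ {F} → Õx inv₁₂ F → Õx inv₁ (λ M _ → 𝕏.Σ< (suc M) (F M))
Σ<-Õx-total {F} h r = Õ-resp (λ M _ _ → sym (Σ<-coeff (suc M) (F M) r)) (Σ<-total (h r))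

Σ<-Õx : ∀ {F} → Õx inv₂ F → Õx one (λ M j → 𝕏.Σ< j (F M))
Σ<-Õx {F} h r = Õ-resp (λ M j _ → sym (Σ<-coeff j (F M) r)) (Σ<-Õ (h r))

defect-Õ : ∀ m p → Õx inv₁ (λ M _ → defect m M p)
defect-Õ m zero    zero    = Õ-0 (λ M _ → 0≤inv M)
defect-Õ m zero    (suc r) = Õ-0 (λ M _ → 0≤inv M)
defect-Õ m (suc p) = Σ<-Õx-total (correction-Õ m p)

-- Generating series in y over ℚ⟦x⟧

module Y = PowerSeries 𝕏

𝕐 : ℚ-Algebra
𝕐 = Y.powerSeries

module 𝕐 where
  open ℚ-Algebra 𝕐 public
  open Rising 𝕐 public

open 𝕐.Solver using () renaming
  (solve to solveᵧ; _:=_ to _:=ᵧ_; _:+_ to _:+ᵧ_; _:*_ to _:*ᵧ_; _:-_ to _:-ᵧ_; :-_ to :-ᵧ_)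

Õy : Family → (ℕ → ℕ → Y.Series) → Set
Õy φ F = ∀ p → Õx φ (λ M j → F M j p)

Õy-+ : ∀ {φ F G} → Õy φ F → Õy φ G → Õy φ (λ M j → F M j Y.⊕ G M j)
Õy-+ h k p = Õx-+ (h p) (k p)

Õy-resp : ∀ {φ F G} → (∀ M j → j ℕ.≤ M → F M j Y.≋ G M j) → Õy φ F → Õy φ G
Õy-resp e h p = Õx-resp (λ M j j≤M → e M j j≤M p) (h p)

Õy-one* : ∀ {φ F G} → Õy one F → Õy φ G → Õy φ (λ M j → F M j Y.⊛ G M j)
Õy-one* {φ} {F} {G} h k p = Y.⊛-closure {ℕ × ℕ}
  (λ a → Õx one (λ M j → a (M , j))) (λ a → Õx φ (λ M j → a (M , j))) (λ a → Õx φ (λ M j → a (M , j)))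
  Õx-one* Õx-+ (λ (M , j) → F M j) (λ (M , j) → G M j) p (λ i _ → h i) (λ i _ → k i)

Σ<-coeffᵧ : ∀ N F p → 𝕐.Σ< N F p 𝕏.≈ 𝕏.Σ< N (λ n → F n p)
Σ<-coeffᵧ zero    F p = Y.const-0 p
Σ<-coeffᵧ (suc N) F p = 𝕏.+-congʳ {F N p} (Σ<-coeffᵧ N F p)

1-_y : Series → Y.Series
1- c y = Y.const (const 1ℚ) 𝕐.- Y.X Y.⊛ Y.const c

delay : Series → Y.Series → Y.Series
delay c f zero    = const 0ℚ
delay c f (suc p) = c ⊛ f p

1-y-⊛ : ∀ c f → (1- c y) Y.⊛ f Y.≋ f 𝕐.- delay c f
1-y-⊛ c f = 𝕐.trans
  (𝕐.trans (solveᵧ 4 (λ o x c f → (o :-ᵧ x :*ᵧ c) :*ᵧ f :=ᵧ o :*ᵧ f :-ᵧ x :*ᵧ (c :*ᵧ f)) 𝕐.refl (Y.const (const 1ℚ)) Y.X (Y.const c) f)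
    (𝕐.+-congʳ {𝕐.- (Y.X Y.⊛ (Y.const c Y.⊛ f))} (𝕐.*-identityˡ f)))
  (𝕐.+-congˡ {f} (𝕐.-‿cong shift))
  where
  shift : Y.X Y.⊛ (Y.const c Y.⊛ f) Y.≋ delay c f
  shift zero    = 𝕏.zeroˡ (c ⊛ f 0)
  shift (suc p) = 𝕏.trans (Y.X-⊛ (Y.const c Y.⊛ f) p) (Y.const-⊛ c f p)

1-y-⊛₀ : ∀ c f → ((1- c y) Y.⊛ f) 0 𝕏.≈ f 0
1-y-⊛₀ c f = 𝕏.trans (1-y-⊛ c f 0) (λ { zero → ℚ.+-identityʳ (f 0 0) ; (suc r) → ℚ.+-identityʳ (f 0 (suc r)) })

module Product (m : ℕ) where

  𝕄 : ℕ → Series → Y.Series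
  𝕄 N t p = newtonSeries m N t p

  err : ℕ → ℕ → Y.Series
  err M j p = remainder m M j p

  U : ℕ → Y.Series
  U zero    = Y.const (const 1ℚ)
  U (suc j) = (1- factor m j y) Y.⊛ U j

  -- By `H-step` this is the product of (1 - y / k^(m + 2))⁻¹ over k ≤ N, so `V` below is a quotient
  -- of two finite products.
  H : ℕ → Y.Series
  H N p = const (levelSum m p N)

  V : ℕ → Y.Series
  V N = U N Y.⊛ H N

  𝕄-step : ∀ M j → 𝕄 (suc M) (node j) Y.≋ (1- factor m j y) Y.⊛ 𝕄 (suc M) (node (suc j)) Y.⊕ err M j
  𝕄-step M j zero    = 𝕏.sym (𝕏.trans (𝕏.+-identityʳ _) (1-y-⊛₀ (factor m j) (𝕄 (suc M) (node (suc j)))))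
  𝕄-step M j (suc p) = 𝕏.sym (𝕏.trans (𝕏.+-congʳ {err M j (suc p)} (1-y-⊛ (factor m j) (𝕄 (suc M) (node (suc j))) (suc p)))
    (solveₓ 3 (λ a b z → a :-ₓ z :+ₓ (b :-ₓ a :+ₓ z) :=ₓ b) 𝕏.refl
      (𝕄 (suc M) (node (suc j)) (suc p)) (𝕄 (suc M) (node j) (suc p)) _))

  𝕄-product : ∀ M j → 𝕄 (suc M) (node 0) Y.≋ U j Y.⊛ 𝕄 (suc M) (node j) Y.⊕ 𝕐.Σ< j (λ k → U k Y.⊛ err M k)
  𝕄-product M zero    = 𝕐.sym (𝕐.trans (𝕐.+-identityʳ _) (𝕐.*-identityˡ _))
  𝕄-product M (suc j) = begin
    𝕄 (suc M) (node 0)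
      ≈⟨ 𝕄-product M j ⟩
    U j Y.⊛ 𝕄 (suc M) (node j) Y.⊕ S
      ≈⟨ 𝕐.+-congʳ {S} (𝕐.*-congˡ {U j} (𝕄-step M j)) ⟩
    U j Y.⊛ ((1- factor m j y) Y.⊛ K Y.⊕ err M j) Y.⊕ S
      ≈⟨ solveᵧ 5 (λ u f k e s → u :*ᵧ (f :*ᵧ k :+ᵧ e) :+ᵧ s :=ᵧ f :*ᵧ u :*ᵧ k :+ᵧ (s :+ᵧ u :*ᵧ e)) 𝕐.refl
           (U j) (1- factor m j y) K (err M j) S ⟩
    U (suc j) Y.⊛ K Y.⊕ (S Y.⊕ U j Y.⊛ err M j) ∎
    where
    open Relation.Binary.Reasoning.Setoid 𝕐.setoid
    K = 𝕄 (suc M) (node (suc j))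
    S = 𝕐.Σ< j (λ k → U k Y.⊛ err M k)

  U₀ : ∀ j → U j 0 𝕏.≈ const 1ℚ
  U₀ zero    = 𝕏.refl
  U₀ (suc j) = 𝕏.trans (1-y-⊛₀ (factor m j) (U j)) (U₀ j)

  -- Each factor changes the product by - y · `factor m k` · `U k`; summing these changes expresses
  -- the coefficient of y^(p + 1) through those of y^p. The bound on `U` can then go by induction on
  -- p, with an implied bound uniform in j.
  Uₛ : ∀ j p → U j (suc p) 𝕏.≈ ⊝ 𝕏.Σ< j (λ k → factor m k ⊛ U k p)
  Uₛ zero    p = λ { zero → refl ; (suc r) → refl }
  Uₛ (suc j) p = 𝕏.trans (1-y-⊛ (factor m j) (U j) (suc p))
    (𝕏.trans (𝕏.+-congʳ {⊝ (factor m j ⊛ U j p)} (Uₛ j p))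
      (solveₓ 2 (λ a b → :-ₓ a :-ₓ b :=ₓ :-ₓ (a :+ₓ b)) 𝕏.refl (𝕏.Σ< j (λ k → factor m k ⊛ U k p)) (factor m j ⊛ U j p)))

  U-Õ : Õy one (λ M j → U j)
  U-Õ zero    = Õx-resp (λ M j _ → 𝕏.sym (U₀ j)) (Õx-const (𝟏 , λ _ _ _ → ℚ.≤-refl))
  U-Õ (suc p) = Õx-resp (λ M j _ → 𝕏.sym (Uₛ j p)) (Õx-neg (Σ<-Õx
    (Õx-resp (λ M j _ → X.⊛-comm (U j p) (factor m j)) (Õx-one* (U-Õ p) (w^-Õ (suc m))))))

  diagonal : ∀ (F : ℕ → Series) → Õx one (λ M j → F j) → Õx one (λ M _ → F M)
  diagonal F h r = proj₁ (h r) , λ M _ _ → proj₂ (h r) M M ℕ.≤-refl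

  -- `Õ` covers only j ≤ M, so the last factor of `U (suc M)` is split off.
  U-end-Õ : Õy one (λ M _ → U (suc M))
  U-end-Õ zero    = Õx-resp (λ M _ _ → 𝕏.sym (U₀ (suc M))) (Õx-const (𝟏 , λ _ _ _ → ℚ.≤-refl))
  U-end-Õ (suc p) = Õx-resp (λ M _ _ → 𝕏.sym (1-y-⊛ (factor m M) (U M) (suc p)))
    (Õx-+ (diagonal (λ j → U j (suc p)) (U-Õ (suc p)))
      (Õx-neg (Õx-one* (diagonal (factor m) (w^-Õ-one (2 ℕ.+ m))) (diagonal (λ j → U j p) (U-Õ p)))))

  -- After V cancels, two errors remain: the defect at the last node times `U`, which is bounded up
  -- to logarithms, and the remainders, whose weights 1 / (j + 1) sum to a logarithm.
  asymptotics : Õy inv₁ (λ M _ → 𝕄 (suc M) (node 0) Y.⊕ V (suc M))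
  asymptotics = Õy-resp (λ M _ _ → 𝕐.sym (𝕐.trans
      (𝕐.+-congʳ {V (suc M)} (𝕐.trans (𝕄-product M (suc M))
        (𝕐.+-congʳ {S M} (𝕐.*-congˡ {U (suc M)} (newtonSeries-end m M)))))
      (solveᵧ 4 (λ u h d s → u :*ᵧ (:-ᵧ h :+ᵧ d) :+ᵧ s :+ᵧ u :*ᵧ h :=ᵧ u :*ᵧ d :+ᵧ s) 𝕐.refl
        (U (suc M)) (H (suc M)) (defect m M) (S M))))
    (Õy-+ (Õy-one* U-end-Õ (defect-Õ m))
          (λ p → Õx-resp (λ M _ _ → 𝕏.sym (Σ<-coeffᵧ (suc M) (λ k → U k Y.⊛ err M k) p))
            (Σ<-Õx-total {λ M k → (U k Y.⊛ err M k) p} (Õy-one* {F = λ M j → U j} {G = err} U-Õ (remainder-Õ m) p))))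
    where
    S : ℕ → Y.Series
    S M = 𝕐.Σ< (suc M) (λ k → U k Y.⊛ err M k)

-- y d/dy
θ : Y.Series → Y.Series
θ f p = 𝕏.ι (nat p) ⊛ f p

θ-cong : ∀ {f g} → f Y.≋ g → θ f Y.≋ θ g
θ-cong e p = 𝕏.*-congˡ {𝕏.ι (nat p)} (e p)

θ-tail : ∀ f → Y.tail (θ f) Y.≋ θ (Y.tail f) Y.⊕ Y.tail f
θ-tail f p = begin
  𝕏.ι (nat (suc p)) ⊛ f (suc p)             ≈⟨ 𝕏.*-congʳ {f (suc p)} (𝕏.ι-suc p) ⟩
  (const 1ℚ ⊕ 𝕏.ι (nat p)) ⊛ f (suc p)      ≈⟨ 𝕏.distribʳ (f (suc p)) (const 1ℚ) (𝕏.ι (nat p)) ⟩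
  const 1ℚ ⊛ f (suc p) ⊕ 𝕏.ι (nat p) ⊛ f (suc p)  ≈⟨ 𝕏.+-comm (const 1ℚ ⊛ f (suc p)) (𝕏.ι (nat p) ⊛ f (suc p)) ⟩
  𝕏.ι (nat p) ⊛ f (suc p) ⊕ const 1ℚ ⊛ f (suc p)  ≈⟨ 𝕏.+-congˡ {𝕏.ι (nat p) ⊛ f (suc p)} (𝕏.*-identityˡ (f (suc p))) ⟩
  𝕏.ι (nat p) ⊛ f (suc p) ⊕ f (suc p)       ∎
  where open Relation.Binary.Reasoning.Setoid 𝕏.setoid

leibniz : ∀ f g → θ (f Y.⊛ g) Y.≋ θ f Y.⊛ g Y.⊕ f Y.⊛ θ g
leibniz f g zero    = begin
  const 0ℚ ⊛ (f 0 ⊛ g 0)                         ≈⟨ z (f 0 ⊛ g 0) ⟩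
  const 0ℚ                                       ≈⟨ 𝕏.+-identityˡ (const 0ℚ) ⟨
  const 0ℚ ⊕ const 0ℚ
    ≈⟨ 𝕏.+-cong (𝕏.trans (𝕏.*-congʳ {g 0} (z (f 0))) (z (g 0)))
                (𝕏.trans (𝕏.*-congˡ {f 0} (z (g 0))) (𝕏.zeroʳ (f 0))) ⟨
  const 0ℚ ⊛ f 0 ⊛ g 0 ⊕ f 0 ⊛ (const 0ℚ ⊛ g 0)  ∎
  where
  open Relation.Binary.Reasoning.Setoid 𝕏.setoid
  z = 𝕏.zeroˡ
leibniz f g (suc p) = begin
  𝕏.ι (nat (suc p)) ⊛ (f 0 ⊛ g (suc p) ⊕ A p)
    ≈⟨ 𝕏.distribˡ (𝕏.ι (nat (suc p))) (f 0 ⊛ g (suc p)) (A p) ⟩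
  𝕏.ι (nat (suc p)) ⊛ (f 0 ⊛ g (suc p)) ⊕ 𝕏.ι (nat (suc p)) ⊛ A p
    ≈⟨ 𝕏.+-cong (solveₓ 3 (λ n a b → n :*ₓ (a :*ₓ b) :=ₓ a :*ₓ (n :*ₓ b)) 𝕏.refl (𝕏.ι (nat (suc p))) (f 0) (g (suc p)))
         (𝕏.trans (𝕏.*-congʳ {A p} (𝕏.ι-suc p)) (𝕏.trans (𝕏.distribʳ (A p) (const 1ℚ) (𝕏.ι (nat p)))
           (𝕏.+-cong (𝕏.*-identityˡ (A p)) (leibniz tf g p)))) ⟩
  f 0 ⊛ θ g (suc p) ⊕ (A p ⊕ ((θ tf Y.⊛ g) p ⊕ (tf Y.⊛ θ g) p))
    ≈⟨ solveₓ 4 (λ a b c d → a :+ₓ (b :+ₓ (c :+ₓ d)) :=ₓ (c :+ₓ b) :+ₓ (a :+ₓ d)) 𝕏.refl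
         (f 0 ⊛ θ g (suc p)) (A p) ((θ tf Y.⊛ g) p) ((tf Y.⊛ θ g) p) ⟩
  ((θ tf Y.⊛ g) p ⊕ A p) ⊕ (f Y.⊛ θ g) (suc p)
    ≈⟨ 𝕏.+-congʳ {(f Y.⊛ θ g) (suc p)} (𝕏.trans (𝕏.sym (𝕐.distribʳ g (θ tf) tf p))
         (𝕏.trans (𝕐.*-congʳ {g} (𝕐.sym (θ-tail f)) p)
           (𝕏.sym (𝕏.trans (𝕏.+-congʳ {(Y.tail (θ f) Y.⊛ g) p} head) (𝕏.+-identityˡ _))))) ⟩
  (θ f Y.⊛ g) (suc p) ⊕ (f Y.⊛ θ g) (suc p) ∎
  where
  open Relation.Binary.Reasoning.Setoid 𝕏.setoid
  tf = Y.tail f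
  A = tf Y.⊛ g
  head : const 0ℚ ⊛ f 0 ⊛ g (suc p) 𝕏.≈ const 0ℚ
  head = 𝕏.trans (𝕏.*-congʳ {g (suc p)} (𝕏.zeroˡ (f 0))) (𝕏.zeroˡ (g (suc p)))

linear-y : Series → Y.Series
linear-y c = Y.X Y.⊛ Y.const c

linear-y-coeff : ∀ c → (linear-y c 0 𝕏.≈ const 0ℚ) × (linear-y c 1 𝕏.≈ c) × (∀ p → linear-y c (2 ℕ.+ p) 𝕏.≈ const 0ℚ)
linear-y-coeff c = 𝕏.zeroˡ c , Y.X-⊛ (Y.const c) 0 , λ p → Y.X-⊛ (Y.const c) (suc p)

θ-1-y : ∀ c → θ (1- c y) Y.≋ 𝕐.- linear-y c
θ-1-y c zero = 𝕏.trans (𝕏.zeroˡ ((1- c y) 0)) (𝕏.sym (𝕏.trans (𝕏.-‿cong (proj₁ (linear-y-coeff c))) neg0))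
  where
  neg0 : ⊝ const 0ℚ 𝕏.≈ const 0ℚ
  neg0 = λ { zero → refl ; (suc r) → refl }
θ-1-y c (suc zero) = 𝕏.trans (𝕏.*-congʳ {(1- c y) 1} {𝕏.ι (nat 1)} 𝕏.1-homo)
  (𝕏.trans (𝕏.*-identityˡ ((1- c y) 1)) (𝕏.+-identityˡ (⊝ linear-y c 1)))
θ-1-y c (suc (suc p)) = begin
  n ⊛ (const 0ℚ ⊕ ⊝ linear-y c (2 ℕ.+ p))   ≈⟨ 𝕏.*-congˡ {n} (𝕏.trans (𝕏.+-identityˡ _) z) ⟩
  n ⊛ const 0ℚ                              ≈⟨ 𝕏.zeroʳ n ⟩
  const 0ℚ                                  ≈⟨ z ⟨
  ⊝ linear-y c (2 ℕ.+ p)                    ∎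
  where
  open Relation.Binary.Reasoning.Setoid 𝕏.setoid
  n = 𝕏.ι (nat (2 ℕ.+ p))
  z : ⊝ linear-y c (2 ℕ.+ p) 𝕏.≈ const 0ℚ
  z = 𝕏.trans (𝕏.-‿cong (proj₂ (proj₂ (linear-y-coeff c)) p)) (λ { zero → refl ; (suc r) → refl })

-- Logarithmic derivatives in y

power : Series → ℕ → Series
power c zero    = const 1ℚ
power c (suc k) = c ⊛ power c k

geometric : Series → Y.Series
geometric c p = power c p

geometric-inverse : ∀ c → (1- c y) Y.⊛ geometric c Y.≋ Y.const (const 1ℚ)
geometric-inverse c zero    = 1-y-⊛₀ c (geometric c)
geometric-inverse c (suc p) = 𝕏.trans (1-y-⊛ c (geometric c) (suc p)) (𝕏.-‿inverseʳ (power c (suc p)))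

-- c y / (1 - c y), the logarithmic derivative of (1 - c y)⁻¹; for 1 - c y itself the sign is
-- opposite.
logDerivative : Series → Y.Series
logDerivative c = linear-y c Y.⊛ geometric c

logDerivative₀ : ∀ c → logDerivative c 0 𝕏.≈ const 0ℚ
logDerivative₀ c = 𝕏.trans (𝕏.*-congʳ {const 1ℚ} (𝕏.zeroˡ c)) (𝕏.zeroˡ (const 1ℚ))

logDerivativeₛ : ∀ c p → logDerivative c (suc p) 𝕏.≈ power c (suc p)
logDerivativeₛ c p = 𝕏.trans (𝕐.*-assoc Y.X (Y.const c) (geometric c) (suc p))
  (𝕏.trans (Y.X-⊛ (Y.const c Y.⊛ geometric c) p) (Y.const-⊛ c (geometric c) p))

-- Apply `θ` to both sides of the product equation by Leibniz' rule, then multiply by the geometric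
-- series inverse to 1 - d y.
θ-quotient : ∀ c d B V W → θ V Y.≋ B Y.⊛ V → (1- d y) Y.⊛ W Y.≋ (1- c y) Y.⊛ V →
             θ W Y.≋ (B Y.⊕ (logDerivative d 𝕐.- logDerivative c)) Y.⊛ W
θ-quotient c d B V W θV PW≈QV = begin
  θ W
    ≈⟨ 𝕐.trans (𝕐.*-congʳ {θ W} (𝕐.trans (𝕐.*-comm gd P) (geometric-inverse d))) (𝕐.*-identityˡ (θ W)) ⟨
  gd Y.⊛ P Y.⊛ θ W
    ≈⟨ 𝕐.trans (𝕐.*-assoc gd P (θ W)) (𝕐.*-congˡ {gd} PθW) ⟩
  gd Y.⊛ (Q Y.⊛ (B Y.⊛ V) 𝕐.- C Y.⊛ V Y.⊕ D Y.⊛ W)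
    ≈⟨ solveᵧ 7 (λ g q b v c d w → g :*ᵧ (q :*ᵧ (b :*ᵧ v) :-ᵧ c :*ᵧ v :+ᵧ d :*ᵧ w)
          :=ᵧ b :*ᵧ (g :*ᵧ (q :*ᵧ v)) :-ᵧ c :*ᵧ (g :*ᵧ v) :+ᵧ (d :*ᵧ g) :*ᵧ w) 𝕐.refl gd Q B V C D W ⟩
  B Y.⊛ (gd Y.⊛ (Q Y.⊛ V)) 𝕐.- C Y.⊛ (gd Y.⊛ V) Y.⊕ (D Y.⊛ gd) Y.⊛ W
    ≈⟨ 𝕐.+-congʳ {(D Y.⊛ gd) Y.⊛ W} (𝕐.+-cong (𝕐.*-congˡ {B} gdQV) (𝕐.-‿cong (𝕐.*-congˡ {C} gdV))) ⟩
  B Y.⊛ W 𝕐.- C Y.⊛ (gc Y.⊛ W) Y.⊕ (D Y.⊛ gd) Y.⊛ W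
    ≈⟨ solveᵧ 6 (λ b w c g d h → b :*ᵧ w :-ᵧ c :*ᵧ (g :*ᵧ w) :+ᵧ (d :*ᵧ h) :*ᵧ w
          :=ᵧ (b :+ᵧ (d :*ᵧ h :-ᵧ c :*ᵧ g)) :*ᵧ w) 𝕐.refl B W C gc D gd ⟩
  (B Y.⊕ (logDerivative d 𝕐.- logDerivative c)) Y.⊛ W ∎
  where
  open Relation.Binary.Reasoning.Setoid 𝕐.setoid
  P = 1- d y
  Q = 1- c y
  C = linear-y c
  D = linear-y d
  gc = geometric c
  gd = geometric d

  gdQV : gd Y.⊛ (Q Y.⊛ V) Y.≋ W
  gdQV = 𝕐.trans (𝕐.*-congˡ {gd} (𝕐.sym PW≈QV)) (𝕐.trans (𝕐.sym (𝕐.*-assoc gd P W))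
    (𝕐.trans (𝕐.*-congʳ {W} (𝕐.trans (𝕐.*-comm gd P) (geometric-inverse d))) (𝕐.*-identityˡ W)))

  gdV : gd Y.⊛ V Y.≋ gc Y.⊛ W
  gdV = 𝕐.sym (𝕐.trans (𝕐.*-congˡ {gc} (𝕐.sym gdQV))
    (𝕐.trans (solveᵧ 4 (λ a b q v → a :*ᵧ (b :*ᵧ (q :*ᵧ v)) :=ᵧ (q :*ᵧ a) :*ᵧ (b :*ᵧ v)) 𝕐.refl gc gd Q V)
    (𝕐.trans (𝕐.*-congʳ {gd Y.⊛ V} (geometric-inverse c)) (𝕐.*-identityˡ (gd Y.⊛ V)))))

  PθW : P Y.⊛ θ W Y.≋ Q Y.⊛ (B Y.⊛ V) 𝕐.- C Y.⊛ V Y.⊕ D Y.⊛ W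
  PθW = begin
    P Y.⊛ θ W
      ≈⟨ solveᵧ 3 (λ p d w → p :=ᵧ (:-ᵧ d :*ᵧ w :+ᵧ p) :+ᵧ d :*ᵧ w) 𝕐.refl (P Y.⊛ θ W) D W ⟩
    (𝕐.- D) Y.⊛ W Y.⊕ P Y.⊛ θ W Y.⊕ D Y.⊛ W
      ≈⟨ 𝕐.+-congʳ {D Y.⊛ W} (𝕐.+-congʳ {P Y.⊛ θ W} (𝕐.*-congʳ {W} (θ-1-y d))) ⟨
    θ P Y.⊛ W Y.⊕ P Y.⊛ θ W Y.⊕ D Y.⊛ W
      ≈⟨ 𝕐.+-congʳ {D Y.⊛ W} (𝕐.trans (𝕐.sym (leibniz P W)) (𝕐.trans (θ-cong PW≈QV) (leibniz Q V))) ⟩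
    θ Q Y.⊛ V Y.⊕ Q Y.⊛ θ V Y.⊕ D Y.⊛ W
      ≈⟨ 𝕐.+-congʳ {D Y.⊛ W} (𝕐.+-cong (𝕐.*-congʳ {V} (θ-1-y c)) (𝕐.*-congˡ {Q} θV)) ⟩
    (𝕐.- C) Y.⊛ V Y.⊕ Q Y.⊛ (B Y.⊛ V) Y.⊕ D Y.⊛ W
      ≈⟨ solveᵧ 4 (λ c v q d → :-ᵧ c :*ᵧ v :+ᵧ q :+ᵧ d :=ᵧ q :-ᵧ c :*ᵧ v :+ᵧ d) 𝕐.refl C V (Q Y.⊛ (B Y.⊛ V)) (D Y.⊛ W) ⟩
    Q Y.⊛ (B Y.⊛ V) 𝕐.- C Y.⊛ V Y.⊕ D Y.⊛ W ∎

module _ (m : ℕ) where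

  open Product m

  pole : ℕ → Series
  pole k = const (inv k ^^ (2 ℕ.+ m))

  H-step : ∀ N → (1- pole N y) Y.⊛ H (suc N) Y.≋ H N
  H-step N zero    = 1-y-⊛₀ (pole N) (H (suc N))
  H-step N (suc p) = 𝕏.trans (1-y-⊛ (pole N) (H (suc N)) (suc p))
    (𝕏.trans (𝕏.+-cong (𝕏.trans (𝕏.+-homo (Σ< N (level m p)) (level m p N))
        (𝕏.+-congˡ {const (Σ< N (level m p))} (𝕏.trans (𝕏.reflexive (cong const (level-^^ m p N))) (𝕏.*-homo (inv N ^^ (2 ℕ.+ m)) (levelSum m p (suc N))))))
        (𝕏.refl {⊝ (pole N ⊛ H (suc N) p)}))
      (solveₓ 2 (λ a b → a :+ₓ b :-ₓ b :=ₓ a) 𝕏.refl (const (Σ< N (level m p))) (pole N ⊛ H (suc N) p)))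

  V-step : ∀ N → (1- pole N y) Y.⊛ V (suc N) Y.≋ (1- factor m N y) Y.⊛ V N
  V-step N = 𝕐.trans
    (solveᵧ 4 (λ p q u h → p :*ᵧ (q :*ᵧ u :*ᵧ h) :=ᵧ q :*ᵧ u :*ᵧ (p :*ᵧ h)) 𝕐.refl (1- pole N y) (1- factor m N y) (U N) (H (suc N)))
    (𝕐.trans (𝕐.*-congˡ {(1- factor m N y) Y.⊛ U N} (H-step N)) (𝕐.*-assoc (1- factor m N y) (U N) (H N)))

  logV : ℕ → Y.Series
  logV N = 𝕐.Σ< N (λ k → logDerivative (pole k) 𝕐.- logDerivative (factor m k))

  V-zero : V 0 Y.≋ Y.const (const 1ℚ)
  V-zero = 𝕐.trans (𝕐.*-identityˡ (H 0)) λ { zero → 𝕏.refl ; (suc p) → λ { zero → refl ; (suc r) → refl } }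

  θV : ∀ N → θ (V N) Y.≋ logV N Y.⊛ V N
  θV zero    = 𝕐.trans (θ-cong V-zero) (𝕐.trans θ1 (𝕐.sym (𝕐.zeroˡ (V 0))))
    where
    θ1 : θ (Y.const (const 1ℚ)) Y.≋ Y.const (const 0ℚ)
    θ1 zero    = 𝕏.zeroˡ (const 1ℚ)
    θ1 (suc p) = 𝕏.zeroʳ (𝕏.ι (nat (suc p)))
  θV (suc N) = θ-quotient (factor m N) (pole N) (logV N) (V N) (V (suc N)) (θV N) (V-step N)

-- Polynomials in zeta values

-- Equality is required at every N and not only in the limit: `seq (eval P) N` is P at the truncated
-- zeta values. Closure under sums and products therefore needs no estimate.
ZetaPolynomial : (ℕ → ℚ) → Set
ZetaPolynomial a = ∃[ P ] ∀ N → a N ≡ seq (eval P) N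

ZP-+ : ∀ {a b} → ZetaPolynomial a → ZetaPolynomial b → ZetaPolynomial (λ N → a N + b N)
ZP-+ (P , p) (Q , q) = P Defs.:+ Q , λ N → cong₂ _+_ (p N) (q N)

ZP-* : ∀ {a b} → ZetaPolynomial a → ZetaPolynomial b → ZetaPolynomial (λ N → a N * b N)
ZP-* (P , p) (Q , q) = P Defs.:* Q , λ N → cong₂ _*_ (p N) (q N)

ZP-const : ∀ c → ZetaPolynomial (λ _ → c)
ZP-const c = Defs.con c , λ _ → refl

ZP-resp : ∀ {a b} → (∀ N → a N ≡ b N) → ZetaPolynomial a → ZetaPolynomial b
ZP-resp e (P , p) = P , λ N → trans (sym (e N)) (p N)

ZP-neg : ∀ {a} → ZetaPolynomial a → ZetaPolynomial (λ N → - a N)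
ZP-neg {a} p = ZP-resp (λ N → solve 1 (λ x → (:- con 1ℚ) :* x := :- x) refl (a N)) (ZP-* (ZP-const (- 1ℚ)) p)

ZPₓ : (ℕ → Series) → Set
ZPₓ F = ∀ r → ZetaPolynomial (λ N → F N r)

ZPₓ-resp : ∀ {F G} → (∀ N → F N ≋ G N) → ZPₓ F → ZPₓ G
ZPₓ-resp e h r = ZP-resp (λ N → e N r) (h r)

ZPₓ-+ : ∀ {F G} → ZPₓ F → ZPₓ G → ZPₓ (λ N → F N ⊕ G N)
ZPₓ-+ h k r = ZP-+ (h r) (k r)

ZPₓ-* : ∀ {F G} → ZPₓ F → ZPₓ G → ZPₓ (λ N → F N ⊛ G N)
ZPₓ-* {F} {G} h k r = X.⊛-closure ZetaPolynomial ZetaPolynomial ZetaPolynomial ZP-* ZP-+ F G r (λ i _ → h i) (λ i _ → k i)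

^^-+ : ∀ x a b → x ^^ (a ℕ.+ b) ≡ x ^^ a * x ^^ b
^^-+ x zero    b = sym (ℚ.*-identityˡ (x ^^ b))
^^-+ x (suc a) b = trans (cong (x *_) (^^-+ x a b)) (sym (ℚ.*-assoc x (x ^^ a) (x ^^ b)))

-- f k is (k + 1)^(-s) times a fixed series in x / (k + 1)
Homogeneous : ℕ → (ℕ → Series) → Set
Homogeneous s f = Σ[ κ ∈ Series ] ∀ k r → f k r ≡ κ r * (inv k ^^ r * inv k ^^ s)

-- The substitution of a multiple of the variable is multiplicative; u and v are constant factors.
dilate-⊛ : ∀ (κ μ : Series) x u v r →
  ((λ i → κ i * (x ^^ i * u)) ⊛ (λ i → μ i * (x ^^ i * v))) r ≡ (κ ⊛ μ) r * (x ^^ r * (u * v))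
dilate-⊛ κ μ x u v zero    = solve 4 (λ a b u v → a :* (con 1ℚ :* u) :* (b :* (con 1ℚ :* v)) := a :* b :* (con 1ℚ :* (u :* v))) refl (κ 0) (μ 0) u v
dilate-⊛ κ μ x u v (suc r) = trans
  (cong (κ 0 * (1ℚ * u) * (μ (suc r) * (x ^^ suc r * v)) +_)
    (trans (X.⊛-cong {h = λ i → μ i * (x ^^ i * v)}
             (λ i → solve 4 (λ a x e u → a :* (x :* e :* u) := a :* (e :* (x :* u))) refl (κ (suc i)) x (x ^^ i) u) (λ _ → refl) r)
           (dilate-⊛ (X.tail κ) μ x (x * u) v r)))
  (solve 7 (λ a u b x e v t → a :* (con 1ℚ :* u) :* (b :* (x :* e :* v)) :+ t :* (e :* (x :* u :* v))
              := (a :* b :+ t) :* (x :* e :* (u :* v))) refl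
     (κ 0) u (μ (suc r)) x (x ^^ r) v ((X.tail κ ⊛ μ) r))

Homogeneous-* : ∀ {s t f g} → Homogeneous s f → Homogeneous t g → Homogeneous (s ℕ.+ t) (λ k → f k ⊛ g k)
Homogeneous-* {s} {t} (κ , p) (μ , q) = κ ⊛ μ , λ k r → trans (X.⊛-cong (p k) (q k) r)
  (trans (dilate-⊛ κ μ (inv k) (inv k ^^ s) (inv k ^^ t) r)
    (cong (λ z → (κ ⊛ μ) r * (inv k ^^ r * z)) (sym (^^-+ (inv k) s t))))

Homogeneous-const : ∀ s → Homogeneous s (λ k → const (inv k ^^ s))
Homogeneous-const s = const 1ℚ , λ where
  k zero    → solve 1 (λ x → x := con 1ℚ :* (con 1ℚ :* x)) refl (inv k ^^ s)
  k (suc r) → sym (ℚ.*-zeroˡ (inv k ^^ suc r * inv k ^^ s))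

Homogeneous-w : Homogeneous 1 w
Homogeneous-w = (λ _ → 1ℚ) , λ k r →
  solve 2 (λ i e → i :* e := con 1ℚ :* (e :* (i :* con 1ℚ))) refl (inv k) (inv k ^^ r)

Homogeneous-w^ : ∀ s → Homogeneous s (w^ s)
Homogeneous-w^ zero    = Homogeneous-const 0
Homogeneous-w^ (suc s) = Homogeneous-* {1} {s} Homogeneous-w (Homogeneous-w^ s)

exponent : ℕ → ℕ → ℕ
exponent q zero    = 0
exponent q (suc a) = q ℕ.+ exponent q a

Homogeneous-power : ∀ {q f} → Homogeneous q f → ∀ a → Homogeneous (exponent q a) (λ k → power (f k) a)
Homogeneous-power h zero    = Homogeneous-const 0
Homogeneous-power {q} h (suc a) = Homogeneous-* {q} {exponent q a} h (Homogeneous-power {q} h a)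

Σ<-* : ∀ c g N → Σ< N (λ k → c * g k) ≡ c * Σ< N g
Σ<-* c g zero    = sym (ℚ.*-zeroʳ c)
Σ<-* c g (suc N) = trans (cong (_+ c * g N) (Σ<-* c g N)) (sym (ℚ.*-distribˡ-+ c (Σ< N g) (g N)))

-- In the coefficient of x^r the constant κ r comes out of the sum and one truncated zeta value of
-- exponent 2 + s + r is left. The offset 2 keeps the divergent harmonic sum away.
Homogeneous-sum : ∀ s {f} → Homogeneous (2 ℕ.+ s) f → ZPₓ (λ N → 𝕏.Σ< N f)
Homogeneous-sum s {f} (κ , p) r = Defs.con (κ r) Defs.:* Defs.var (2 ℕ.+ s ℕ.+ r) , λ N →
  trans (Σ<-coeff N f r) (trans (Σ<-cong N (λ k → trans (p k r) (cong (κ r *_)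
      (trans (ℚ.*-comm (inv k ^^ r) (inv k ^^ (2 ℕ.+ s))) (trans (sym (^^-+ (inv k) (2 ℕ.+ s) r)) (sym (1/^≡inv^^ k (2 ℕ.+ s ℕ.+ r))))))))
    (trans (Σ<-* (κ r) (λ k → 1/ suc k ^ (2 ℕ.+ s ℕ.+ r)) N) (cong (κ r *_) (Σ<≡∑ N (λ k → refl)))))

Σ<-- : ∀ N F G → 𝕏.Σ< N (λ k → F k 𝕏.- G k) ≋ 𝕏.Σ< N F 𝕏.- 𝕏.Σ< N G
Σ<-- zero    F G = λ { zero → refl ; (suc r) → refl }
Σ<-- (suc N) F G = 𝕏.trans (𝕏.+-congʳ {F N 𝕏.- G N} (Σ<-- N F G))
  (solveₓ 4 (λ a b c d → (a :-ₓ b) :+ₓ (c :-ₓ d) :=ₓ (a :+ₓ c) :-ₓ (b :+ₓ d)) 𝕏.refl (𝕏.Σ< N F) (𝕏.Σ< N G) (F N) (G N))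

module _ (m : ℕ) where

  open Product m

  logV₀ : ∀ N → logV m N 0 𝕏.≈ const 0ℚ
  logV₀ N = 𝕏.trans (Σ<-coeffᵧ N _ 0) (go N)
    where
    go : ∀ N → 𝕏.Σ< N (λ k → logDerivative (pole m k) 0 𝕏.- logDerivative (factor m k) 0) 𝕏.≈ const 0ℚ
    go zero    = 𝕏.refl
    go (suc N) = 𝕏.trans (𝕏.+-cong (go N) (𝕏.+-cong (logDerivative₀ (pole m N)) (𝕏.-‿cong (logDerivative₀ (factor m N)))))
      λ { zero → refl ; (suc r) → refl }

  logV-ZP : ∀ a → ZPₓ (λ N → logV m N (suc a))
  logV-ZP a = ZPₓ-resp
    (λ N → 𝕏.sym (𝕏.trans (Σ<-coeffᵧ N _ (suc a)) (𝕏.trans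
      (𝕏.Σ<-cong N (λ k → 𝕏.+-cong (logDerivativeₛ (pole m k) a) (𝕏.-‿cong (logDerivativeₛ (factor m k) a))))
      (Σ<-- N _ _))))
    (ZPₓ-+ (Homogeneous-sum (m ℕ.+ exponent (2 ℕ.+ m) a) (Homogeneous-power {2 ℕ.+ m} (Homogeneous-const (2 ℕ.+ m)) (suc a)))
           (λ r → ZP-neg (Homogeneous-sum (m ℕ.+ exponent (2 ℕ.+ m) a) (Homogeneous-power {2 ℕ.+ m} (Homogeneous-w^ (2 ℕ.+ m)) (suc a)) r)))

  V₀ : ∀ N → V N 0 𝕏.≈ const 1ℚ
  V₀ N = 𝕏.trans (𝕏.*-congʳ {const 1ℚ} (U₀ N)) (𝕏.*-identityˡ (const 1ℚ))

  -- As `logV` has no constant term, the right side of θ V = `logV` · V contains only lower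
  -- coefficients of V. These are Newton's identities between symmetric functions and power sums.
  V-recurrence : ∀ N p → V N (suc p) ≋ (λ r → inv p * (Y.tail (logV m N) Y.⊛ V N) p r)
  V-recurrence N p r = nat*-injective p _ _ (trans (sym (X.const-⊛ (nat (suc p)) (V N (suc p)) r))
    (trans (θV m N (suc p) r) (trans (cong (_+ (Y.tail (logV m N) Y.⊛ V N) p r)
        (𝕏.trans (𝕏.*-congʳ {V N (suc p)} (logV₀ N)) (𝕏.zeroˡ (V N (suc p))) r))
      (𝕏.+-identityˡ ((Y.tail (logV m N) Y.⊛ V N) p) r))))

  V-ZP : ∀ p → ZPₓ (λ N → V N p)
  V-ZP = ℕ.<-rec (λ p → ZPₓ (λ N → V N p)) step
    where
    step : ∀ p → (∀ {i} → i ℕ.< p → ZPₓ (λ N → V N i)) → ZPₓ (λ N → V N p)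
    step zero    _   = ZPₓ-resp (λ N → 𝕏.sym (V₀ N)) (λ { zero → ZP-const 1ℚ ; (suc r) → ZP-const 0ℚ })
    step (suc p) rec = ZPₓ-resp (λ N → 𝕏.sym (V-recurrence N p))
      (λ r → ZP-* (ZP-const (inv p)) (Y.⊛-closure ZPₓ ZPₓ ZPₓ ZPₓ-* ZPₓ-+ (λ N → Y.tail (logV m N)) V p
        (λ i _ → logV-ZP i) (λ i i≤p → rec (ℕ.s≤s i≤p)) r))

-- Convergence

1≤natₛ : ∀ n → 1ℚ ≤ nat (suc n)
1≤natₛ n = ℚ.≤-trans (p≤q+p 1ℚ (0≤nat n)) (ℚ.≤-reflexive (ℚ.+-comm (nat n) 1ℚ))

^^-increment : ∀ {a d} → 0ℚ ≤ a → 0ℚ ≤ d → ∀ k →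
  (a + d) ^^ suc k ≤ a ^^ suc k + nat (suc k) * d * (a + d) ^^ k
^^-increment {a} {d} 0≤a 0≤d zero    = ℚ.≤-reflexive
  (solve 2 (λ a d → (a :+ d) :* con 1ℚ := a :* con 1ℚ :+ (con 1ℚ :+ con 0ℚ) :* d :* con 1ℚ) refl a d)
^^-increment {a} {d} 0≤a 0≤d (suc k) = begin
  (a + d) * (a + d) ^^ suc k
    ≤⟨ ℚ.*-monoˡ-≤-nonNeg (a + d) {{nonNegative (0≤+ 0≤a 0≤d)}} (^^-increment 0≤a 0≤d k) ⟩
  (a + d) * (a ^^ suc k + nat (suc k) * d * (a + d) ^^ k)
    ≡⟨ solve 5 (λ a d u n v → (a :+ d) :* (u :+ n :* d :* v) := a :* u :+ n :* d :* ((a :+ d) :* v) :+ d :* u) refl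
         a d (a ^^ suc k) (nat (suc k)) ((a + d) ^^ k) ⟩
  a * a ^^ suc k + nat (suc k) * d * (a + d) ^^ suc k + d * a ^^ suc k
    ≤⟨ ℚ.+-monoʳ-≤ (a * a ^^ suc k + nat (suc k) * d * (a + d) ^^ suc k)
         (ℚ.*-monoˡ-≤-nonNeg d {{nonNegative 0≤d}} (^^-mono 0≤a (ℚ.≤-trans (p≤q+p a 0≤d) (ℚ.≤-reflexive (ℚ.+-comm d a))) (suc k))) ⟩
  a * a ^^ suc k + nat (suc k) * d * (a + d) ^^ suc k + d * (a + d) ^^ suc k
    ≡⟨ solve 4 (λ u n d v → u :+ n :* d :* v :+ d :* v := u :+ (con 1ℚ :+ n) :* d :* v) refl
         (a * a ^^ suc k) (nat (suc k)) d ((a + d) ^^ suc k) ⟩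
  a ^^ (2 ℕ.+ k) + nat (2 ℕ.+ k) * d * (a + d) ^^ suc k ∎
  where open ℚ.≤-Reasoning

nat*inv≤2 : ∀ n → nat (2 ℕ.+ n) * inv n ≤ 1ℚ + 1ℚ
nat*inv≤2 n = begin
  (1ℚ + nat (suc n)) * inv n   ≡⟨ trans (ℚ.*-distribʳ-+ (inv n) 1ℚ (nat (suc n))) (cong₂ _+_ (ℚ.*-identityˡ (inv n)) (nat*inv n)) ⟩
  inv n + 1ℚ                   ≤⟨ ℚ.+-monoˡ-≤ 1ℚ (inv≤1 n) ⟩
  1ℚ + 1ℚ                      ∎
  where open ℚ.≤-Reasoning

-- From n to n + 1 the power k + 1 grows by at most (k + 1) · `inv n` · `ℓ (suc n) ^^ k`, which the
-- bound for k makes at most the constant `E`. In `D` the summand 1 covers n = 0 and `E` covers each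
-- increment.
ℓ^^-linear : ∀ k → ∃[ C ] (0ℚ ≤ C × ∀ n → ℓ n ^^ k ≤ C * nat (suc n))
ℓ^^-linear zero    = 1ℚ , 0≤1 , λ n → ℚ.≤-trans (1≤natₛ n) (ℚ.≤-reflexive (sym (ℚ.*-identityˡ (nat (suc n)))))
ℓ^^-linear (suc k) with ℓ^^-linear k
... | C , 0≤C , h = D , 0≤D , go
  where
  open ℚ.≤-Reasoning
  E = nat (suc k) * (C * (1ℚ + 1ℚ))
  D = 1ℚ + E

  0≤E : 0ℚ ≤ E
  0≤E = 0≤* (0≤nat (suc k)) (0≤* 0≤C (0≤+ 0≤1 0≤1))

  0≤D : 0ℚ ≤ D
  0≤D = 0≤+ 0≤1 0≤E

  go : ∀ n → ℓ n ^^ suc k ≤ D * nat (suc n)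
  go zero    = begin
    1ℚ ^^ suc k   ≡⟨ 1^^ (suc k) ⟩
    1ℚ            ≤⟨ p≤q+p 1ℚ 0≤E ⟩
    E + 1ℚ        ≡⟨ solve 1 (λ e → e :+ con 1ℚ := (con 1ℚ :+ e) :* (con 1ℚ :+ con 0ℚ)) refl E ⟩
    D * nat 1     ∎
    where
    1^^ : ∀ k → 1ℚ ^^ k ≡ 1ℚ
    1^^ zero    = refl
    1^^ (suc k) = trans (ℚ.*-identityˡ (1ℚ ^^ k)) (1^^ k)
  go (suc n) = begin
    (ℓ n + inv n) ^^ suc k
      ≤⟨ ^^-increment (0≤ℓ n) (0≤inv n) k ⟩
    ℓ n ^^ suc k + nat (suc k) * inv n * ℓ (suc n) ^^ k
      ≤⟨ ℚ.+-mono-≤ (go n) (ℚ.*-monoˡ-≤-nonNeg (nat (suc k) * inv n) {{nonNegative (0≤* (0≤nat (suc k)) (0≤inv n))}} (h (suc n))) ⟩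
    D * nat (suc n) + nat (suc k) * inv n * (C * nat (2 ℕ.+ n))
      ≡⟨ cong (D * nat (suc n) +_) (solve 4 (λ a i c b → a :* i :* (c :* b) := a :* (c :* (b :* i))) refl (nat (suc k)) (inv n) C (nat (2 ℕ.+ n))) ⟩
    D * nat (suc n) + nat (suc k) * (C * (nat (2 ℕ.+ n) * inv n))
      ≤⟨ ℚ.+-monoʳ-≤ (D * nat (suc n)) (ℚ.*-monoˡ-≤-nonNeg (nat (suc k)) {{nonNegative (0≤nat (suc k))}}
           (ℚ.*-monoˡ-≤-nonNeg C {{nonNegative 0≤C}} (nat*inv≤2 n))) ⟩
    D * nat (suc n) + E
      ≤⟨ ℚ.+-monoʳ-≤ (D * nat (suc n)) (p≤q+p E 0≤1) ⟩
    D * nat (suc n) + D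
      ≡⟨ solve 2 (λ d n → d :* n :+ d := d :* (con 1ℚ :+ n)) refl D (nat (suc n)) ⟩
    D * nat (2 ℕ.+ n) ∎

degree : Bound → ℕ
degree 𝟏       = 0
degree log     = 1
degree (d ∔ e) = degree d ℕ.+ degree e
degree (d ∙ e) = degree d ℕ.+ degree e

^^-monoʳ : ∀ {x} → 1ℚ ≤ x → ∀ a b → x ^^ a ≤ x ^^ (a ℕ.+ b)
^^-monoʳ {x} 1≤x zero    b = 1≤ b
  where
  1≤ : ∀ b → 1ℚ ≤ x ^^ b
  1≤ zero    = ℚ.≤-refl
  1≤ (suc b) = subst (_≤ x * x ^^ b) (ℚ.*-identityˡ 1ℚ) (*-mono 0≤1 (ℚ.≤-trans 0≤1 (1≤ b)) 1≤x (1≤ b))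
^^-monoʳ {x} 1≤x (suc a) b = ℚ.*-monoˡ-≤-nonNeg x {{nonNegative (ℚ.≤-trans 0≤1 1≤x)}} (^^-monoʳ 1≤x a b)

Bound-power : ∀ e → ∃[ C ] (0ℚ ≤ C × ∀ x → 1ℚ ≤ x → ⟦ e ⟧ x ≤ C * x ^^ degree e)
Bound-power 𝟏       = 1ℚ , 0≤1 , λ x _ → ℚ.≤-refl
Bound-power log     = 1ℚ , 0≤1 , λ x _ → ℚ.≤-reflexive (solve 1 (λ x → x := con 1ℚ :* (x :* con 1ℚ)) refl x)
Bound-power (d ∔ e) with Bound-power d | Bound-power e
... | C , 0≤C , g | D , 0≤D , h = C + D , 0≤+ 0≤C 0≤D , λ x 1≤x → begin
  ⟦ d ⟧ x + ⟦ e ⟧ x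
    ≤⟨ ℚ.+-mono-≤ (g x 1≤x) (h x 1≤x) ⟩
  C * x ^^ degree d + D * x ^^ degree e
    ≤⟨ ℚ.+-mono-≤ (ℚ.*-monoˡ-≤-nonNeg C {{nonNegative 0≤C}} (^^-monoʳ 1≤x (degree d) (degree e)))
         (ℚ.*-monoˡ-≤-nonNeg D {{nonNegative 0≤D}} (subst (λ k → x ^^ degree e ≤ x ^^ k) (ℕ.+-comm (degree e) (degree d)) (^^-monoʳ 1≤x (degree e) (degree d)))) ⟩
  C * x ^^ (degree d ℕ.+ degree e) + D * x ^^ (degree d ℕ.+ degree e)
    ≡⟨ ℚ.*-distribʳ-+ (x ^^ (degree d ℕ.+ degree e)) C D ⟨
  (C + D) * x ^^ (degree d ℕ.+ degree e) ∎
  where open ℚ.≤-Reasoning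
Bound-power (d ∙ e) with Bound-power d | Bound-power e
... | C , 0≤C , g | D , 0≤D , h = C * D , 0≤* 0≤C 0≤D , λ x 1≤x → let 0≤x = ℚ.≤-trans 0≤1 1≤x in begin
  ⟦ d ⟧ x * ⟦ e ⟧ x
    ≤⟨ *-mono (0≤⟦ d ⟧ 0≤x) (0≤* 0≤D (0≤^^ 0≤x (degree e))) (g x 1≤x) (h x 1≤x) ⟩
  C * x ^^ degree d * (D * x ^^ degree e)
    ≡⟨ solve 4 (λ a b c d → a :* b :* (c :* d) := a :* c :* (b :* d)) refl C (x ^^ degree d) D (x ^^ degree e) ⟩
  C * D * (x ^^ degree d * x ^^ degree e)
    ≡⟨ cong (C * D *_) (^^-+ x (degree d) (degree e)) ⟨
  C * D * x ^^ (degree d ℕ.+ degree e) ∎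
  where open ℚ.≤-Reasoning

Bound-linear : ∀ e → ∃[ C ] (0ℚ ≤ C × ∀ n → ⟦ e ⟧ (ℓ n) ≤ C * nat (suc n))
Bound-linear e with Bound-power e | ℓ^^-linear (degree e)
... | C , 0≤C , g | D , 0≤D , h = C * D , 0≤* 0≤C 0≤D , λ n → ℚ.≤-trans (g (ℓ n) (1≤ℓ n))
  (ℚ.≤-trans (ℚ.*-monoˡ-≤-nonNeg C {{nonNegative 0≤C}} (h n)) (ℚ.≤-reflexive (sym (ℚ.*-assoc C D (nat (suc n))))))

Null : (ℕ → ℚ) → Set
Null z = ∀ ε → 0ℚ < ε → ∃[ N ] ∀ n → N ℕ.≤ n → ∣ z n ∣ < ε

square-cancel-< : ∀ {x ε} → 0ℚ < ε → x * x < ε * ε → x < ε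
square-cancel-< {x} {ε} 0<ε p with x ℚ.<? ε
... | yes x<ε = x<ε
... | no  x≮ε = ⊥-elim (ℚ.<-irrefl refl (ℚ.<-≤-trans p (*-mono (ℚ.<⇒≤ 0<ε) (ℚ.≤-trans (ℚ.<⇒≤ 0<ε) ε≤x) ε≤x ε≤x)))
  where ε≤x = ℚ.≮⇒≥ x≮ε

-- After squaring, the numerator is linear in n while the denominator is quadratic; 2 bounds (n + 2)
-- / (n + 1). The added 1 in 1 + 2 C makes this number invertible even for C = 0.
square-small : ∀ {C D δ x} n N → 0ℚ ≤ C → 0ℚ < 1ℚ + C * (1ℚ + 1ℚ) → (1ℚ + C * (1ℚ + 1ℚ)) * D ≡ 1ℚ →
               inv N < D * δ → N ℕ.≤ n → x * x ≤ C * nat (2 ℕ.+ n) → x * inv n * (x * inv n) < δ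
square-small {C} {D} {δ} {x} n N 0≤C 0<K KD≡1 inv< N≤n h = begin-strict
  x * inv n * (x * inv n)
    ≡⟨ solve 2 (λ a i → a :* i :* (a :* i) := a :* a :* (i :* i)) refl x (inv n) ⟩
  x * x * (inv n * inv n)
    ≤⟨ ℚ.*-monoʳ-≤-nonNeg (inv n * inv n) {{nonNegative (0≤* (0≤inv n) (0≤inv n))}} h ⟩
  C * nat (2 ℕ.+ n) * (inv n * inv n)
    ≡⟨ solve 3 (λ c k i → c :* k :* (i :* i) := c :* (k :* i) :* i) refl C (nat (2 ℕ.+ n)) (inv n) ⟩
  C * (nat (2 ℕ.+ n) * inv n) * inv n
    ≤⟨ ℚ.*-monoʳ-≤-nonNeg (inv n) {{nonNegative (0≤inv n)}}
         (ℚ.≤-trans (ℚ.*-monoˡ-≤-nonNeg C {{nonNegative 0≤C}} (nat*inv≤2 n)) (p≤q+p (C * (1ℚ + 1ℚ)) 0≤1)) ⟩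
  K * inv n
    ≤⟨ ℚ.*-monoˡ-≤-nonNeg K {{nonNegative (ℚ.<⇒≤ 0<K)}} (recip-anti (suc n) (suc N) (ℕ.s≤s N≤n)) ⟩
  K * inv N
    <⟨ ℚ.*-monoʳ-<-pos K {{positive 0<K}} inv< ⟩
  K * (D * δ)
    ≡⟨ trans (sym (ℚ.*-assoc K D δ)) (trans (cong (_* δ) KD≡1) (ℚ.*-identityˡ δ)) ⟩
  δ ∎
  where
  open ℚ.≤-Reasoning
  K = 1ℚ + C * (1ℚ + 1ℚ)

-- Squaring reduces the claim to ℓ n ^ k = O(n).
Õ-inv₁⇒Null : ∀ {z} → Õ inv₁ (λ M _ → z (suc M)) → Null z
Õ-inv₁⇒Null {z} (e , h) ε 0<ε =
  let C , 0≤C , g = Bound-linear (e ∙ e)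
      0<K         = ℚ.+-mono-<-≤ {0ℚ} {1ℚ} (ℚ.positive⁻¹ 1ℚ) (0≤* 0≤C (0≤+ 0≤1 0≤1))
      D , 0<D , p = recip (1ℚ + C * (1ℚ + 1ℚ)) 0<K
      N , inv<    = inv-small (D * (ε * ε)) (pos*pos D (ε * ε) 0<D (pos*pos ε ε 0<ε 0<ε))
  in suc N , λ where
    (suc n) (ℕ.s≤s N≤n) → ℚ.≤-<-trans (h n 0 ℕ.z≤n)
      (square-cancel-< 0<ε (square-small {C} {D} {x = ⟦ e ⟧ (ℓ (suc n))} n N 0≤C 0<K p inv< N≤n (g (suc n))))

-- This is the source of the convergence claim: b will be a polynomial in truncated zeta values,
-- already known to be Cauchy.
Null-difference⇒Cauchy : ∀ {a b} → Cauchy b → Null (λ n → a n - b n) → Cauchy a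
Null-difference⇒Cauchy {a} {b} cb null ε 0<ε
  with cb (½ * ε) (half-pos ε 0<ε) | null (½ * (½ * ε)) (half-pos (½ * ε) (half-pos ε 0<ε))
... | M , g | N , h = M ℕ.⊔ N , λ m n m≥ n≥ → begin-strict
  ∣ a m - a n ∣
    ≡⟨ cong ∣_∣ (solve 4 (λ a b c d → a :- c := (b :- d) :+ ((a :- b) :- (c :- d))) refl (a m) (b m) (a n) (b n)) ⟩
  ∣ (b m - b n) + ((a m - b m) - (a n - b n)) ∣
    ≤⟨ ℚ.≤-trans (ℚ.∣p+q∣≤∣p∣+∣q∣ (b m - b n) _) (ℚ.+-monoʳ-≤ ∣ b m - b n ∣ (ℚ.∣p-q∣≤∣p∣+∣q∣ (a m - b m) (a n - b n))) ⟩
  ∣ b m - b n ∣ + (∣ a m - b m ∣ + ∣ a n - b n ∣)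
    <⟨ ℚ.+-mono-< (g m n (ℕ.m⊔n≤o⇒m≤o M N m≥) (ℕ.m⊔n≤o⇒m≤o M N n≥))
         (ℚ.+-mono-< (h m (ℕ.m⊔n≤o⇒n≤o M N m≥)) (h n (ℕ.m⊔n≤o⇒n≤o M N n≥))) ⟩
  ½ * ε + (½ * (½ * ε) + ½ * (½ * ε))
    ≡⟨ cong (½ * ε +_) (half+half (½ * ε)) ⟩
  ½ * ε + ½ * ε
    ≡⟨ half+half ε ⟩
  ε ∎
  where open ℚ.≤-Reasoning

-- The series as a coefficient of a Newton series

rising-coeff : ∀ n r → 𝕏.rising (node 0 ⊕ const 1ℚ) n r ≡ ζ[ n ] (ones r)
rising-coeff zero    zero    = refl
rising-coeff zero    (suc r) = refl
rising-coeff (suc n) r = trans (⊛-const (u ⊛ (t ⊕ 𝕏.ι (nat n))) (inv n) r) (go r)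
  where
  t = node 0 ⊕ const 1ℚ
  u = 𝕏.rising t n

  lin : t ⊕ 𝕏.ι (nat n) ≋ const (nat (suc n)) ⊕ X.X
  lin zero          = solve 1 (λ n → con 0ℚ :+ con 0ℚ :+ con 1ℚ :+ n := con 1ℚ :+ n :+ con 0ℚ) refl (nat n)
  lin (suc zero)    = refl
  lin (suc (suc r)) = refl

  go : ∀ r → (u ⊛ (t ⊕ 𝕏.ι (nat n))) r * inv n ≡ ζ[ suc n ] (ones r)
  go zero    = trans (cong (_* inv n) (linear₀ u (nat (suc n)) _ lin))
    (trans (ℚ.*-comm _ (inv n)) (trans (inv*nat* n (u 0)) (rising-coeff n 0)))
  -- The new factor of the product is 1 + x / (n + 1); its term in x accounts for the summands of
  -- the harmonic sum with n₁ = n + 1.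
  go (suc r) = trans (cong (_* inv n) (linearₛ u (nat (suc n)) _ lin r))
    (trans (solve 4 (λ k a b i → (k :* a :+ b) :* i := i :* (k :* a) :+ i :* b) refl (nat (suc n)) (u (suc r)) (u r) (inv n))
    (cong₂ _+_ (trans (inv*nat* n (u (suc r))) (rising-coeff n (suc r)))
               (cong₂ _*_ (sym (trans (1/^≡inv^^ n 1) (ℚ.*-identityʳ (inv n)))) (rising-coeff n r))))

rising-coeffₛ : ∀ n r → 𝕏.rising (node 0) (suc n) (suc r) ≡ inv n * ζ[ n ] (ones r)
rising-coeffₛ n r = nat*-injective n _ _ (begin
  nat (suc n) * 𝕏.rising t (suc n) (suc r)
    ≡⟨ X.const-⊛ (nat (suc n)) (𝕏.rising t (suc n)) (suc r) ⟨
  (𝕏.ι (nat (suc n)) ⊛ 𝕏.rising t (suc n)) (suc r)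
    ≡⟨ 𝕏.rising-shift t n (suc r) ⟨
  (t ⊛ u) (suc r)
    ≡⟨ X.⊛-comm t u (suc r) ⟩
  (u ⊛ t) (suc r)
    ≡⟨ linearₛ u 0ℚ t (λ { zero → refl ; (suc zero) → refl ; (suc (suc _)) → refl }) r ⟩
  0ℚ * u (suc r) + u r
    ≡⟨ solve 2 (λ a b → con 0ℚ :* a :+ b := b) refl (u (suc r)) (u r) ⟩
  u r
    ≡⟨ rising-coeff n r ⟩
  ζ[ n ] (ones r) ∎)
  where
  open ≡.≡-Reasoning
  t = node 0
  u = 𝕏.rising (t ⊕ const 1ℚ) n

summand : ℕ → Index → (n : ℕ) .{{_ : NonZero n}} → ℚ
summand r l n = ζ[ n ∸ 1 ] (ones r) * ζ⋆[ n ] l * 1/ n ^ 2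

-- The exponent 2 of the series is made of two factors `inv n`, one from the rising factorial and
-- one from the dual coefficients.
partialSum : ∀ m p r N → ∑ N (summand r (block m p)) ≡ newtonSeries m N (node 0) (suc p) (suc r)
partialSum m p r N = sym (trans (Σ<-coeff N (λ n → 𝕏.rising (node 0) (suc n) ⊛ const (dual (level m p) n)) (suc r))
  (Σ<≡∑ N λ n → trans (⊛-const (𝕏.rising (node 0) (suc n)) (dual (level m p) n) (suc r))
    (trans (cong₂ _*_ (rising-coeffₛ n r) (level-dual m p n))
    (trans (solve 3 (λ i a b → i :* a :* (i :* b) := a :* b :* (i :* (i :* con 1ℚ))) refl (inv n) (ζ[ n ] (ones r)) (ζ⋆[ suc n ] (block m p)))
           (cong (ζ[ n ] (ones r) * ζ⋆[ suc n ] (block m p) *_) (sym (1/^≡inv^^ n 2)))))))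

theorem3p6 : ∀ (r m p : ℕ) .{{_ : NonZero r}} .{{_ : NonZero m}} .{{_ : NonZero p}} →
    let ls = ((1 ∷ []) ×× (m ∸ 1) ++ 2 ∷ []) ×× (p ∸ 1) ++ (1 ∷ []) ×× m
    in ∃[ x ] ( x ≃ζ⟨ 1 ∷ (1 ∷ []) ×× (r ∸ 1) ⊛ 1 ∷ ls ⋆⟩
    × (λ n → ζ[ n ∸ 1 ] ((1 ∷ []) ×× (r ∸ 1)) * ζ⋆[ n ] ls * 1/ n ^ 2) SumsTo x
    × x ∈ℚ[ζ] )
-- The value is taken to be `eval P` itself, so membership in ℚ[ζ] is reflexivity and the content
-- lies in `sums`. Both forms of the series unfold to the same summand.
theorem3p6 (suc r) (suc m) (suc p) = eval P , sums , sums , P , λ ε 0<ε → 0 , λ n _ →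
    subst (_< ε) (sym (cong ∣_∣ (ℚ.+-inverseʳ (seq (eval P) n)))) 0<ε
  where
  open Product m using (V; asymptotics)

  -V : ZetaPolynomial (λ N → - V N (suc p) (suc r))
  -V = ZP-neg (V-ZP m (suc p) (suc r))

  P = proj₁ -V

  difference : Null (λ N → ∑ N (summand r (block m p)) - seq (eval P) N)
  difference = Õ-inv₁⇒Null (Õ-resp (λ M _ _ → cong₂ (λ a b → a + b)
      (sym (partialSum m p r (suc M)))
      (trans (sym (⁻¹-involutive (V (suc M) (suc p) (suc r)))) (cong -_ (proj₂ -V (suc M)))))
    (asymptotics (suc p) (suc r)))
    where open Algebra.Properties.Group ℚ.+-0-group using (⁻¹-involutive)

  sums : summand r (block m p) SumsTo eval P
  sums = Null-difference⇒Cauchy {λ N → ∑ N (summand r (block m p))} {seq (eval P)} (cauchy (eval P)) difference , difference
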